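{- Let $m$ and $n$ be positive integers, let $0\le k\le m$, and put $\kappa:=m+n$. For $r\ge1$ let $(m^r,k)$ denote the partition with $r$ parts equal to $m$ followed by one part equal to $k$ (when $k=0$ this is the partition with $r$ parts equal to $m$). Then, as formal power series in $q$ (coefficientwise limit), \[ \lim_{r\to\infty} q^{ -m\binom{r}{2}-kr}\, Q_{(m^r,k)}\big(1,q,q^2,\dots;q^n\big) =\frac{(q^n;q^n)_{\infty}(q^{\kappa};q^{\kappa})_{\infty}^{n-1}}{(q;q)_{\infty}^n}\prod_{i=1}^{n-1}\theta\big(q^{i+k};q^{\kappa}\big)\prod_{1\le i<j\le n-1}\theta\big(q^{j-i};q^{\kappa}\big). \]
   Context: $(a;q)_k=\prod_{j=0}^{k-1}(1-aq^j)$, $(a;q)_\infty=\prod_{j\ge0}(1-aq^j)$, $\theta(a;q):=(a;q)_\infty(q/a;q)_\infty$. Hall–Littlewood polynomials: for variables $x=(x_1,\dots,x_N)$, a parameter $t$ and a partition $\lambda$ with at most $N$ nonzero parts, let $m_i=m_i(\lambda)$ be the number of parts equal to $i$ ($m_0:=N-$ number of nonzero parts), $v_\lambda(t)=\prod_{i\ge0}(t;t)_{m_i}/(1-t)^{m_i}$, and $P_\lambda(x;t)=\frac{1}{v_\lambda(t)}\sum_{w\in\mathfrak S_N} w\Big(x_1^{\lambda_1}\cdots x_N^{\lambda_N}\prod_{i<j}\frac{x_i-tx_j}{x_i-x_j}\Big)$ ($P_\lambda:=0$ if $\lambda$ has more than $N$ nonzero parts). Further $Q_\lambda(x;t):=b_\lambda(t)P_\lambda(x;t)$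 with $b_\lambda(t):=\prod_{i\ge1}(t;t)_{m_i(\lambda)}$. $Q_\lambda(1,q,q^2,\dots;t)$ denotes the specialization at $x_i=q^{i-1}$, $i\ge1$, of the corresponding symmetric function (the $N\to\infty$ limit of $Q_\lambda(1,q,\dots,q^{N-1};t)$). Here $t=q^n$. -}

module Defs where

open import Data.Bool using (Bool; true; false; if_then_else_)
open import Data.Nat as ℕ using (ℕ; zero; suc; _≡ᵇ_; _<ᵇ_; _≤ᵇ_; _⊔_)
open import Data.Integer as ℤ using (ℤ; +_; -[1+_]; _+_; _*_; -_; _-_)
open import Data.List using (List; []; _∷_; _++_; map; foldr; zipWith; replicate; concatMap; length; upTo)
open import Data.Nat.Combinatorics using (_C_)

PS : Set
PS = ℕ → ℤ

sumℤ : List ℤ → ℤ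
sumℤ = foldr _+_ (+ 0)

sumℕ : List ℕ → ℕ
sumℕ = foldr ℕ._+_ 0

zeroPS : PS
zeroPS _ = + 0

onePS : PS
onePS zero    = + 1
onePS (suc _) = + 0

mono : ℕ → PS
mono a d = if a ≡ᵇ d then + 1 else + 0

infixl 6 _⊕_ _⊖_
infixl 7 _⊛_

_⊕_ : PS → PS → PS
(f ⊕ g) d = f d + g d

_⊖_ : PS → PS → PS
(f ⊖ g) d = f d - g d

_⊛_ : PS → PS → PS
(f ⊛ g) d = sumℤ (map (λ i → f i * g (d ℕ.∸ i)) (upTo (suc d)))

prodL : List PS → PS
prodL = foldr _⊛_ onePS

sumL : List PS → PS
sumL = foldr _⊕_ zeroPS

powPS : PS → ℕ → PS
powPS f zero    = onePS
powPS f (suc e) = f ⊛ powPS f e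

-- multiplicative inverse of a series f with constant term f 0 = 1.
-- invRev f d = [g d, g (d-1), ..., g 0] where g = f⁻¹, computed by the
-- recursion g 0 = 1, g (d+1) = - Σ_{j=1}^{d+1} f j * g (d+1-j).
invRev : PS → ℕ → List ℤ
invRev f zero    = + 1 ∷ []
invRev f (suc d) =
  let l = invRev f d in
  (- sumℤ (zipWith _*_ (map (λ i → f (suc i)) (upTo (suc d))) l)) ∷ l

inv : PS → PS
inv f d with invRev f d
... | []    = + 0
... | c ∷ _ = c

range : ℕ → ℕ → List ℕ
range a b = map (a ℕ.+_) (upTo (suc b ℕ.∸ a))

pochFin : ℕ → ℕ → ℕ → PS
pochFin a b K = prodL (map (λ j → onePS ⊖ mono (a ℕ.+ b ℕ.* j)) (upTo K))

-- infinite (q^a ; q^b)_∞  for a ≥ 1, b ≥ 1, as a formal power series: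
-- its coefficient of q^d is that of the partial product over j = 0..d
-- (all further factors are ≡ 1 mod q^{d+1}).
poch∞ : ℕ → ℕ → PS
poch∞ a b d = pochFin a b (suc d) d

-- θ(q^a ; q^c) = (q^a;q^c)_∞ (q^{c-a};q^c)_∞   (used with 0 < a < c)
theta : ℕ → ℕ → PS
theta a c = poch∞ a c ⊛ poch∞ (c ℕ.∸ a) c

inserts : ℕ → List ℕ → List (List ℕ)
inserts x []       = (x ∷ []) ∷ []
inserts x (y ∷ ys) = (x ∷ y ∷ ys) ∷ map (y ∷_) (inserts x ys)

perms : List ℕ → List (List ℕ)
perms []       = [] ∷ []
perms (x ∷ xs) = concatMap (inserts x) (perms xs)

-- The factor (x_A - t x_B)/(x_A - x_B) at x_A = q^a, x_B = q^b, t = q^n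
-- (a ≠ b), expanded in ℤ[[q]]:
--   a < b :  (1 - q^{n+b-a}) / (1 - q^{b-a})
--   a > b :  (q^n - q^{a-b}) / (1 - q^{a-b})
hlFactor : ℕ → ℕ → ℕ → PS
hlFactor n a b =
  if a <ᵇ b
  then (onePS ⊖ mono (n ℕ.+ (b ℕ.∸ a))) ⊛ inv (onePS ⊖ mono (b ℕ.∸ a))
  else (mono n ⊖ mono (a ℕ.∸ b)) ⊛ inv (onePS ⊖ mono (a ℕ.∸ b))

-- Π_{i<j} (x_{w i} - t x_{w j})/(x_{w i} - x_{w j}) where the list gives
-- the exponents (w(1)-1, ..., w(N)-1), i.e. x_{w i} = q^{w(i)-1}
pairProd : ℕ → List ℕ → PS
pairProd n []       = onePS
pairProd n (a ∷ as) = prodL (map (hlFactor n a) as) ⊛ pairProd n as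

-- Σ_{w ∈ S_N} w( x_1^{λ_1} ⋯ x_N^{λ_N} Π_{i<j} (x_i - t x_j)/(x_i - x_j) )
-- at x_i = q^{i-1}, t = q^n; lam is λ padded with zeros to length N
symSum : ℕ → ℕ → List ℕ → PS
symSum n N lam =
  sumL (map (λ w → mono (sumℕ (zipWith ℕ._*_ lam w)) ⊛ pairProd n w)
            (perms (upTo N)))

count : ℕ → List ℕ → ℕ
count i []       = 0
count i (x ∷ xs) = if x ≡ᵇ i then suc (count i xs) else count i xs

maxPart : List ℕ → ℕ
maxPart = foldr _⊔_ 0

tPoch : ℕ → ℕ → PS
tPoch n μ = prodL (map (λ j → onePS ⊖ mono (n ℕ.* suc j)) (upTo μ))

vFactor : ℕ → ℕ → PS
vFactor n μ = tPoch n μ ⊛ inv (powPS (onePS ⊖ mono n) μ)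

-- A partition is given by its list of nonzero parts (weakly decreasing).
-- padded to N entries (m_0 = N - ℓ(λ))
pad : ℕ → List ℕ → List ℕ
pad N lam = lam ++ replicate (N ℕ.∸ length lam) 0

vλ : ℕ → ℕ → List ℕ → PS
vλ n N lam = prodL (map (λ i → vFactor n (count i (pad N lam))) (upTo (suc (maxPart lam))))

bλ : ℕ → List ℕ → PS
bλ n lam = prodL (map (λ i → tPoch n (count i lam)) (range 1 (maxPart lam)))

hlP : ℕ → ℕ → List ℕ → PS
hlP n N lam =
  if length lam ≤ᵇ N
  then inv (vλ n N lam) ⊛ symSum n N (pad N lam)
  else zeroPS

hlQ : ℕ → ℕ → List ℕ → PS
hlQ n N lam = bλ n lam ⊛ hlP n N lam

mrk : ℕ → ℕ → ℕ → List ℕ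
mrk m r k = replicate r m ++ (if k ≡ᵇ 0 then [] else k ∷ [])

coeffℤ : PS → ℤ → ℤ
coeffℤ f (+ d)     = f d
coeffℤ f -[1+ _ ]  = + 0

shiftExp : ℕ → ℕ → ℕ → ℕ
shiftExp m k r = m ℕ.* (r C 2) ℕ.+ k ℕ.* r

rhs41 : ℕ → ℕ → ℕ → PS
rhs41 m n k =
  let κ = m ℕ.+ n in
  poch∞ n n
  ⊛ powPS (poch∞ κ κ) (n ℕ.∸ 1)
  ⊛ powPS (inv (poch∞ 1 1)) n
  ⊛ prodL (map (λ i → theta (i ℕ.+ k) κ) (range 1 (n ℕ.∸ 1)))
  ⊛ prodL (concatMap (λ i → map (λ j → theta (j ℕ.∸ i) κ) (range (suc i) (n ℕ.∸ 1)))
                     (range 1 (n ℕ.∸ 1)))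

-- With t = q^n and x_a = q^a the factor (x_a − t x_b)/(x_a − x_b) vanishes for a = b + n, so an
-- ordering of the alphabet contributes only if it uses every residue class modulo n in increasing
-- order.  For N → ∞ the products telescope along the classes, and Q becomes a sum over the
-- compositions c of r, where c_y counts the letters of the class of y that carry the part m.
-- A partial fraction identity gives the recursion in r behind this sum; for a general modulus M,
-- general labels y and m = 0 the same recursion shows that the analogous sum is 1/(q^M; q^M)_r.
-- As r → ∞ the denominators of the summands become theta products independent of c, and what is
-- left is a sum over c of Vandermonde-like determinants.  For the modulus n with the labels
-- 0, …, n − 1 and the modulus κ with the labels k + n − 1, n − 2, …, 0 these determinants are
-- transposes of each other, up to a power of q.  Hence the sum for Q equals q^{m C(r,2) + k r}
-- times the sum for κ, whose value is known.

module Submission where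

open import Defs
open import Data.Bool using (true; false; if_then_else_)
open import Data.Nat using (ℕ; zero; suc; _+_; _*_; _∸_; _≤_; _<_; z≤n; s≤s; _≡ᵇ_; _<ᵇ_; _≤ᵇ_; _⊔_; >-nonZero)
open import Data.Nat.Properties
open import Data.Nat.Combinatorics using (_C_; nC1≡n; nCk+nC[k+1]≡[n+1]C[k+1])
open import Data.Nat.DivMod using (_/_; _%_; m≡m%n+[m/n]*n; m%n<n; m*n/n≡m; /-monoˡ-≤)
open import Data.Nat.Solver using () renaming (module +-*-Solver to ℕ-Solver)
open import Data.Integer.Solver using () renaming (module +-*-Solver to ℤ-Solver)
open import Data.Integer as ℤ using (ℤ; -[1+_])
import Data.Integer.Properties as ℤᵖ
open import Data.List using (List; []; _∷_; _++_; map; foldr; zipWith; replicate; concatMap; length; upTo; applyUpTo; downFrom)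
open import Data.List.Properties using (∷-injective; map-upTo; length-upTo; map-∘; map-cong; ++-assoc; ++-identityʳ; length-++; length-map; length-replicate; reverse-upTo; upTo-∷ʳ)
open import Data.List.Membership.Propositional using (_∈_)
open import Data.List.Membership.Propositional.Properties using (∈-++⁺ˡ; ∈-++⁺ʳ)
open import Data.List.Relation.Unary.Any using (here; there)
open import Data.List.Relation.Unary.All as All using (All; []; _∷_)
import Data.List.Relation.Unary.All.Properties as Allᵖ
import Data.List.Relation.Unary.AllPairs.Properties as AllPairsᵖ
open import Data.List.Relation.Unary.AllPairs as AllPairs using (AllPairs; []; _∷_)
open import Data.List.Relation.Binary.Permutation.Propositional as ↭ using (_↭_; ↭-refl; ↭-sym; ↭-trans; prep; swap)
import Data.List.Relation.Binary.Permutation.Propositional.Properties as ↭ᵖ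
import Data.Maybe as Maybe
open import Data.Product using (_×_; _,_; proj₁; proj₂; ∃-syntax)
open import Data.Sum using (_⊎_; inj₁; inj₂)
open import Data.Empty using (⊥-elim)
open import Function using (_∘_; id; flip)
open import Relation.Nullary using (contradiction)
open import Relation.Nullary.Decidable using (dec⇒maybe)
open import Relation.Binary using (tri<; tri≈; tri>; Setoid)
open import Relation.Binary.PropositionalEquality using (_≡_; _≢_; refl; sym; trans; cong; cong₂; subst; subst₂; module ≡-Reasoning)
open import Algebra.Bundles using (CommutativeRing)
import Algebra.Solver.Ring
open import Algebra.Solver.Ring.AlmostCommutativeRing using (fromCommutativeRing; _-Raw-AlmostCommutative⟶_)
import Relation.Binary.Reasoning.Setoid
open import Level using (0ℓ)

-- Formal power series as a commutative ring

-- With X_a = q^a, the factors of the symmetrizing sum have the form 1 - s · K for the kernel X_a /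
-- (X_a - X_b), so one partial fraction expansion yields the normalisation of P, the recursion in r
-- and the kernel sums that equal 1. The determinants arise as bialternants: the last letter, with
-- part k, contributes the complete homogeneous polynomial h_k in the powers q^position, and its
-- Vandermonde denominator cancels against the binomials to which the pair factors reduce. In the
-- sum for κ the constant 1 is written in the same way. The obstacle is uniformity: the number of
-- compositions grows with r, and so does the power of q to be divided out. Limits are therefore
-- congruences modulo q^(shift r + K). The r + 1 letters are distinct, so for k ≤ m every summand is
-- itself divisible by q^(shift r), and the other factors matter only modulo q^K. Once r ≥ 2 n K, a
-- composition with an entry below K also has one of at least 2 K, and then both `U` and the
-- numerators that replace it vanish modulo q^K.

tail : PS → PS
tail f d = f (suc d)

private
  sumTo : (ℕ → ℤ) → ℕ → ℤ
  sumTo h zero    = ℤ.+ 0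
  sumTo h (suc n) = h 0 ℤ.+ sumTo (h ∘ suc) n

  sumℤ-upTo : ∀ h n → sumℤ (map h (upTo n)) ≡ sumTo h n
  sumℤ-upTo h n = trans (cong sumℤ (map-upTo h n)) (go h n)
    where
    go : ∀ h n → sumℤ (applyUpTo h n) ≡ sumTo h n
    go h zero    = refl
    go h (suc n) = cong (ℤ._+_ (h 0)) (go (h ∘ suc) n)

⊛-zero : ∀ f g → (f ⊛ g) 0 ≡ f 0 ℤ.* g 0
⊛-zero f g = ℤᵖ.+-identityʳ _

⊛-suc : ∀ f g d → (f ⊛ g) (suc d) ≡ f 0 ℤ.* g (suc d) ℤ.+ (tail f ⊛ g) d
⊛-suc f g d = begin
  (f ⊛ g) (suc d)                                       ≡⟨ sumℤ-upTo (λ i → f i ℤ.* g (suc d ∸ i)) (suc (suc d)) ⟩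
  f 0 ℤ.* g (suc d) ℤ.+ sumTo (λ i → f (suc i) ℤ.* g (d ∸ i)) (suc d)
    ≡⟨ cong (ℤ._+_ (f 0 ℤ.* g (suc d))) (sumℤ-upTo (λ i → f (suc i) ℤ.* g (d ∸ i)) (suc d)) ⟨
  f 0 ℤ.* g (suc d) ℤ.+ (tail f ⊛ g) d                  ∎
  where open ≡-Reasoning

⊛-at-cong : ∀ {f f′ g g′} d → (∀ i → i ≤ d → f i ≡ f′ i) → (∀ i → i ≤ d → g i ≡ g′ i) → (f ⊛ g) d ≡ (f′ ⊛ g′) d
⊛-at-cong {f} {f′} {g} {g′} zero p q =
  trans (⊛-zero f g) (trans (cong₂ ℤ._*_ (p 0 z≤n) (q 0 z≤n)) (sym (⊛-zero f′ g′)))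
⊛-at-cong {f} {f′} {g} {g′} (suc d) p q = trans (⊛-suc f g d)
  (trans (cong₂ ℤ._+_ (cong₂ ℤ._*_ (p 0 z≤n) (q (suc d) ≤-refl))
                      (⊛-at-cong {tail f} {tail f′} {g} {g′} d (λ i i≤d → p (suc i) (s≤s i≤d)) (λ i i≤d → q i (m≤n⇒m≤1+n i≤d))))
         (sym (⊛-suc f′ g′ d)))

private
  ⊛-distribʳ-at : ∀ f g h d → ((f ⊕ g) ⊛ h) d ≡ (f ⊛ h) d ℤ.+ (g ⊛ h) d
  ⊛-distribʳ-at f g h zero = begin
    ((f ⊕ g) ⊛ h) 0               ≡⟨ ⊛-zero (f ⊕ g) h ⟩
    (f 0 ℤ.+ g 0) ℤ.* h 0         ≡⟨ ℤᵖ.*-distribʳ-+ (h 0) (f 0) (g 0) ⟩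
    f 0 ℤ.* h 0 ℤ.+ g 0 ℤ.* h 0   ≡⟨ cong₂ ℤ._+_ (⊛-zero f h) (⊛-zero g h) ⟨
    (f ⊛ h) 0 ℤ.+ (g ⊛ h) 0       ∎
    where open ≡-Reasoning
  ⊛-distribʳ-at f g h (suc d) = begin
    ((f ⊕ g) ⊛ h) (suc d)                                      ≡⟨ ⊛-suc (f ⊕ g) h d ⟩
    (f 0 ℤ.+ g 0) ℤ.* h (suc d) ℤ.+ ((tail f ⊕ tail g) ⊛ h) d  ≡⟨ cong (ℤ._+_ ((f 0 ℤ.+ g 0) ℤ.* h (suc d))) (⊛-distribʳ-at (tail f) (tail g) h d) ⟩
    (f 0 ℤ.+ g 0) ℤ.* h (suc d) ℤ.+ ((tail f ⊛ h) d ℤ.+ (tail g ⊛ h) d)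
      ≡⟨ solve 5 (λ a b c x y → (a :+ b) :* c :+ (x :+ y) := (a :* c :+ x) :+ (b :* c :+ y)) refl (f 0) (g 0) (h (suc d)) ((tail f ⊛ h) d) ((tail g ⊛ h) d) ⟩
    (f 0 ℤ.* h (suc d) ℤ.+ (tail f ⊛ h) d) ℤ.+ (g 0 ℤ.* h (suc d) ℤ.+ (tail g ⊛ h) d)
      ≡⟨ cong₂ ℤ._+_ (⊛-suc f h d) (⊛-suc g h d) ⟨
    (f ⊛ h) (suc d) ℤ.+ (g ⊛ h) (suc d) ∎
    where open ≡-Reasoning
          open ℤ-Solver

  scale : ℤ → PS → PS
  scale z f d = z ℤ.* f d

  scale-⊛-at : ∀ z f g d → (scale z f ⊛ g) d ≡ z ℤ.* (f ⊛ g) d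
  scale-⊛-at z f g zero = trans (⊛-zero (scale z f) g) (trans (ℤᵖ.*-assoc z (f 0) (g 0)) (cong (ℤ._*_ z) (sym (⊛-zero f g))))
  scale-⊛-at z f g (suc d) = begin
    (scale z f ⊛ g) (suc d)                                        ≡⟨ ⊛-suc (scale z f) g d ⟩
    z ℤ.* f 0 ℤ.* g (suc d) ℤ.+ (scale z (tail f) ⊛ g) d           ≡⟨ cong (ℤ._+_ (z ℤ.* f 0 ℤ.* g (suc d))) (scale-⊛-at z (tail f) g d) ⟩
    z ℤ.* f 0 ℤ.* g (suc d) ℤ.+ z ℤ.* (tail f ⊛ g) d
      ≡⟨ solve 4 (λ z a b x → z :* a :* b :+ z :* x := z :* (a :* b :+ x)) refl z (f 0) (g (suc d)) ((tail f ⊛ g) d) ⟩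
    z ℤ.* (f 0 ℤ.* g (suc d) ℤ.+ (tail f ⊛ g) d)                   ≡⟨ cong (ℤ._*_ z) (⊛-suc f g d) ⟨
    z ℤ.* (f ⊛ g) (suc d)                                          ∎
    where open ≡-Reasoning
          open ℤ-Solver

  -- Peels off the last term where `⊛-suc` peels off the first; the two together make commutativity
  -- an induction.
  ⊛-suc′ : ∀ f g d → (f ⊛ g) (suc d) ≡ f (suc d) ℤ.* g 0 ℤ.+ (f ⊛ tail g) d
  ⊛-suc′ f g zero = begin
    (f ⊛ g) 1                               ≡⟨ ⊛-suc f g 0 ⟩
    f 0 ℤ.* g 1 ℤ.+ (tail f ⊛ g) 0          ≡⟨ cong (ℤ._+_ (f 0 ℤ.* g 1)) (⊛-zero (tail f) g) ⟩
    f 0 ℤ.* g 1 ℤ.+ f 1 ℤ.* g 0             ≡⟨ ℤᵖ.+-comm (f 0 ℤ.* g 1) _ ⟩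
    f 1 ℤ.* g 0 ℤ.+ f 0 ℤ.* g 1             ≡⟨ cong (ℤ._+_ (f 1 ℤ.* g 0)) (⊛-zero f (tail g)) ⟨
    f 1 ℤ.* g 0 ℤ.+ (f ⊛ tail g) 0          ∎
    where open ≡-Reasoning
  ⊛-suc′ f g (suc d) = begin
    (f ⊛ g) (2 + d)                                                             ≡⟨ ⊛-suc f g (suc d) ⟩
    f 0 ℤ.* g (2 + d) ℤ.+ (tail f ⊛ g) (suc d)                                  ≡⟨ cong (ℤ._+_ (f 0 ℤ.* g (2 + d))) (⊛-suc′ (tail f) g d) ⟩
    f 0 ℤ.* g (2 + d) ℤ.+ (f (2 + d) ℤ.* g 0 ℤ.+ (tail f ⊛ tail g) d)
      ≡⟨ solve 3 (λ x y z → x :+ (y :+ z) := y :+ (x :+ z)) refl (f 0 ℤ.* g (2 + d)) (f (2 + d) ℤ.* g 0) ((tail f ⊛ tail g) d) ⟩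
    f (2 + d) ℤ.* g 0 ℤ.+ (f 0 ℤ.* g (2 + d) ℤ.+ (tail f ⊛ tail g) d)           ≡⟨ cong (ℤ._+_ (f (2 + d) ℤ.* g 0)) (⊛-suc f (tail g) d) ⟨
    f (2 + d) ℤ.* g 0 ℤ.+ (f ⊛ tail g) (suc d)                                  ∎
    where open ≡-Reasoning
          open ℤ-Solver

  ⊛-comm-at : ∀ f g d → (f ⊛ g) d ≡ (g ⊛ f) d
  ⊛-comm-at f g zero    = trans (⊛-zero f g) (trans (ℤᵖ.*-comm (f 0) (g 0)) (sym (⊛-zero g f)))
  ⊛-comm-at f g (suc d) = trans (⊛-suc f g d)
    (trans (cong₂ ℤ._+_ (ℤᵖ.*-comm (f 0) (g (suc d))) (⊛-comm-at (tail f) g d)) (sym (⊛-suc′ g f d)))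

  ⊛-assoc-at : ∀ f g h d → ((f ⊛ g) ⊛ h) d ≡ (f ⊛ (g ⊛ h)) d
  ⊛-assoc-at f g h zero = begin
    ((f ⊛ g) ⊛ h) 0          ≡⟨ ⊛-zero (f ⊛ g) h ⟩
    (f ⊛ g) 0 ℤ.* h 0        ≡⟨ cong (ℤ._* h 0) (⊛-zero f g) ⟩
    f 0 ℤ.* g 0 ℤ.* h 0      ≡⟨ ℤᵖ.*-assoc (f 0) (g 0) (h 0) ⟩
    f 0 ℤ.* (g 0 ℤ.* h 0)    ≡⟨ cong (ℤ._*_ (f 0)) (⊛-zero g h) ⟨
    f 0 ℤ.* (g ⊛ h) 0        ≡⟨ ⊛-zero f (g ⊛ h) ⟨
    (f ⊛ (g ⊛ h)) 0          ∎
    where open ≡-Reasoning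
  ⊛-assoc-at f g h (suc d) = begin
    ((f ⊛ g) ⊛ h) (suc d)
      ≡⟨ ⊛-suc (f ⊛ g) h d ⟩
    (f ⊛ g) 0 ℤ.* h (suc d) ℤ.+ (tail (f ⊛ g) ⊛ h) d
      ≡⟨ cong₂ (λ x y → x ℤ.* h (suc d) ℤ.+ y) (⊛-zero f g) (⊛-at-cong {g = h} d (λ i _ → ⊛-suc f g i) (λ _ _ → refl)) ⟩
    f 0 ℤ.* g 0 ℤ.* h (suc d) ℤ.+ ((scale (f 0) (tail g) ⊕ (tail f ⊛ g)) ⊛ h) d
      ≡⟨ cong (ℤ._+_ (f 0 ℤ.* g 0 ℤ.* h (suc d))) (⊛-distribʳ-at (scale (f 0) (tail g)) (tail f ⊛ g) h d) ⟩
    f 0 ℤ.* g 0 ℤ.* h (suc d) ℤ.+ ((scale (f 0) (tail g) ⊛ h) d ℤ.+ ((tail f ⊛ g) ⊛ h) d)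
      ≡⟨ cong₂ (λ x y → f 0 ℤ.* g 0 ℤ.* h (suc d) ℤ.+ (x ℤ.+ y)) (scale-⊛-at (f 0) (tail g) h d) (⊛-assoc-at (tail f) g h d) ⟩
    f 0 ℤ.* g 0 ℤ.* h (suc d) ℤ.+ (f 0 ℤ.* (tail g ⊛ h) d ℤ.+ (tail f ⊛ (g ⊛ h)) d)
      ≡⟨ solve 5 (λ a b c x y → a :* b :* c :+ (a :* x :+ y) := a :* (b :* c :+ x) :+ y) refl (f 0) (g 0) (h (suc d)) ((tail g ⊛ h) d) ((tail f ⊛ (g ⊛ h)) d) ⟩
    f 0 ℤ.* (g 0 ℤ.* h (suc d) ℤ.+ (tail g ⊛ h) d) ℤ.+ (tail f ⊛ (g ⊛ h)) d
      ≡⟨ cong (λ x → f 0 ℤ.* x ℤ.+ (tail f ⊛ (g ⊛ h)) d) (⊛-suc g h d) ⟨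
    f 0 ℤ.* (g ⊛ h) (suc d) ℤ.+ (tail f ⊛ (g ⊛ h)) d
      ≡⟨ ⊛-suc f (g ⊛ h) d ⟨
    (f ⊛ (g ⊛ h)) (suc d) ∎
    where open ≡-Reasoning
          open ℤ-Solver

  zero-⊛-at : ∀ g d → (zeroPS ⊛ g) d ≡ ℤ.+ 0
  zero-⊛-at g zero    = ⊛-zero zeroPS g
  zero-⊛-at g (suc d) = trans (⊛-suc zeroPS g d) (trans (ℤᵖ.+-identityˡ _) (zero-⊛-at g d))

  one-⊛-at : ∀ g d → (onePS ⊛ g) d ≡ g d
  one-⊛-at g zero    = trans (⊛-zero onePS g) (ℤᵖ.*-identityˡ (g 0))
  one-⊛-at g (suc d) = trans (⊛-suc onePS g d)
    (trans (cong₂ ℤ._+_ (ℤᵖ.*-identityˡ (g (suc d))) (zero-⊛-at g d)) (ℤᵖ.+-identityʳ _))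

infix 4 _≈_
infixl 6 _⊞_ _⊟_
infixl 7 _·_

-- Without η, series expressions stay neutral instead of unfolding to coefficient functions.
record Series : Set where
  no-eta-equality
  constructor series
  field coef : PS
open Series

record _≈_ (f g : Series) : Set where
  constructor pw
  field at : ∀ d → coef f d ≡ coef g d
open _≈_

𝟘 𝟙 : Series
coef 𝟘 = zeroPS
coef 𝟙 = onePS

_⊞_ _⊟_ _·_ : Series → Series → Series
coef (f ⊞ g) = coef f ⊕ coef g
coef (f · g) = coef f ⊛ coef g

neg : Series → Series
coef (neg f) d = ℤ.- coef f d

f ⊟ g = f ⊞ neg g

≈-refl : ∀ {f} → f ≈ f
≈-refl .at d = refl

≈-sym : ∀ {f g} → f ≈ g → g ≈ f
≈-sym p .at d = sym (at p d)

≈-trans : ∀ {f g h} → f ≈ g → g ≈ h → f ≈ h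
≈-trans p q .at d = trans (at p d) (at q d)

≡⇒≈ : ∀ {f g} → f ≡ g → f ≈ g
≡⇒≈ refl = ≈-refl

+-cong : ∀ {f f′ g g′} → f ≈ f′ → g ≈ g′ → f ⊞ g ≈ f′ ⊞ g′
+-cong p q .at d = cong₂ ℤ._+_ (at p d) (at q d)

·-cong : ∀ {f f′ g g′} → f ≈ f′ → g ≈ g′ → f · g ≈ f′ · g′
·-cong p q .at d = ⊛-at-cong d (λ i _ → at p i) (λ i _ → at q i)

neg-cong : ∀ {f f′} → f ≈ f′ → neg f ≈ neg f′
neg-cong p .at d = cong ℤ.-_ (at p d)

·-comm : ∀ f g → f · g ≈ g · f
·-comm f g .at = ⊛-comm-at (coef f) (coef g)

·-identityˡ : ∀ f → 𝟙 · f ≈ f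
·-identityˡ f .at = one-⊛-at (coef f)

commutativeRing : CommutativeRing 0ℓ 0ℓ
commutativeRing = record
  { Carrier = Series ; _≈_ = _≈_ ; _+_ = _⊞_ ; _*_ = _·_ ; -_ = neg ; 0# = 𝟘 ; 1# = 𝟙
  ; isCommutativeRing = record
    { isRing = record
      { +-isAbelianGroup = record
        { isGroup = record
          { isMonoid = record
            { isSemigroup = record
              { isMagma = record
                { isEquivalence = record { refl = ≈-refl ; sym = ≈-sym ; trans = ≈-trans }
                ; ∙-cong = +-cong }
              ; assoc = λ f g h → pw λ d → ℤᵖ.+-assoc (coef f d) (coef g d) (coef h d) }
            ; identity = (λ f → pw λ d → ℤᵖ.+-identityˡ (coef f d)) , (λ f → pw λ d → ℤᵖ.+-identityʳ (coef f d)) }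
          ; inverse = (λ f → pw λ d → ℤᵖ.+-inverseˡ (coef f d)) , (λ f → pw λ d → ℤᵖ.+-inverseʳ (coef f d))
          ; ⁻¹-cong = neg-cong }
        ; comm = λ f g → pw λ d → ℤᵖ.+-comm (coef f d) (coef g d) }
      ; *-cong = ·-cong
      ; *-assoc = λ f g h → pw (⊛-assoc-at (coef f) (coef g) (coef h))
      ; *-identity = ·-identityˡ , (λ f → ≈-trans (·-comm f 𝟙) (·-identityˡ f))
      ; distrib = (λ h f g → ≈-trans (·-comm h (f ⊞ g)) (≈-trans (distribʳ h f g) (+-cong (·-comm f h) (·-comm g h))))
                , distribʳ }
    ; *-comm = ·-comm } }
  where
  distribʳ : ∀ h f g → (f ⊞ g) · h ≈ f · h ⊞ g · h
  distribʳ h f g .at = ⊛-distribʳ-at (coef f) (coef g) (coef h)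

open CommutativeRing commutativeRing using ()
  renaming ( +-assoc to ⊞-assoc; +-identityˡ to ⊞-identityˡ; +-identityʳ to ⊞-identityʳ; +-comm to ⊞-comm
           ; *-assoc to ·-assoc; *-identityʳ to ·-identityʳ; zeroˡ to ·-zeroˡ; zeroʳ to ·-zeroʳ
           ; distribˡ to ·-distribˡ; distribʳ to ·-distribʳ; setoid to Series-setoid )

module ≈-Reasoning = Relation.Binary.Reasoning.Setoid Series-setoid

·-congˡ : ∀ {f g h} → g ≈ h → f · g ≈ f · h
·-congˡ = ·-cong ≈-refl

·-congʳ : ∀ {f g h} → f ≈ g → f · h ≈ g · h
·-congʳ p = ·-cong p ≈-refl

⊞-congˡ : ∀ {f g h} → g ≈ h → f ⊞ g ≈ f ⊞ h
⊞-congˡ = +-cong ≈-refl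

⊞-congʳ : ∀ {f g h} → f ≈ g → f ⊞ h ≈ g ⊞ h
⊞-congʳ p = +-cong p ≈-refl

⊟-cong : ∀ {f f′ g g′} → f ≈ f′ → g ≈ g′ → f ⊟ g ≈ f′ ⊟ g′
⊟-cong p q = +-cong p (neg-cong q)

⊟-congˡ : ∀ {f g h} → g ≈ h → f ⊟ g ≈ f ⊟ h
⊟-congˡ = ⊟-cong ≈-refl

-- The values at 0 and 1 make the solver's constants 0 and 1 denote 𝟘 and 𝟙 on the nose.
constant : ℤ → Series
constant (ℤ.+ 0) = 𝟘
constant (ℤ.+ 1) = 𝟙
constant z       = series (scale z onePS)

private
  constant-≈ : ∀ z → constant z ≈ series (scale z onePS)
  constant-≈ (ℤ.+ 0)             = pw λ { zero → refl ; (suc _) → refl }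
  constant-≈ (ℤ.+ 1)             = pw λ { zero → refl ; (suc _) → refl }
  constant-≈ (ℤ.+ (suc (suc n))) = ≈-refl
  constant-≈ (-[1+ n ])          = ≈-refl

  constant-+ : ∀ y z → constant (y ℤ.+ z) ≈ constant y ⊞ constant z
  constant-+ y z = ≈-trans (constant-≈ (y ℤ.+ z)) (≈-trans (pw λ d → ℤᵖ.*-distribʳ-+ (onePS d) y z)
    (≈-sym (+-cong (constant-≈ y) (constant-≈ z))))

  constant-* : ∀ y z → constant (y ℤ.* z) ≈ constant y · constant z
  constant-* y z = ≈-trans (constant-≈ (y ℤ.* z)) (≈-trans (pw λ d →
      trans (ℤᵖ.*-assoc y z (onePS d)) (trans (cong (y ℤ.*_) (sym (one-⊛-at (scale z onePS) d)))
        (sym (scale-⊛-at y onePS (scale z onePS) d))))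
    (≈-sym (·-cong (constant-≈ y) (constant-≈ z))))

  constant-neg : ∀ z → constant (ℤ.- z) ≈ neg (constant z)
  constant-neg z = ≈-trans (constant-≈ (ℤ.- z)) (≈-trans (pw λ d → sym (ℤᵖ.neg-distribˡ-* z (onePS d)))
    (neg-cong (≈-sym (constant-≈ z))))

  constant-homo : CommutativeRing.rawRing ℤᵖ.+-*-commutativeRing -Raw-AlmostCommutative⟶ fromCommutativeRing commutativeRing
  constant-homo = record
    { ⟦_⟧ = constant ; +-homo = constant-+ ; *-homo = constant-* ; -‿homo = constant-neg ; 0-homo = ≈-refl ; 1-homo = ≈-refl }

  module SeriesSolver = Algebra.Solver.Ring _ (fromCommutativeRing commutativeRing) constant-homo
    (λ y z → Maybe.map (λ p → ≡⇒≈ (cong constant p)) (dec⇒maybe (y ℤᵖ.≟ z)))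

module Solver where
  open SeriesSolver public using (solve; con; _:+_; _:*_; _:-_; :-_; _:=_; Polynomial)

  :0 :1 : ∀ {n} → Polynomial n
  :0 = con (ℤ.+ 0)
  :1 = con (ℤ.+ 1)

private variable
  A B : Set

-- Sums over marked entries and partial fractions

∏ : (A → Series) → List A → Series
∏ f []       = 𝟙
∏ f (x ∷ xs) = f x · ∏ f xs

∏-cong : ∀ {f g : A → Series} (xs : List A) → (∀ x → f x ≈ g x) → ∏ f xs ≈ ∏ g xs
∏-cong []       p = ≈-refl
∏-cong (x ∷ xs) p = ·-cong (p x) (∏-cong xs p)

∏-congAll : ∀ {P : A → Set} {f g : A → Series} {xs : List A} → All P xs → (∀ x → P x → f x ≈ g x) → ∏ f xs ≈ ∏ g xs
∏-congAll []         p = ≈-refl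
∏-congAll (px ∷ pxs) p = ·-cong (p _ px) (∏-congAll pxs p)

∏-++ : ∀ (f : A → Series) xs ys → ∏ f (xs ++ ys) ≈ ∏ f xs · ∏ f ys
∏-++ f []       ys = ≈-sym (·-identityˡ _)
∏-++ f (x ∷ xs) ys = ≈-trans (·-congˡ (∏-++ f xs ys)) (≈-sym (·-assoc (f x) (∏ f xs) (∏ f ys)))

∏-𝟙 : ∀ (xs : List A) → ∏ (λ _ → 𝟙) xs ≈ 𝟙
∏-𝟙 []       = ≈-refl
∏-𝟙 (x ∷ xs) = ≈-trans (·-identityˡ _) (∏-𝟙 xs)

∏-· : ∀ (f g : A → Series) xs → ∏ (λ x → f x · g x) xs ≈ ∏ f xs · ∏ g xs
∏-· f g []       = ≈-sym (·-identityˡ 𝟙)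
∏-· f g (x ∷ xs) = ≈-trans (·-congˡ (∏-· f g xs))
  (solve 4 (λ a b c d → (a :* b) :* (c :* d) := (a :* c) :* (b :* d)) ≈-refl (f x) (g x) (∏ f xs) (∏ g xs))
  where open Solver

∏-map : ∀ (f : B → Series) (h : A → B) xs → ∏ f (map h xs) ≈ ∏ (f ∘ h) xs
∏-map f h []       = ≈-refl
∏-map f h (x ∷ xs) = ·-congˡ (∏-map f h xs)

∏-middle : ∀ (f : A → Series) pre p post → ∏ f (pre ++ p ∷ post) ≈ f p · ∏ f (pre ++ post)
∏-middle f []        p post = ≈-refl
∏-middle f (x ∷ pre) p post = ≈-trans (·-congˡ (∏-middle f pre p post))
  (solve 3 (λ a b c → a :* (b :* c) := b :* (a :* c)) ≈-refl (f x) (f p) (∏ f (pre ++ post)))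
  where open Solver

∏-↭ : ∀ (f : A → Series) {xs ys} → xs ↭ ys → ∏ f xs ≈ ∏ f ys
∏-↭ f ↭.refl          = ≈-refl
∏-↭ f (prep x p)      = ·-congˡ (∏-↭ f p)
∏-↭ f (swap {xs} {ys} x y p) = ≈-trans
  (solve 3 (λ a b c → a :* (b :* c) := b :* (a :* c)) ≈-refl (f x) (f y) (∏ f xs)) (·-congˡ (·-congˡ (∏-↭ f p)))
  where open Solver
∏-↭ f (↭.trans p q)   = ≈-trans (∏-↭ f p) (∏-↭ f q)

-- splitSum v H is the sum of H pre p post over all decompositions v = pre ++ p ∷ post.
splitSum : List A → (List A → A → List A → Series) → Series
splitSum []       H = 𝟘
splitSum (x ∷ xs) H = H [] x xs ⊞ splitSum xs (λ pre → H (x ∷ pre))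

splitSum-cong : ∀ {H H′ : List A → A → List A → Series} xs →
  (∀ pre p post → pre ++ p ∷ post ≡ xs → H pre p post ≈ H′ pre p post) → splitSum xs H ≈ splitSum xs H′
splitSum-cong []       h = ≈-refl
splitSum-cong (x ∷ xs) h = +-cong (h [] x xs refl) (splitSum-cong xs λ pre p post eq → h (x ∷ pre) p post (cong (x ∷_) eq))

splitSum-cong′ : ∀ {H H′ : List A → A → List A → Series} xs →
  (∀ pre p post → H pre p post ≈ H′ pre p post) → splitSum xs H ≈ splitSum xs H′
splitSum-cong′ xs h = splitSum-cong xs λ pre p post _ → h pre p post

splitSum-⊞ : ∀ (H H′ : List A → A → List A → Series) xs →
  splitSum xs (λ pre p post → H pre p post ⊞ H′ pre p post) ≈ splitSum xs H ⊞ splitSum xs H′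
splitSum-⊞ H H′ []       = ≈-sym (⊞-identityˡ 𝟘)
splitSum-⊞ H H′ (x ∷ xs) = ≈-trans (⊞-congˡ (splitSum-⊞ (H ∘ (x ∷_)) (H′ ∘ (x ∷_)) xs))
  (solve 4 (λ a b c d → (a :+ b) :+ (c :+ d) := (a :+ c) :+ (b :+ d)) ≈-refl (H [] x xs) (H′ [] x xs) (splitSum xs (H ∘ (x ∷_))) (splitSum xs (H′ ∘ (x ∷_))))
  where open Solver

splitSum-· : ∀ c (H : List A → A → List A → Series) xs →
  splitSum xs (λ pre p post → c · H pre p post) ≈ c · splitSum xs H
splitSum-· c H []       = ≈-sym (·-zeroʳ c)
splitSum-· c H (x ∷ xs) = ≈-trans (⊞-congˡ (splitSum-· c (H ∘ (x ∷_)) xs)) (≈-sym (·-distribˡ c _ _))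

splitSum-zero : ∀ {H : List A → A → List A → Series} xs → (∀ pre p post → pre ++ p ∷ post ≡ xs → H pre p post ≈ 𝟘) → splitSum xs H ≈ 𝟘
splitSum-zero []       h = ≈-refl
splitSum-zero (x ∷ xs) h = ≈-trans (+-cong (h [] x xs refl) (splitSum-zero xs λ pre p post eq → h (x ∷ pre) p post (cong (x ∷_) eq))) (⊞-identityˡ 𝟘)

splitSum-++ : ∀ (H : List A → A → List A → Series) xs ys →
  splitSum (xs ++ ys) H ≈ splitSum xs (λ pre p post → H pre p (post ++ ys)) ⊞ splitSum ys (λ pre → H (xs ++ pre))
splitSum-++ H []       ys = ≈-sym (⊞-identityˡ _)
splitSum-++ H (x ∷ xs) ys = ≈-trans (⊞-congˡ (splitSum-++ (H ∘ (x ∷_)) xs ys)) (≈-sym (⊞-assoc _ _ _))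

splitSum-swap : ∀ (G : List A → A → List A → List B → B → List B → Series) xs ys →
  splitSum xs (λ pre p post → splitSum ys (λ pre′ p′ post′ → G pre p post pre′ p′ post′)) ≈
  splitSum ys (λ pre′ p′ post′ → splitSum xs (λ pre p post → G pre p post pre′ p′ post′))
splitSum-swap G []       ys = ≈-sym (splitSum-zero ys λ _ _ _ _ → ≈-refl)
splitSum-swap G (x ∷ xs) ys = ≈-trans (⊞-congˡ (splitSum-swap (G ∘ (x ∷_)) xs ys))
  (≈-sym (splitSum-⊞ (λ pre′ p′ post′ → G [] x xs pre′ p′ post′) (λ pre′ p′ post′ → splitSum xs (λ pre p post → G (x ∷ pre) p post pre′ p′ post′)) ys))

split-All : ∀ {P : A → Set} {xs} pre {p post} → All P xs → pre ++ p ∷ post ≡ xs → P p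
split-All pre ps refl = All.head (Allᵖ.++⁻ʳ pre ps)

rest-All : ∀ {P : A → Set} {xs} pre {p post} → All P xs → pre ++ p ∷ post ≡ xs → All P (pre ++ post)
rest-All pre ps refl = Allᵖ.++⁺ (Allᵖ.++⁻ˡ pre ps) (All.tail (Allᵖ.++⁻ʳ pre ps))

rest-AllPairs : ∀ {D : A → A → Set} {xs} pre {p post} → AllPairs D xs → pre ++ p ∷ post ≡ xs → AllPairs D (pre ++ post)
rest-AllPairs []        (_ ∷ ds) refl = ds
rest-AllPairs (x ∷ pre) (d ∷ ds) refl = rest-All pre d refl ∷ rest-AllPairs pre ds refl

split-AllPairs : ∀ {D : A → A → Set} {xs} pre {p post} → AllPairs D xs → pre ++ p ∷ post ≡ xs → All (λ b → D b p) pre × All (D p) post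
split-AllPairs []        (d ∷ ds) refl = [] , d
split-AllPairs (x ∷ pre) (d ∷ ds) refl with split-AllPairs pre ds refl
... | l , r = split-All pre d refl ∷ l , r

rest-length : ∀ {xs : List A} pre {p post} → pre ++ p ∷ post ≡ xs → length xs ≡ suc (length (pre ++ post))
rest-length []        refl = refl
rest-length (x ∷ pre) refl = cong suc (rest-length pre refl)

-- The partial fraction expansion of ∏_b (z − Y_b)/(z − X_b), freed of division: K b p stands for
-- X_b/(X_b − X_p), s b for 1 − Y_b/X_b, and h b for X_b/(X_b − z), so that h = 1 is the case z = 0.
module PartialFractions (K : A → A → Series) (s : A → Series) (D : A → A → Set)
  (three-term : ∀ {z x y} → D z x → D z y → D x y → K x z · K y z ≈ K y x · K x z ⊞ K x y · K y z) where

  residue : (A → Series) → List A → A → List A → Series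
  residue h pre p post = s p · (h p · ∏ (λ b → 𝟙 ⊟ s b · K b p) (pre ++ post))

  -- Induction on the factors. Splitting off the factor of y creates products h y · h p, and the
  -- relation assumed for h resolves each into two simple fractions. Those at y add up to the value
  -- of the remaining product at the pole of y, which is the expansion of v for `λ b → K b y` in
  -- place of h.
  expansion : ∀ h v → AllPairs D v → AllPairs (λ x y → h x · h y ≈ K y x · h x ⊞ K x y · h y) v →
    ∏ (λ b → 𝟙 ⊟ s b · h b) v ≈ 𝟙 ⊟ splitSum v (residue h)
  expansion h [] _ _ = solve 0 (:1 := :1 :- :0) ≈-refl
    where open Solver
  expansion h (y ∷ v) (d ∷ ds) (g ∷ gs) = begin
    (𝟙 ⊟ s y · h y) · ∏ (λ b → 𝟙 ⊟ s b · h b) v    ≈⟨ ·-congˡ (expansion h v ds gs) ⟩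
    (𝟙 ⊟ s y · h y) · (𝟙 ⊟ Σ₁)
      ≈⟨ solve 4 (λ c h a b → (:1 :- c :* h) :* (:1 :- a) := :1 :- (c :* (h :* (:1 :- b)) :+ ((a :+ (c :* h) :* b) :+ (:- (c :* h)) :* a))) ≈-refl (s y) (h y) Σ₁ Σ₂ ⟩
    𝟙 ⊟ (s y · (h y · (𝟙 ⊟ Σ₂)) ⊞ ((Σ₁ ⊞ (s y · h y) · Σ₂) ⊞ neg (s y · h y) · Σ₁))
      ≈⟨ ⊟-congˡ (+-cong (·-congˡ (·-congˡ (expansion (λ b → K b y) v ds (K-relation d ds)))) combine) ⟨
    𝟙 ⊟ (residue h [] y v ⊞ splitSum v (λ pre → residue h (y ∷ pre))) ∎
    where
    open ≈-Reasoning
    open Solver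
    Σ₁ = splitSum v (residue h)
    Σ₂ = splitSum v (residue (λ b → K b y))
    K-relation : ∀ {v} → All (D y) v → AllPairs D v → AllPairs (λ a b → K a y · K b y ≈ K b a · K a y ⊞ K a b · K b y) v
    K-relation []       []       = []
    K-relation (e ∷ es) (f ∷ fs) = All.zipWith (λ (u , w) → three-term e u w) (es , f) ∷ K-relation es fs
    combine : splitSum v (λ pre → residue h (y ∷ pre)) ≈ (Σ₁ ⊞ (s y · h y) · Σ₂) ⊞ neg (s y · h y) · Σ₁
    combine = begin
      splitSum v (λ pre → residue h (y ∷ pre))
        ≈⟨ splitSum-cong v (λ pre p post eq → let w = ∏ (λ b → 𝟙 ⊟ s b · K b p) (pre ++ post) in begin
             s p · (h p · ((𝟙 ⊟ s y · K y p) · w))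
               ≈⟨ solve 5 (λ a b c e w → a :* (b :* ((:1 :- c :* e) :* w)) := a :* (b :* w) :- (a :* w :* c) :* (e :* b)) ≈-refl (s p) (h p) (s y) (K y p) w ⟩
             s p · (h p · w) ⊟ (s p · w · s y) · (K y p · h p)
               ≈⟨ solve 6 (λ u x kyp hp kpy hy → u :- x :* (kyp :* hp) := (u :+ x :* (kpy :* hy)) :- x :* (kpy :* hy :+ kyp :* hp)) ≈-refl (s p · (h p · w)) (s p · w · s y) (K y p) (h p) (K p y) (h y) ⟩
             (s p · (h p · w) ⊞ (s p · w · s y) · (K p y · h y)) ⊟ (s p · w · s y) · (K p y · h y ⊞ K y p · h p)
               ≈⟨ ⊟-congˡ (·-congˡ (split-All pre g eq)) ⟨
             (s p · (h p · w) ⊞ (s p · w · s y) · (K p y · h y)) ⊟ (s p · w · s y) · (h y · h p)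
               ≈⟨ solve 6 (λ a b c e f w → (a :* (b :* w) :+ (a :* w :* c) :* (e :* f)) :- (a :* w :* c) :* (f :* b) :=
                                            (a :* (b :* w) :+ (c :* f) :* (a :* (e :* w))) :+ (:- (c :* f)) :* (a :* (b :* w)))
                    ≈-refl (s p) (h p) (s y) (K p y) (h y) w ⟩
             (s p · (h p · w) ⊞ (s y · h y) · (s p · (K p y · w))) ⊞ neg (s y · h y) · (s p · (h p · w)) ∎) ⟩
      splitSum v (λ pre p post → (residue h pre p post ⊞ (s y · h y) · residue (λ b → K b y) pre p post) ⊞ neg (s y · h y) · residue h pre p post)
        ≈⟨ splitSum-⊞ _ _ v ⟩
      splitSum v (λ pre p post → residue h pre p post ⊞ (s y · h y) · residue (λ b → K b y) pre p post) ⊞ splitSum v (λ pre p post → neg (s y · h y) · residue h pre p post)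
        ≈⟨ +-cong (≈-trans (splitSum-⊞ _ _ v) (⊞-congˡ (splitSum-· _ _ v))) (splitSum-· _ _ v) ⟩
      (Σ₁ ⊞ (s y · h y) · Σ₂) ⊞ neg (s y · h y) · Σ₁ ∎

-- Determinants and sums over compositions

sgn : ℕ → Series
sgn zero    = 𝟙
sgn (suc l) = neg (sgn l)

det : (A → B → Series) → List A → List B → Series
det a []       []       = 𝟙
det a []       (_ ∷ _)  = 𝟘
det a (x ∷ xs) ys       = splitSum ys (λ pre y post → sgn (length pre) · (a x y · det a xs (pre ++ post)))

-- After one step along the first row, induction expands every minor along its first column;
-- exchanging the two sums collects the minors by the row that is deleted from that column.
det-column : ∀ (a : A → B → Series) xs y ys →
  det a xs (y ∷ ys) ≈ splitSum xs (λ pre x post → sgn (length pre) · (a x y · det a (pre ++ post) ys))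
det-column a []       y ys = ≈-refl
det-column a (x ∷ xs) y ys = ⊞-congˡ (begin
  splitSum ys (λ pre y′ post → neg (sgn (length pre)) · (a x y′ · det a xs (y ∷ pre ++ post)))
    ≈⟨ splitSum-cong′ ys (λ pre y′ post → begin
         neg (sgn (length pre)) · (a x y′ · det a xs (y ∷ pre ++ post))
           ≈⟨ ·-congˡ (·-congˡ (det-column a xs y (pre ++ post))) ⟩
         neg (sgn (length pre)) · (a x y′ · splitSum xs (λ pre′ x′ post′ → sgn (length pre′) · (a x′ y · det a (pre′ ++ post′) (pre ++ post))))
           ≈⟨ ·-assoc _ _ _ ⟨
         (neg (sgn (length pre)) · a x y′) · splitSum xs (λ pre′ x′ post′ → sgn (length pre′) · (a x′ y · det a (pre′ ++ post′) (pre ++ post)))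
           ≈⟨ splitSum-· _ _ xs ⟨
         splitSum xs (λ pre′ x′ post′ → (neg (sgn (length pre)) · a x y′) · (sgn (length pre′) · (a x′ y · det a (pre′ ++ post′) (pre ++ post))))
           ∎) ⟩
  splitSum ys (λ pre y′ post → splitSum xs (λ pre′ x′ post′ → (neg (sgn (length pre)) · a x y′) · (sgn (length pre′) · (a x′ y · det a (pre′ ++ post′) (pre ++ post)))))
    ≈⟨ splitSum-swap _ ys xs ⟩
  splitSum xs (λ pre′ x′ post′ → splitSum ys (λ pre y′ post → (neg (sgn (length pre)) · a x y′) · (sgn (length pre′) · (a x′ y · det a (pre′ ++ post′) (pre ++ post)))))
    ≈⟨ splitSum-cong′ xs (λ pre′ x′ post′ → ≈-trans
         (splitSum-cong′ ys λ pre y′ post →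
           solve 5 (λ s b t c w → (:- s :* b) :* (t :* (c :* w)) := (:- t :* c) :* (s :* (b :* w))) ≈-refl
             (sgn (length pre)) (a x y′) (sgn (length pre′)) (a x′ y) (det a (pre′ ++ post′) (pre ++ post)))
         (≈-trans (splitSum-· _ _ ys) (·-assoc _ _ _))) ⟩
  splitSum xs (λ pre′ x′ post′ → neg (sgn (length pre′)) · (a x′ y · det a (x ∷ pre′ ++ post′) ys)) ∎)
  where
  open ≈-Reasoning
  open Solver

det-transpose : ∀ (a : A → B → Series) xs ys → det a xs ys ≈ det (flip a) ys xs
det-transpose a []       []       = ≈-refl
det-transpose a (x ∷ xs) []       = ≈-refl
det-transpose a xs       (y ∷ ys) = ≈-trans (det-column a xs y ys)
  (splitSum-cong′ xs λ pre x post → ·-congˡ (·-congˡ (det-transpose a (pre ++ post) ys)))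

det-cong : ∀ {a b : A → B → Series} xs ys → (∀ x y → a x y ≈ b x y) → det a xs ys ≈ det b xs ys
det-cong []       []       e = ≈-refl
det-cong []       (_ ∷ _)  e = ≈-refl
det-cong (x ∷ xs) ys       e = splitSum-cong′ ys λ pre y post → ·-congˡ (·-cong (e x y) (det-cong xs (pre ++ post) e))

det-scale : ∀ (a : A → B → Series) (g : B → Series) xs ys → det (λ x y → g y · a x y) xs ys ≈ ∏ g ys · det a xs ys
det-scale a g []       []       = ≈-sym (·-identityˡ 𝟙)
det-scale a g []       (y ∷ ys) = ≈-sym (·-zeroʳ _)
det-scale a g (x ∷ xs) ys       = ≈-trans
  (splitSum-cong ys λ { pre y post refl → begin
    sgn (length pre) · ((g y · a x y) · det (λ x y → g y · a x y) xs (pre ++ post))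
      ≈⟨ ·-congˡ (·-congˡ (det-scale a g xs (pre ++ post))) ⟩
    sgn (length pre) · ((g y · a x y) · (∏ g (pre ++ post) · det a xs (pre ++ post)))
      ≈⟨ solve 5 (λ s g a p d → s :* ((g :* a) :* (p :* d)) := (g :* p) :* (s :* (a :* d))) ≈-refl
           (sgn (length pre)) (g y) (a x y) (∏ g (pre ++ post)) (det a xs (pre ++ post)) ⟩
    (g y · ∏ g (pre ++ post)) · (sgn (length pre) · (a x y · det a xs (pre ++ post)))
      ≈⟨ ·-congʳ (∏-middle g pre y post) ⟨
    ∏ g (pre ++ y ∷ post) · (sgn (length pre) · (a x y · det a xs (pre ++ post))) ∎ })
  (splitSum-· _ _ ys)
  where
  open ≈-Reasoning
  open Solver

antidiag : ℕ → (ℕ → ℕ → Series) → Series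
antidiag zero    G = G 0 0
antidiag (suc r) G = G 0 (suc r) ⊞ antidiag r (λ s → G (suc s))

antidiag-cong : ∀ {G H : ℕ → ℕ → Series} r → (∀ s t → s + t ≡ r → G s t ≈ H s t) → antidiag r G ≈ antidiag r H
antidiag-cong zero    h = h 0 0 refl
antidiag-cong (suc r) h = +-cong (h 0 (suc r) refl) (antidiag-cong r λ s t eq → h (suc s) t (cong suc eq))

antidiag-⊞ : ∀ (G H : ℕ → ℕ → Series) r → antidiag r (λ s t → G s t ⊞ H s t) ≈ antidiag r G ⊞ antidiag r H
antidiag-⊞ G H zero    = ≈-refl
antidiag-⊞ G H (suc r) = ≈-trans (⊞-congˡ (antidiag-⊞ (G ∘ suc) (H ∘ suc) r))
  (solve 4 (λ a b c d → (a :+ b) :+ (c :+ d) := (a :+ c) :+ (b :+ d)) ≈-refl (G 0 (suc r)) (H 0 (suc r)) (antidiag r (G ∘ suc)) (antidiag r (H ∘ suc)))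
  where open Solver

antidiag-· : ∀ c (G : ℕ → ℕ → Series) r → antidiag r (λ s t → c · G s t) ≈ c · antidiag r G
antidiag-· c G zero    = ≈-refl
antidiag-· c G (suc r) = ≈-trans (⊞-congˡ (antidiag-· c (G ∘ suc) r)) (≈-sym (·-distribˡ c _ _))

antidiag-zero : ∀ {G : ℕ → ℕ → Series} r → (∀ s t → G s t ≈ 𝟘) → antidiag r G ≈ 𝟘
antidiag-zero zero    h = h 0 0
antidiag-zero (suc r) h = ≈-trans (+-cong (h 0 (suc r)) (antidiag-zero r λ s → h (suc s))) (⊞-identityˡ 𝟘)

antidiag-last : ∀ (G : ℕ → ℕ → Series) r → antidiag (suc r) G ≈ antidiag r (λ s t → G s (suc t)) ⊞ G (suc r) 0
antidiag-last G zero    = ≈-refl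
antidiag-last G (suc r) = ≈-trans (⊞-congˡ (antidiag-last (G ∘ suc) r)) (≈-sym (⊞-assoc _ _ _))

antidiag-swap : ∀ (G : ℕ → ℕ → ℕ → Series) r →
  antidiag r (λ s t → antidiag t (λ u w → G s u w)) ≈ antidiag r (λ u t → antidiag t (λ s w → G s u w))
antidiag-swap G zero    = ≈-refl
antidiag-swap G (suc r) = begin
  antidiag (suc r) (G 0) ⊞ antidiag r (λ s t → antidiag t (G (suc s)))
    ≈⟨ +-cong (antidiag-last (G 0) r) (antidiag-swap (G ∘ suc) r) ⟩
  (antidiag r (λ u t → G 0 u (suc t)) ⊞ G 0 (suc r) 0) ⊞ antidiag r (λ u t → antidiag t (λ s w → G (suc s) u w))
    ≈⟨ solve 3 (λ a b c → (a :+ b) :+ c := (a :+ c) :+ b) ≈-refl (antidiag r (λ u t → G 0 u (suc t))) (G 0 (suc r) 0) (antidiag r (λ u t → antidiag t (λ s w → G (suc s) u w))) ⟩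
  (antidiag r (λ u t → G 0 u (suc t)) ⊞ antidiag r (λ u t → antidiag t (λ s w → G (suc s) u w))) ⊞ G 0 (suc r) 0
    ≈⟨ ⊞-congʳ (antidiag-⊞ _ _ r) ⟨
  antidiag r (λ u t → antidiag (suc t) (λ s w → G s u w)) ⊞ G 0 (suc r) 0
    ≈⟨ antidiag-last (λ u t → antidiag t (λ s w → G s u w)) r ⟨
  antidiag (suc r) (λ u t → antidiag t (λ s w → G s u w)) ∎
  where
  open ≈-Reasoning
  open Solver

-- Sum over all ways of attaching to the labels ys multiplicities of total r.
compSum : List A → ℕ → (List (A × ℕ) → Series) → Series
compSum []       zero    F = F []
compSum []       (suc r) F = 𝟘
compSum (y ∷ ys) r       F = antidiag r (λ s t → compSum ys t (λ v → F ((y , s) ∷ v)))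

total : List (A × ℕ) → ℕ
total []            = 0
total ((_ , c) ∷ v) = c + total v

compSum-cong : ∀ {F G : List (A × ℕ) → Series} ys r → (∀ v → map proj₁ v ≡ ys → total v ≡ r → F v ≈ G v) → compSum ys r F ≈ compSum ys r G
compSum-cong []       zero    h = h [] refl refl
compSum-cong []       (suc r) h = ≈-refl
compSum-cong (y ∷ ys) r       h = antidiag-cong r λ s t s+t≡r → compSum-cong ys t λ v eq tot →
  h ((y , s) ∷ v) (cong (y ∷_) eq) (trans (cong (s +_) tot) s+t≡r)

compSum-cong′ : ∀ {F G : List (A × ℕ) → Series} ys r → (∀ v → F v ≈ G v) → compSum ys r F ≈ compSum ys r G
compSum-cong′ ys r h = compSum-cong ys r λ v _ _ → h v

compSum-⊞ : ∀ (F G : List (A × ℕ) → Series) ys r → compSum ys r (λ v → F v ⊞ G v) ≈ compSum ys r F ⊞ compSum ys r G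
compSum-⊞ F G []       zero    = ≈-refl
compSum-⊞ F G []       (suc r) = ≈-sym (⊞-identityˡ 𝟘)
compSum-⊞ F G (y ∷ ys) r       = ≈-trans (antidiag-cong r λ s t _ → compSum-⊞ _ _ ys t) (antidiag-⊞ _ _ r)

compSum-· : ∀ c (F : List (A × ℕ) → Series) ys r → compSum ys r (λ v → c · F v) ≈ c · compSum ys r F
compSum-· c F []       zero    = ≈-refl
compSum-· c F []       (suc r) = ≈-sym (·-zeroʳ c)
compSum-· c F (y ∷ ys) r       = ≈-trans (antidiag-cong r λ s t _ → compSum-· c _ ys t) (antidiag-· c _ r)

antidiag-splitSum : ∀ (G : ℕ → ℕ → List A → A → List A → Series) ys r →
  antidiag r (λ s t → splitSum ys (G s t)) ≈ splitSum ys (λ pre y post → antidiag r (λ s t → G s t pre y post))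
antidiag-splitSum G []       r = antidiag-zero r λ _ _ → ≈-refl
antidiag-splitSum G (y ∷ ys) r = ≈-trans (antidiag-⊞ _ _ r) (⊞-congˡ (antidiag-splitSum (λ s t pre → G s t (y ∷ pre)) ys r))

-- The marked label and its multiplicity can be chosen before the rest of the total is distributed.
-- `H` sees the prefix only through its length, which is what the sign of a minor needs.
compSum-splitSum : ∀ (H : ℕ → A → ℕ → List (A × ℕ) → Series) ys r →
  compSum ys r (λ v → splitSum v (λ pre (y , s) post → H (length pre) y s (pre ++ post))) ≈
  splitSum ys (λ pre y post → antidiag r (λ s t → compSum (pre ++ post) t (H (length pre) y s)))
compSum-splitSum H []       zero    = ≈-refl
compSum-splitSum H []       (suc r) = ≈-refl
compSum-splitSum H (y ∷ ys) r       = begin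
  antidiag r (λ s t → compSum ys t (λ v → H 0 y s v ⊞ splitSum v (λ pre (y′ , s′) post → H (suc (length pre)) y′ s′ ((y , s) ∷ pre ++ post))))
    ≈⟨ antidiag-cong r (λ s t _ → compSum-⊞ _ _ ys t) ⟩
  antidiag r (λ s t → compSum ys t (H 0 y s) ⊞ compSum ys t (λ v → splitSum v (λ pre (y′ , s′) post → H (suc (length pre)) y′ s′ ((y , s) ∷ pre ++ post))))
    ≈⟨ antidiag-⊞ _ _ r ⟩
  antidiag r (λ s t → compSum ys t (H 0 y s)) ⊞ antidiag r (λ s t → compSum ys t (λ v → splitSum v (λ pre (y′ , s′) post → H (suc (length pre)) y′ s′ ((y , s) ∷ pre ++ post))))
    ≈⟨ ⊞-congˡ (antidiag-cong r λ s t _ → compSum-splitSum (λ l y′ s′ v → H (suc l) y′ s′ ((y , s) ∷ v)) ys t) ⟩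
  antidiag r (λ s t → compSum ys t (H 0 y s)) ⊞ antidiag r (λ s t → splitSum ys (λ pre y′ post → antidiag t (λ s′ w → compSum (pre ++ post) w (λ v → H (suc (length pre)) y′ s′ ((y , s) ∷ v)))))
    ≈⟨ ⊞-congˡ (antidiag-splitSum _ ys r) ⟩
  antidiag r (λ s t → compSum ys t (H 0 y s)) ⊞ splitSum ys (λ pre y′ post → antidiag r (λ s t → antidiag t (λ s′ w → compSum (pre ++ post) w (λ v → H (suc (length pre)) y′ s′ ((y , s) ∷ v)))))
    ≈⟨ ⊞-congˡ (splitSum-cong′ ys λ pre y′ post → antidiag-swap _ r) ⟩
  antidiag r (λ s t → compSum ys t (H 0 y s)) ⊞ splitSum ys (λ pre y′ post → antidiag r (λ s′ t → antidiag t (λ s w → compSum (pre ++ post) w (λ v → H (suc (length pre)) y′ s′ ((y , s) ∷ v))))) ∎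
  where open ≈-Reasoning

compSum-zero : ∀ (ys : List A) r → compSum ys r (λ v → 𝟘) ≈ 𝟘
compSum-zero []       zero    = ≈-refl
compSum-zero []       (suc r) = ≈-refl
compSum-zero (y ∷ ys) r       = antidiag-zero r λ s t → compSum-zero ys t

splitSum-compSum : ∀ (G : List (A × ℕ) → List B → B → List B → Series) xs ys r →
  compSum xs r (λ v → splitSum ys (G v)) ≈ splitSum ys (λ pre y post → compSum xs r (λ v → G v pre y post))
splitSum-compSum G xs []       r = compSum-zero xs r
splitSum-compSum G xs (y ∷ ys) r = ≈-trans (compSum-⊞ _ _ xs r) (⊞-congˡ (splitSum-compSum (λ v pre → G v (y ∷ pre)) xs ys r))

-- Expanding the left determinant by rows and the right one by columns gives the same recursion.
compSum-det : ∀ (a : A → B → ℕ → Series) xs ys r →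
  compSum ys r (det (λ x (y , c) → a x y c) xs) ≈ compSum xs r (det (λ y (x , c) → a x y c) ys)
compSum-det a []       []       zero    = ≈-refl
compSum-det a []       (y ∷ ys) zero    = compSum-zero ys 0
compSum-det a []       []       (suc r) = ≈-refl
compSum-det a []       (y ∷ ys) (suc r) = antidiag-zero (suc r) λ s t → compSum-zero ys t
compSum-det a (x ∷ xs) ys       r       = begin
  compSum ys r (λ v → splitSum v (λ pre (y , c) post → sgn (length pre) · (a x y c · det _ xs (pre ++ post))))
    ≈⟨ compSum-splitSum (λ l y c v → sgn l · (a x y c · det _ xs v)) ys r ⟩
  splitSum ys (λ pre y post → antidiag r (λ s t → compSum (pre ++ post) t (λ v → sgn (length pre) · (a x y s · det _ xs v))))
    ≈⟨ splitSum-cong′ ys (λ pre y post → antidiag-cong r λ s t _ → begin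
         compSum (pre ++ post) t (λ v → sgn (length pre) · (a x y s · det _ xs v))
           ≈⟨ ≈-trans (compSum-· _ _ (pre ++ post) t) (·-congˡ (compSum-· _ _ (pre ++ post) t)) ⟩
         sgn (length pre) · (a x y s · compSum (pre ++ post) t (det _ xs))
           ≈⟨ ·-congˡ (·-congˡ (compSum-det a xs (pre ++ post) t)) ⟩
         sgn (length pre) · (a x y s · compSum xs t (det _ (pre ++ post)))
           ≈⟨ ≈-trans (compSum-· _ _ xs t) (·-congˡ (compSum-· _ _ xs t)) ⟨
         compSum xs t (λ v → sgn (length pre) · (a x y s · det _ (pre ++ post) v)) ∎) ⟩
  splitSum ys (λ pre y post → antidiag r (λ s t → compSum xs t (λ v → sgn (length pre) · (a x y s · det _ (pre ++ post) v))))
    ≈⟨ antidiag-splitSum _ ys r ⟨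
  antidiag r (λ s t → splitSum ys (λ pre y post → compSum xs t (λ v → sgn (length pre) · (a x y s · det _ (pre ++ post) v))))
    ≈⟨ antidiag-cong r (λ s t _ → splitSum-compSum _ xs ys t) ⟨
  antidiag r (λ s t → compSum xs t (λ v → splitSum ys (λ pre y post → sgn (length pre) · (a x y s · det _ (pre ++ post) v))))
    ≈⟨ antidiag-cong r (λ s t _ → compSum-cong′ xs t λ v → det-column (λ y (x , c) → a x y c) ys (x , s) v) ⟨
  antidiag r (λ s t → compSum xs t (λ v → det _ ys ((x , s) ∷ v))) ∎
  where open ≈-Reasoning

-- Raising one multiplicity: the configurations of total r + 1 with a marked entry of positive
-- multiplicity are those of total r with an arbitrary marked entry.
lower : (A × ℕ → Series) → A × ℕ → Series
lower h (y , zero)  = 𝟘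
lower h (y , suc c) = h (y , c)

lowered : (List (A × ℕ) → A × ℕ → List (A × ℕ) → Series) → List (A × ℕ) → A × ℕ → List (A × ℕ) → Series
lowered H pre p post = lower (λ p′ → H pre p′ post) p

compSum-raise : ∀ (H : List (A × ℕ) → A × ℕ → List (A × ℕ) → Series) ys r →
  compSum ys (suc r) (λ v → splitSum v (lowered H)) ≈ compSum ys r (λ v → splitSum v H)
compSum-raise H []       zero    = ≈-refl
compSum-raise H []       (suc r) = ≈-refl
compSum-raise H (y ∷ ys) r       = begin
  antidiag (suc r) (λ s t → compSum ys t (λ v → lowered H [] (y , s) v ⊞ splitSum v (λ pre → lowered H ((y , s) ∷ pre))))
    ≈⟨ antidiag-cong {G = λ s t → compSum ys t (λ v → lowered H [] (y , s) v ⊞ splitSum v (λ pre → lowered H ((y , s) ∷ pre)))} {H = λ s t → first s t ⊞ later s t} (suc r) (λ s t _ → compSum-⊞ _ _ ys t) ⟩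
  antidiag (suc r) (λ s t → first s t ⊞ later s t)
    ≈⟨ antidiag-⊞ first later (suc r) ⟩
  antidiag (suc r) first ⊞ antidiag (suc r) later
    ≈⟨ +-cong (≈-trans (⊞-congʳ (compSum-zero ys (suc r))) (⊞-identityˡ _)) raise-later ⟩
  antidiag r (λ s t → compSum ys t (H [] (y , s))) ⊞ antidiag r (λ s t → compSum ys t (λ v → splitSum v (λ pre → H ((y , s) ∷ pre))))
    ≈⟨ antidiag-⊞ _ _ r ⟨
  antidiag r (λ s t → compSum ys t (H [] (y , s)) ⊞ compSum ys t (λ v → splitSum v (λ pre → H ((y , s) ∷ pre))))
    ≈⟨ antidiag-cong r (λ s t _ → compSum-⊞ _ _ ys t) ⟨
  antidiag r (λ s t → compSum ys t (λ v → H [] (y , s) v ⊞ splitSum v (λ pre → H ((y , s) ∷ pre)))) ∎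
  where
  open ≈-Reasoning
  first later : ℕ → ℕ → Series
  first s t = compSum ys t (lowered H [] (y , s))
  later s t = compSum ys t (λ v → splitSum v (λ pre → lowered H ((y , s) ∷ pre)))
  lowered-zero : ∀ (G : List (A × ℕ) → A × ℕ → List (A × ℕ) → Series) v → total v ≡ 0 → splitSum v (lowered G) ≈ 𝟘
  lowered-zero G []               _  = ≈-refl
  lowered-zero G ((y , zero) ∷ v) eq = ≈-trans (⊞-identityˡ _) (lowered-zero (λ pre → G ((y , 0) ∷ pre)) v eq)
  raise-later : antidiag (suc r) later ≈ antidiag r (λ s t → compSum ys t (λ v → splitSum v (λ pre → H ((y , s) ∷ pre))))
  raise-later = ≈-trans (antidiag-last later r) (≈-trans
    (+-cong (antidiag-cong r λ s t _ → compSum-raise (λ pre → H ((y , s) ∷ pre)) ys t)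
            (≈-trans (compSum-cong ys 0 λ v _ tot → lowered-zero (λ pre → H ((y , suc r) ∷ pre)) v tot) (compSum-zero ys 0)))
    (⊞-identityʳ _))

-- Powers of q and the kernel 1 / (1 − q^{b−a})

q^ : ℕ → Series
coef (q^ a) = mono a

private
  q^-suc-0 : ∀ a f → coef (q^ (suc a) · f) 0 ≡ ℤ.+ 0
  q^-suc-0 a f = ⊛-zero (mono (suc a)) (coef f)

  q^-suc-suc : ∀ a f d → coef (q^ (suc a) · f) (suc d) ≡ coef (q^ a · f) d
  q^-suc-suc a f d = trans (⊛-suc (mono (suc a)) (coef f) d) (ℤᵖ.+-identityˡ _)

q^-0 : q^ 0 ≈ 𝟙
q^-0 .at zero    = refl
q^-0 .at (suc d) = refl

q^-+ : ∀ a b → q^ (a + b) ≈ q^ a · q^ b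
q^-+ zero    b = ≈-sym (≈-trans (·-congʳ q^-0) (·-identityˡ (q^ b)))
q^-+ (suc a) b .at zero    = sym (q^-suc-0 a (q^ b))
q^-+ (suc a) b .at (suc d) = trans (at (q^-+ a b) d) (sym (q^-suc-suc a (q^ b) d))

coef-q^-· : ∀ a f d → coef (q^ a · f) (a + d) ≡ coef f d
coef-q^-· zero    f d = at (≈-trans (·-congʳ q^-0) (·-identityˡ f)) d
coef-q^-· (suc a) f d = trans (q^-suc-suc a f (a + d)) (coef-q^-· a f d)

coef-q^-·-< : ∀ a f d → d < a → coef (q^ a · f) d ≡ ℤ.+ 0
coef-q^-·-< (suc a) f zero    _         = q^-suc-0 a f
coef-q^-·-< (suc a) f (suc d) (s≤s d<a) = trans (q^-suc-suc a f d) (coef-q^-·-< a f d d<a)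

q^-cancel : ∀ a {f g} → q^ a · f ≈ q^ a · g → f ≈ g
q^-cancel a {f} {g} p .at d = trans (sym (coef-q^-· a f d)) (trans (at p (a + d)) (coef-q^-· a g d))

inverse : Series → Series
coef (inverse f) = inv (coef f)

private
  zipWith-invRev : ∀ f g d → sumℤ (zipWith ℤ._*_ (applyUpTo g (suc d)) (invRev f d)) ≡ (g ⊛ inv f) d
  zipWith-invRev f g zero    = trans (ℤᵖ.+-identityʳ _) (sym (⊛-zero g (inv f)))
  zipWith-invRev f g (suc d) = trans (cong (ℤ._+_ (g 0 ℤ.* inv f (suc d))) (zipWith-invRev f (g ∘ suc) d)) (sym (⊛-suc g (inv f) d))

inverse-right : ∀ f → coef f 0 ≡ ℤ.+ 1 → f · inverse f ≈ 𝟙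
inverse-right f f0 .at zero    = trans (⊛-zero (coef f) (inv (coef f))) (trans (ℤᵖ.*-identityʳ _) f0)
inverse-right f f0 .at (suc d) = begin
  (coef f ⊛ inv (coef f)) (suc d)                                     ≡⟨ ⊛-suc (coef f) (inv (coef f)) d ⟩
  coef f 0 ℤ.* inv (coef f) (suc d) ℤ.+ (tail (coef f) ⊛ inv (coef f)) d
    ≡⟨ cong₂ (λ x y → x ℤ.* (ℤ.- y) ℤ.+ (tail (coef f) ⊛ inv (coef f)) d) f0
         (trans (cong (λ l → sumℤ (zipWith ℤ._*_ l (invRev (coef f) d))) (map-upTo (tail (coef f)) (suc d))) (zipWith-invRev (coef f) (tail (coef f)) d)) ⟩
  ℤ.+ 1 ℤ.* ℤ.- x ℤ.+ x                                               ≡⟨ cong (ℤ._+ x) (ℤᵖ.*-identityˡ (ℤ.- x)) ⟩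
  ℤ.- x ℤ.+ x                                                         ≡⟨ ℤᵖ.+-inverseˡ x ⟩
  ℤ.+ 0                                                               ∎
  where
  open ≡-Reasoning
  x = (tail (coef f) ⊛ inv (coef f)) d

inverse-· : ∀ f g → coef f 0 ≡ ℤ.+ 1 → inverse f · (f · g) ≈ g
inverse-· f g f0 = ≈-trans (solve 3 (λ f i g → i :* (f :* g) := (f :* i) :* g) ≈-refl f (inverse f) g)
  (≈-trans (·-congʳ (inverse-right f f0)) (·-identityˡ g))
  where open Solver

·-unit-cancel : ∀ f {g h} → coef f 0 ≡ ℤ.+ 1 → f · g ≈ f · h → g ≈ h
·-unit-cancel f {g} {h} f0 p = ≈-trans (≈-sym (inverse-· f g f0)) (≈-trans (·-congˡ p) (inverse-· f h f0))

om : ℕ → Series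
om e = 𝟙 ⊟ q^ e

om-unit : ∀ {e} → 0 < e → coef (om e) 0 ≡ ℤ.+ 1
om-unit {suc e} _ = refl

·-unit : ∀ f g → coef f 0 ≡ ℤ.+ 1 → coef g 0 ≡ ℤ.+ 1 → coef (f · g) 0 ≡ ℤ.+ 1
·-unit f g p r = trans (⊛-zero (coef f) (coef g)) (cong₂ ℤ._*_ p r)

∏-unit : ∀ {A : Set} (f : A → Series) xs → (∀ x → coef (f x) 0 ≡ ℤ.+ 1) → coef (∏ f xs) 0 ≡ ℤ.+ 1
∏-unit f []       h = refl
∏-unit f (x ∷ xs) h = ·-unit (f x) (∏ f xs) (h x) (∏-unit f xs h)

-- J a b = 1 / (1 − q^{b−a}), a power series for either sign of b − a; meaningless for a = b.
signed : ℕ → ℕ → Series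
signed (suc e) _ = inverse (om (suc e))
signed zero    e = neg (q^ e · inverse (om e))

J : ℕ → ℕ → Series
J a b = signed (b ∸ a) (a ∸ b)

J-< : ∀ {a b} → a < b → J a b ≡ inverse (om (b ∸ a))
J-< {a} {b} a<b with b ∸ a in eq
... | suc e = refl
... | zero  = contradiction (m∸n≡0⇒m≤n eq) (<⇒≱ a<b)

J-≥ : ∀ {a b} → b ≤ a → J a b ≡ neg (q^ (a ∸ b) · inverse (om (a ∸ b)))
J-≥ {a} {b} b≤a = cong (λ e → signed e (a ∸ b)) (m≤n⇒m∸n≡0 b≤a)

J-shift : ∀ e a b → J (e + a) (e + b) ≡ J a b
J-shift e a b = cong₂ signed ([m+n]∸[m+o]≡n∸o e b a) ([m+n]∸[m+o]≡n∸o e a b)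

difference : ∀ {a b} → a ≤ b → q^ a ⊟ q^ b ≈ q^ a · om (b ∸ a)
difference {a} {b} a≤b = begin
  q^ a ⊟ q^ b               ≈⟨ ⊟-congˡ (≡⇒≈ (cong q^ (sym (m+[n∸m]≡n a≤b)))) ⟩
  q^ a ⊟ q^ (a + (b ∸ a))   ≈⟨ ⊟-congˡ (q^-+ a (b ∸ a)) ⟩
  q^ a ⊟ q^ a · q^ (b ∸ a)  ≈⟨ solve 2 (λ x y → x :- x :* y := x :* (:1 :- y)) ≈-refl (q^ a) (q^ (b ∸ a)) ⟩
  q^ a · om (b ∸ a)         ∎
  where
  open ≈-Reasoning
  open Solver

⊟-swap : ∀ f g → f ⊟ g ≈ neg (g ⊟ f)
⊟-swap = solve 2 (λ f g → f :- g := :- (g :- f)) ≈-refl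
  where open Solver

neg-cancel : ∀ {f g} → neg f ≈ neg g → f ≈ g
neg-cancel p .at d = ℤᵖ.neg-injective (at p d)

-- Characterises `J a b` as X_a / (X_a - X_b) for X_a = q^a and hides the sign of b - a. The further
-- identities for `J` in this section come from clearing denominators with it.
J-defining : ∀ {a b} → a ≢ b → (q^ a ⊟ q^ b) · J a b ≈ q^ a
J-defining {a} {b} a≢b with ≤-total a b
... | inj₁ a≤b = ≈-trans (·-congˡ (≡⇒≈ (J-< (≤∧≢⇒< a≤b a≢b)))) (begin
    (q^ a ⊟ q^ b) · inverse (om (b ∸ a))             ≈⟨ ·-congʳ (difference a≤b) ⟩
    q^ a · om (b ∸ a) · inverse (om (b ∸ a))         ≈⟨ ·-assoc _ _ _ ⟩
    q^ a · (om (b ∸ a) · inverse (om (b ∸ a)))       ≈⟨ ·-congˡ (inverse-right _ (om-unit (m<n⇒0<n∸m (≤∧≢⇒< a≤b a≢b)))) ⟩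
    q^ a · 𝟙                                         ≈⟨ ·-identityʳ _ ⟩
    q^ a                                             ∎)
  where open ≈-Reasoning
... | inj₂ b≤a = ≈-trans (·-congˡ (≡⇒≈ (J-≥ b≤a))) (begin
    (q^ a ⊟ q^ b) · neg (q^ (a ∸ b) · i)
      ≈⟨ solve 4 (λ x y z i → (x :- y) :* :- (z :* i) := (y :- x) :* (z :* i)) ≈-refl (q^ a) (q^ b) (q^ (a ∸ b)) i ⟩
    (q^ b ⊟ q^ a) · (q^ (a ∸ b) · i)                 ≈⟨ ·-congʳ (difference b≤a) ⟩
    (q^ b · om (a ∸ b)) · (q^ (a ∸ b) · i)
      ≈⟨ solve 4 (λ y o z i → (y :* o) :* (z :* i) := (y :* z) :* (o :* i)) ≈-refl (q^ b) (om (a ∸ b)) (q^ (a ∸ b)) i ⟩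
    (q^ b · q^ (a ∸ b)) · (om (a ∸ b) · i)
      ≈⟨ ·-cong (≈-sym (q^-+ b (a ∸ b))) (inverse-right _ (om-unit (m<n⇒0<n∸m (≤∧≢⇒< b≤a (a≢b ∘ sym))))) ⟩
    q^ (b + (a ∸ b)) · 𝟙                             ≈⟨ ·-identityʳ _ ⟩
    q^ (b + (a ∸ b))                                 ≡⟨ cong q^ (m+[n∸m]≡n b≤a) ⟩
    q^ a                                             ∎)
  where
  open ≈-Reasoning
  open Solver
  i = inverse (om (a ∸ b))

-- The difference is, up to sign, a power of q times a unit, hence not a zero divisor.
difference-cancel : ∀ {a b f g} → a ≢ b → (q^ a ⊟ q^ b) · f ≈ (q^ a ⊟ q^ b) · g → f ≈ g
difference-cancel {a} {b} {f} {g} a≢b p with ≤-total a b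
... | inj₁ a≤b = cancel a b a≤b a≢b p
  where
  cancel : ∀ a b → a ≤ b → a ≢ b → (q^ a ⊟ q^ b) · f ≈ (q^ a ⊟ q^ b) · g → f ≈ g
  cancel a b a≤b a≢b p = ·-unit-cancel (om (b ∸ a)) (om-unit (m<n⇒0<n∸m (≤∧≢⇒< a≤b a≢b))) (q^-cancel a
    (≈-trans (≈-sym (·-assoc _ _ _)) (≈-trans (·-congʳ (≈-sym (difference a≤b))) (≈-trans p (≈-trans (·-congʳ (difference a≤b)) (·-assoc _ _ _))))))
... | inj₂ b≤a = ·-unit-cancel (om (a ∸ b)) (om-unit (m<n⇒0<n∸m (≤∧≢⇒< b≤a (a≢b ∘ sym)))) (q^-cancel b (neg-cancel
    (≈-trans (regroup f) (≈-trans p (≈-sym (regroup g))))))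
  where
  open Solver
  regroup : ∀ f → neg (q^ b · (om (a ∸ b) · f)) ≈ (q^ a ⊟ q^ b) · f
  regroup f = ≈-trans (solve 3 (λ y o f → :- (y :* (o :* f)) := :- (y :* o) :* f) ≈-refl (q^ b) (om (a ∸ b)) f)
    (·-congʳ (≈-trans (neg-cong (≈-sym (difference b≤a))) (≈-sym (⊟-swap (q^ a) (q^ b)))))

J-sum : ∀ {a b} → a ≢ b → J a b ⊞ J b a ≈ 𝟙
J-sum {a} {b} a≢b = difference-cancel a≢b (begin
  (q^ a ⊟ q^ b) · (J a b ⊞ J b a)
    ≈⟨ solve 4 (λ x y u v → (x :- y) :* (u :+ v) := (x :- y) :* u :- (y :- x) :* v) ≈-refl (q^ a) (q^ b) (J a b) (J b a) ⟩
  (q^ a ⊟ q^ b) · J a b ⊟ (q^ b ⊟ q^ a) · J b a     ≈⟨ ⊟-cong (J-defining a≢b) (J-defining (a≢b ∘ sym)) ⟩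
  q^ a ⊟ q^ b                                       ≈⟨ ·-identityʳ _ ⟨
  (q^ a ⊟ q^ b) · 𝟙                                 ∎)
  where
  open ≈-Reasoning
  open Solver

J-swap : ∀ {a b} → a ≢ b → q^ b · J a b ≈ neg (q^ a · J b a)
J-swap {a} {b} a≢b = begin
  q^ b · J a b                                            ≈⟨ solve 3 (λ x y u → y :* u := x :* u :- (x :- y) :* u) ≈-refl (q^ a) (q^ b) (J a b) ⟩
  q^ a · J a b ⊟ (q^ a ⊟ q^ b) · J a b                    ≈⟨ ⊟-congˡ (J-defining a≢b) ⟩
  q^ a · J a b ⊟ q^ a                                     ≈⟨ solve 3 (λ x u v → x :* u :- x := :- (x :* v) :- x :* (:1 :- (u :+ v))) ≈-refl (q^ a) (J a b) (J b a) ⟩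
  neg (q^ a · J b a) ⊟ q^ a · (𝟙 ⊟ (J a b ⊞ J b a))       ≈⟨ ⊟-congˡ (·-congˡ (⊟-congˡ (J-sum a≢b))) ⟩
  neg (q^ a · J b a) ⊟ q^ a · (𝟙 ⊟ 𝟙)                     ≈⟨ solve 2 (λ x v → :- (x :* v) :- x :* (:1 :- :1) := :- (x :* v)) ≈-refl (q^ a) (J b a) ⟩
  neg (q^ a · J b a)                                      ∎
  where
  open ≈-Reasoning
  open Solver

J-three-term : ∀ {x y z} → x ≢ z → y ≢ z → x ≢ y → J x z · J y z ≈ J y x · J x z ⊞ J x y · J y z
J-three-term {x} {y} {z} x≢z y≢z x≢y = difference-cancel x≢z (difference-cancel y≢z (difference-cancel x≢y (begin
  (X ⊟ Y) · ((Y ⊟ Z) · ((X ⊟ Z) · (a · b)))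
    ≈⟨ solve 5 (λ X Y Z a b → (X :- Y) :* ((Y :- Z) :* ((X :- Z) :* (a :* b))) := (X :- Y) :* (((X :- Z) :* a) :* ((Y :- Z) :* b))) ≈-refl X Y Z a b ⟩
  (X ⊟ Y) · (((X ⊟ Z) · a) · ((Y ⊟ Z) · b))
    ≈⟨ ·-congˡ (·-cong (J-defining x≢z) (J-defining y≢z)) ⟩
  (X ⊟ Y) · (X · Y)
    ≈⟨ solve 3 (λ X Y Z → (X :- Y) :* (X :* Y) := (:- (Y :* (X :* (Y :- Z)))) :+ X :* (Y :* (X :- Z))) ≈-refl X Y Z ⟩
  neg (Y · (X · (Y ⊟ Z))) ⊞ X · (Y · (X ⊟ Z))
    ≈⟨ +-cong (neg-cong (·-cong (J-defining (x≢y ∘ sym)) (·-congʳ (J-defining x≢z)))) (·-cong (J-defining x≢y) (·-congʳ (J-defining y≢z))) ⟨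
  neg (((Y ⊟ X) · c) · (((X ⊟ Z) · a) · (Y ⊟ Z))) ⊞ ((X ⊟ Y) · d) · (((Y ⊟ Z) · b) · (X ⊟ Z))
    ≈⟨ solve 7 (λ X Y Z a b c d → (:- (((Y :- X) :* c) :* (((X :- Z) :* a) :* (Y :- Z)))) :+ ((X :- Y) :* d) :* (((Y :- Z) :* b) :* (X :- Z)) :=
                                  (X :- Y) :* ((Y :- Z) :* ((X :- Z) :* (c :* a :+ d :* b)))) ≈-refl X Y Z a b c d ⟩
  (X ⊟ Y) · ((Y ⊟ Z) · ((X ⊟ Z) · (c · a ⊞ d · b))) ∎)))
  where
  open ≈-Reasoning
  open Solver
  X = q^ x
  Y = q^ y
  Z = q^ z
  a = J x z
  b = J y z
  c = J y x
  d = J x y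

-- Makes the partial fractions available for `flip J`. It follows from `J-three-term` because
-- `J z x` is 1 - `J x z`.
J-three-termᵀ : ∀ {x y z} → x ≢ z → y ≢ z → x ≢ y → J z x · J z y ≈ J x y · J z x ⊞ J y x · J z y
J-three-termᵀ {x} {y} {z} x≢z y≢z x≢y = begin
  J z x · J z y                               ≈⟨ ·-cong (complement x≢z) (complement y≢z) ⟩
  (𝟙 ⊟ J x z) · (𝟙 ⊟ J y z)                   ≈⟨ solve 2 (λ a b → (:1 :- a) :* (:1 :- b) := (:1 :- a :- b) :+ a :* b) ≈-refl (J x z) (J y z) ⟩
  (𝟙 ⊟ J x z ⊟ J y z) ⊞ J x z · J y z         ≈⟨ ⊞-congˡ (J-three-term x≢z y≢z x≢y) ⟩
  (𝟙 ⊟ J x z ⊟ J y z) ⊞ (J y x · J x z ⊞ J x y · J y z)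
    ≈⟨ ⊞-congˡ (+-cong (·-congʳ (complement x≢y)) ≈-refl) ⟩
  (𝟙 ⊟ J x z ⊟ J y z) ⊞ ((𝟙 ⊟ J x y) · J x z ⊞ J x y · J y z)
    ≈⟨ solve 3 (λ a b d → (:1 :- a :- b) :+ ((:1 :- d) :* a :+ d :* b) := d :* (:1 :- a) :+ (:1 :- d) :* (:1 :- b)) ≈-refl (J x z) (J y z) (J x y) ⟩
  J x y · (𝟙 ⊟ J x z) ⊞ (𝟙 ⊟ J x y) · (𝟙 ⊟ J y z)
    ≈⟨ +-cong (·-congˡ (complement x≢z)) (·-cong (complement x≢y) (complement y≢z)) ⟨
  J x y · J z x ⊞ J y x · J z y ∎
  where
  open ≈-Reasoning
  open Solver
  complement : ∀ {a b} → a ≢ b → J b a ≈ 𝟙 ⊟ J a b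
  complement {a} {b} a≢b = begin
    J b a                       ≈⟨ solve 2 (λ u v → v := (u :+ v) :- u) ≈-refl (J a b) (J b a) ⟩
    (J a b ⊞ J b a) ⊟ J a b     ≈⟨ ⊟-cong (J-sum a≢b) ≈-refl ⟩
    𝟙 ⊟ J a b                   ∎

om-J : ∀ {e a b} → 0 < e → b ≡ a + e → om e · J a b ≈ 𝟙
om-J {e} {a} 0<e refl = q^-cancel a (begin
  q^ a · (om e · J a (a + e))            ≈⟨ solve 3 (λ x z u → x :* ((:1 :- z) :* u) := (x :- x :* z) :* u) ≈-refl (q^ a) (q^ e) (J a (a + e)) ⟩
  (q^ a ⊟ q^ a · q^ e) · J a (a + e)     ≈⟨ ·-congʳ (⊟-congˡ (q^-+ a e)) ⟨
  (q^ a ⊟ q^ (a + e)) · J a (a + e)      ≈⟨ J-defining (<⇒≢ (m<m+n a 0<e)) ⟩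
  q^ a                                   ≈⟨ ·-identityʳ _ ⟨
  q^ a · 𝟙                               ∎)
  where
  open ≈-Reasoning
  open Solver

-- Chain sums modulo M

∏₂ : (A → A → Series) → List A → Series
∏₂ φ []      = 𝟙
∏₂ φ (x ∷ v) = ∏ (φ x) v · ∏₂ φ v

∏₂-middle : ∀ {φ : A → A → Series} → (∀ x y → φ x y ≈ φ y x) → ∀ pre p post →
  ∏₂ φ (pre ++ p ∷ post) ≈ ∏ (φ p) (pre ++ post) · ∏₂ φ (pre ++ post)
∏₂-middle         symm []        p post = ≈-refl
∏₂-middle {φ = φ} symm (x ∷ pre) p post = begin
  ∏ (φ x) (pre ++ p ∷ post) · ∏₂ φ (pre ++ p ∷ post)
    ≈⟨ ·-cong (∏-middle (φ x) pre p post) (∏₂-middle symm pre p post) ⟩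
  (φ x p · ∏ (φ x) (pre ++ post)) · (∏ (φ p) (pre ++ post) · ∏₂ φ (pre ++ post))
    ≈⟨ solve 4 (λ a b c d → (a :* b) :* (c :* d) := (a :* c) :* (b :* d)) ≈-refl (φ x p) (∏ (φ x) (pre ++ post)) (∏ (φ p) (pre ++ post)) (∏₂ φ (pre ++ post)) ⟩
  (φ x p · ∏ (φ p) (pre ++ post)) · (∏ (φ x) (pre ++ post) · ∏₂ φ (pre ++ post))
    ≈⟨ ·-congʳ (·-congʳ (symm x p)) ⟩
  (φ p x · ∏ (φ p) (pre ++ post)) · (∏ (φ x) (pre ++ post) · ∏₂ φ (pre ++ post)) ∎
  where
  open ≈-Reasoning
  open Solver

∏-𝟘 : ∀ (v : List A) → 0 < length v → ∏ (λ _ → 𝟘) v ≈ 𝟘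
∏-𝟘 (x ∷ v) _ = ·-zeroˡ _

-- For h = 1 the relation that `expansion` demands of h is just `two`.
unit-expansion : ∀ (K : ℕ → ℕ → Series) → (∀ {x y z} → x ≢ z → y ≢ z → x ≢ y → K x z · K y z ≈ K y x · K x z ⊞ K x y · K y z) →
  (∀ {x y} → x ≢ y → K x y ⊞ K y x ≈ 𝟙) → (pos : A → ℕ) (s : A → Series) → ∀ v → AllPairs (λ a b → pos a ≢ pos b) v →
  ∏ (λ b → 𝟙 ⊟ s b) v ≈ 𝟙 ⊟ splitSum v (λ pre p post → s p · ∏ (λ b → 𝟙 ⊟ s b · K (pos b) (pos p)) (pre ++ post))
unit-expansion K three two pos s v ds = begin
  ∏ (λ b → 𝟙 ⊟ s b) v          ≈⟨ ∏-cong v (λ b → ⊟-congˡ (·-identityʳ (s b))) ⟨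
  ∏ (λ b → 𝟙 ⊟ s b · 𝟙) v
    ≈⟨ expansion (λ _ → 𝟙) v ds (AllPairs.map (λ x≢y → ≈-trans (·-identityˡ 𝟙) (≈-trans (≈-sym (two (x≢y ∘ sym))) (≈-sym (+-cong (·-identityʳ _) (·-identityʳ _))))) ds) ⟩
  𝟙 ⊟ splitSum v (residue (λ _ → 𝟙))
    ≈⟨ ⊟-congˡ (splitSum-cong′ v λ pre p post → ·-congˡ (·-identityˡ _)) ⟩
  𝟙 ⊟ splitSum v (λ pre p post → s p · ∏ (λ b → 𝟙 ⊟ s b · K (pos b) (pos p)) (pre ++ post)) ∎
  where
  open ≈-Reasoning
  open PartialFractions (λ a b → K (pos a) (pos b)) s (λ a b → pos a ≢ pos b) (λ z≢x z≢y x≢y → three (z≢x ∘ sym) (z≢y ∘ sym) x≢y)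

-- Take s = 1 in `unit-expansion`: the product on the left is 0 for nonempty v, while 1 - K b p
-- becomes K p b on the right.
splitSum-∏-complement : ∀ (K : ℕ → ℕ → Series) → (∀ {x y z} → x ≢ z → y ≢ z → x ≢ y → K x z · K y z ≈ K y x · K x z ⊞ K x y · K y z) →
  (∀ {x y} → x ≢ y → K x y ⊞ K y x ≈ 𝟙) → (pos : A → ℕ) → ∀ v → 0 < length v → AllPairs (λ a b → pos a ≢ pos b) v →
  splitSum v (λ pre p post → ∏ (λ b → K (pos p) (pos b)) (pre ++ post)) ≈ 𝟙
splitSum-∏-complement K three two pos v nonempty ds = begin
  splitSum v (λ pre p post → ∏ (λ b → K (pos p) (pos b)) (pre ++ post))
    ≈⟨ splitSum-cong v (λ pre p post eq → let (l , r) = split-AllPairs pre ds eq in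
         ∏-congAll (Allᵖ.++⁺ (All.map (λ b≢p → complement b≢p) l) (All.map (λ p≢b → complement (p≢b ∘ sym)) r)) λ b h → h) ⟩
  splitSum v (λ pre p post → ∏ (λ b → 𝟙 ⊟ 𝟙 · K (pos b) (pos p)) (pre ++ post))
    ≈⟨ splitSum-cong′ v (λ pre p post → ·-identityˡ _) ⟨
  Σ₁
    ≈⟨ solve 1 (λ x → x := :1 :- (:1 :- x)) ≈-refl Σ₁ ⟩
  𝟙 ⊟ (𝟙 ⊟ Σ₁)
    ≈⟨ ⊟-congˡ (unit-expansion K three two pos (λ _ → 𝟙) v ds) ⟨
  𝟙 ⊟ ∏ (λ b → 𝟙 ⊟ 𝟙) v
    ≈⟨ ⊟-congˡ (≈-trans (∏-cong v λ _ → solve 0 (:1 :- :1 := :0) ≈-refl) (∏-𝟘 v nonempty)) ⟩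
  𝟙 ⊟ 𝟘
    ≈⟨ solve 0 (:1 :- :0 := :1) ≈-refl ⟩
  𝟙 ∎
  where
  open ≈-Reasoning
  open Solver
  Σ₁ = splitSum v (λ pre p post → 𝟙 · ∏ (λ b → 𝟙 ⊟ 𝟙 · K (pos b) (pos p)) (pre ++ post))
  complement : ∀ {x y} → x ≢ y → K y x ≈ 𝟙 ⊟ 𝟙 · K x y
  complement {x} {y} x≢y = ≈-trans (solve 2 (λ a b → b := (a :+ b) :- (:1 :* a)) ≈-refl (K x y) (K y x)) (⊟-cong (two x≢y) ≈-refl)

sumBy : (A → ℕ) → List A → ℕ
sumBy h = foldr (λ b s → h b + s) 0

tri : ℕ → ℕ
tri zero    = 0
tri (suc c) = c + tri c

-- A label (y , c) stands for the elements y, y + M, …, y + (c − 1) M of a residue class;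
-- its position is the first element that is missing.
module Chain (M : ℕ) (0<M : 0 < M) where

  position : ℕ × ℕ → ℕ
  position (y , c) = y + M * c

  -- the sum of the elements that a label stands for
  weight : ℕ × ℕ → ℕ
  weight (y , c) = y * c + M * tri c

  raise : ℕ × ℕ → ℕ × ℕ
  raise (y , c) = y , suc c

  labels-raise : ∀ pre p post → map proj₁ (pre ++ raise p ∷ post) ≡ map proj₁ (pre ++ p ∷ post)
  labels-raise []        p post = refl
  labels-raise (x ∷ pre) p post = cong (proj₁ x ∷_) (labels-raise pre p post)

  -- Distinct labels less than M apart are incongruent modulo M, so positions in different classes
  -- never coincide, whatever the multiplicities. This keeps the kernels between two classes
  -- meaningful.
  Near : ℕ → ℕ → Set
  Near y z = y ≢ z × y < z + M × z < y + M

  position-raise : ∀ p → position (raise p) ≡ M + position p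
  position-raise (y , c) = solve 3 (λ y M c → y :+ M :* (con 1 :+ c) := M :+ (y :+ M :* c)) refl y M c
    where open ℕ-Solver

  weight-raise : ∀ p → weight (raise p) ≡ weight p + position p
  weight-raise (y , c) = solve 4 (λ y M c t → y :* (con 1 :+ c) :+ M :* (c :+ t) := y :* c :+ M :* t :+ (y :+ M :* c)) refl y M c (tri c)
    where open ℕ-Solver

  private
    position-≢-≤ : ∀ {y z} c d → Near y z → c ≤ d → y + M * c ≢ z + M * d
    position-≢-≤ {y} {z} c d (y≢z , y<z+M , _) c≤d eq with m≤n⇒m<n∨m≡n c≤d
    ... | inj₂ refl = y≢z (+-cancelʳ-≡ (M * c) y z eq)
    ... | inj₁ c<d  = <⇒≢ (begin-strict
      y + M * c           <⟨ +-monoˡ-< (M * c) y<z+M ⟩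
      z + M + M * c       ≡⟨ solve 3 (λ z M c → z :+ M :+ M :* c := z :+ M :* (con 1 :+ c)) refl z M c ⟩
      z + M * suc c       ≤⟨ +-monoʳ-≤ z (*-monoʳ-≤ M c<d) ⟩
      z + M * d           ∎) eq
      where
      open ≤-Reasoning
      open ℕ-Solver

  position-≢ : ∀ {a b} → Near (proj₁ a) (proj₁ b) → position a ≢ position b
  position-≢ {_ , c} {_ , d} near@(y≢z , l , r) with ≤-total c d
  ... | inj₁ c≤d = position-≢-≤ c d near c≤d
  ... | inj₂ d≤c = position-≢-≤ d c (y≢z ∘ sym , r , l) d≤c ∘ sym

  position-AllPairs : ∀ {v : List (ℕ × ℕ)} → AllPairs (λ a b → Near (proj₁ a) (proj₁ b)) v → AllPairs (λ a b → position a ≢ position b) v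
  position-AllPairs = AllPairs.map (λ {a} {b} → position-≢ {a} {b})

  -- ladder x z c = ∏_{u=1}^{c} J x (z + M u)
  ladder : ℕ → ℕ → ℕ → Series
  ladder x z zero    = 𝟙
  ladder x z (suc c) = J x (M + z) · ladder x (M + z) c

  ladder-shift : ∀ x z c → ladder (M + x) (M + z) c ≈ ladder x z c
  ladder-shift x z zero    = ≈-refl
  ladder-shift x z (suc c) = ·-cong (≡⇒≈ (J-shift M x (M + z))) (ladder-shift x (M + z) c)

  ladder-last : ∀ x z c → ladder x z (suc c) ≈ ladder x z c · J x (M + z + M * c)
  ladder-last x z zero    = ≈-trans (·-comm _ _) (·-congˡ (≡⇒≈ (cong (J x) (sym (trans (cong (M + z +_) (*-zeroʳ M)) (+-identityʳ _))))))
  ladder-last x z (suc c) = begin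
    J x (M + z) · ladder x (M + z) (suc c)                              ≈⟨ ·-congˡ (ladder-last x (M + z) c) ⟩
    J x (M + z) · (ladder x (M + z) c · J x (M + (M + z) + M * c))      ≈⟨ ·-assoc _ _ _ ⟨
    ladder x z (suc c) · J x (M + (M + z) + M * c)
      ≡⟨ cong (λ e → ladder x z (suc c) · J x e) (ℕ-Solver.solve 3 (λ M z c → M :+ (M :+ z) :+ M :* c := M :+ z :+ M :* (con 1 :+ c)) refl M z c) ⟩
    ladder x z (suc c) · J x (M + z + M * suc c) ∎
    where
    open ≈-Reasoning
    open ℕ-Solver using (_:+_; _:*_; _:=_; con)

  -- The reciprocal of (q^M; q^M)_c.
  self : ℕ × ℕ → Series
  self (_ , c) = ladder 0 0 c

  pair : ℕ × ℕ → ℕ × ℕ → Series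
  pair a b = ladder (position a) (position b) (proj₂ a) · ladder (position b) (position a) (proj₂ b)

  pair-sym : ∀ a b → pair a b ≈ pair b a
  pair-sym a b = ·-comm _ _

  -- `poch (total v) · U v` is the sum, over all ways to reach `v` from multiplicities 0 by
  -- successive raises, of the products of the `outflow` factors of the steps. `U-recursion`
  -- expresses this by the last step.
  U : List (ℕ × ℕ) → Series
  U v = ∏ self v · ∏₂ pair v

  U-middle : ∀ pre p post → U (pre ++ p ∷ post) ≈ self p · (∏ (pair p) (pre ++ post) · U (pre ++ post))
  U-middle pre p post = ≈-trans (·-cong (∏-middle self pre p post) (∏₂-middle pair-sym pre p post))
    (solve 4 (λ a b c d → (a :* b) :* (c :* d) := a :* (c :* (b :* d))) ≈-refl (self p) (∏ self (pre ++ post)) (∏ (pair p) (pre ++ post)) (∏₂ pair (pre ++ post)))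
    where open Solver

  self-raise : ∀ y c → om (M * suc c) · self (y , suc c) ≈ self (y , c)
  self-raise y c = begin
    om (M * suc c) · ladder 0 0 (suc c)                        ≈⟨ ·-congˡ (ladder-last 0 0 c) ⟩
    om (M * suc c) · (ladder 0 0 c · J 0 (M + 0 + M * c))      ≈⟨ solve 3 (λ a b c → a :* (b :* c) := (a :* c) :* b) ≈-refl (om (M * suc c)) (ladder 0 0 c) (J 0 (M + 0 + M * c)) ⟩
    (om (M * suc c) · J 0 (M + 0 + M * c)) · ladder 0 0 c      ≈⟨ ·-congʳ (om-J (*-mono-≤ 0<M (s≤s z≤n)) (trans (cong (_+ M * c) (+-identityʳ M)) (sym (*-suc M c)))) ⟩
    𝟙 · ladder 0 0 c                                           ≈⟨ ·-identityˡ _ ⟩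
    ladder 0 0 c                                               ∎
    where
    open ≈-Reasoning
    open Solver

  -- Both sides extend the ladder of b over the position of a by one rung, at opposite ends.
  pair-raise : ∀ a b → (pair a b · J (position a) (position b)) · J (position b) (position (raise a) + M * proj₂ b) ≈
                       pair (raise a) b · J (position b) (position (raise a))
  pair-raise a@(y , c) b@(z , d) rewrite position-raise a = begin
    ((ladder x w c · ladder w x d) · J x w) · J w (M + x + M * d)
      ≈⟨ solve 4 (λ p q r s → ((p :* q) :* r) :* s := (r :* p) :* (q :* s)) ≈-refl (ladder x w c) (ladder w x d) (J x w) (J w (M + x + M * d)) ⟩
    (J x w · ladder x w c) · (ladder w x d · J w (M + x + M * d))
      ≈⟨ ·-cong (·-cong (≡⇒≈ (J-shift M x w)) (ladder-shift x w c)) (ladder-last w x d) ⟨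
    (J (M + x) (M + w) · ladder (M + x) (M + w) c) · (J w (M + x) · ladder w (M + x) d)
      ≈⟨ solve 3 (λ p q r → p :* (q :* r) := (p :* r) :* q) ≈-refl (ladder (M + x) w (suc c)) (J w (M + x)) (ladder w (M + x) d) ⟩
    (ladder (M + x) w (suc c) · ladder w (M + x) d) · J w (M + x) ∎
    where
    open ≈-Reasoning
    open Solver
    x = position a
    w = position b

  private
    -- The hypothesis says that w + e = x + f, so both sides are (1 − q^e) / (1 − q^{x−w}).
    om-J-complement : ∀ {x w e f} → x ≢ w → w + e ≡ x + f → om e · J w x ≈ 𝟙 ⊟ om f · J x w
    om-J-complement {x} {w} {e} {f} x≢w eq = difference-cancel (x≢w ∘ sym) (begin
      (W ⊟ X) · (om e · J w x)         ≈⟨ solve 4 (λ W X o j → (W :- X) :* (o :* j) := o :* ((W :- X) :* j)) ≈-refl W X (om e) (J w x) ⟩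
      om e · ((W ⊟ X) · J w x)         ≈⟨ ·-congˡ (J-defining (x≢w ∘ sym)) ⟩
      om e · W                         ≈⟨ solve 2 (λ E W → (:1 :- E) :* W := W :- W :* E) ≈-refl (q^ e) W ⟩
      W ⊟ W · q^ e                     ≈⟨ ⊟-congˡ (≈-trans (≈-sym (q^-+ w e)) (≈-trans (≡⇒≈ (cong q^ eq)) (q^-+ x f))) ⟩
      W ⊟ X · q^ f                     ≈⟨ solve 3 (λ W X F → W :- X :* F := (W :- X) :+ (:1 :- F) :* X) ≈-refl W X (q^ f) ⟩
      (W ⊟ X) ⊞ om f · X               ≈⟨ ⊞-congˡ (·-congˡ (J-defining x≢w)) ⟨
      (W ⊟ X) ⊞ om f · ((X ⊟ W) · J x w)
        ≈⟨ solve 4 (λ W X o j → (W :- X) :+ o :* ((X :- W) :* j) := (W :- X) :* (:1 :- o :* j)) ≈-refl W X (om f) (J x w) ⟩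
      (W ⊟ X) · (𝟙 ⊟ om f · J x w)     ∎)
      where
      open ≈-Reasoning
      open Solver
      W = q^ w
      X = q^ x

  -- `pair-raise` adds a rung 1 / (1 - q^e) at the far end of the ladder of b, and `om e` removes
  -- it. As w + e is the top of that ladder, `om-J-complement` rewrites the remaining
  -- `om e · J w x′` as the bracket.
  pair-raise-complement : ∀ a b → Near (proj₁ a) (proj₁ b) →
    pair (raise a) b · (𝟙 ⊟ om (M * proj₂ b) · J (position (raise a)) (position b)) ≈ pair a b · J (position a) (position b)
  pair-raise-complement a@(y , c) b@(z , d) near@(_ , _ , z<y+M) = ≈-sym (begin
    pair a b · J x w                                                   ≈⟨ ·-identityʳ _ ⟨
    (pair a b · J x w) · 𝟙                                             ≈⟨ ·-congˡ (om-J 0<e top) ⟨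
    (pair a b · J x w) · (om e · J w (x′ + M * d))
      ≈⟨ solve 3 (λ p o j → p :* (o :* j) := (p :* j) :* o) ≈-refl (pair a b · J x w) (om e) (J w (x′ + M * d)) ⟩
    ((pair a b · J x w) · J w (x′ + M * d)) · om e                     ≈⟨ ·-congʳ (pair-raise a b) ⟩
    (pair (raise a) b · J w x′) · om e
      ≈⟨ solve 3 (λ p j o → (p :* j) :* o := p :* (o :* j)) ≈-refl (pair (raise a) b) (J w x′) (om e) ⟩
    pair (raise a) b · (om e · J w x′)
      ≈⟨ ·-congˡ (om-J-complement (position-≢ {raise a} {b} near) (sym top)) ⟩
    pair (raise a) b · (𝟙 ⊟ om (M * d) · J x′ w) ∎)
    where
    open ≈-Reasoning
    open Solver
    x = position a
    x′ = position (raise a)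
    w = position b
    w<x′+Md : w < x′ + M * d
    w<x′+Md = +-monoˡ-< (M * d) (<-≤-trans z<y+M (+-monoʳ-≤ y (m≤m*n M (suc c))))
    e = x′ + M * d ∸ w
    0<e = m<n⇒0<n∸m w<x′+Md
    top : x′ + M * d ≡ w + e
    top = sym (m+[n∸m]≡n (<⇒≤ w<x′+Md))

  -- The weight of taking the next letter from the class of `p`: what the factors of the
  -- symmetrizing sum telescope to for an infinite alphabet.
  outflow : List (ℕ × ℕ) → ℕ × ℕ → List (ℕ × ℕ) → Series
  outflow pre p post = ∏ (λ b → J (position p) (position b)) (pre ++ post)

  NearPairs : List (ℕ × ℕ) → Set
  NearPairs = AllPairs (λ a b → Near (proj₁ a) (proj₁ b))

  near-rest : ∀ {v} pre {p post} → NearPairs v → pre ++ p ∷ post ≡ v → All (λ b → Near (proj₁ p) (proj₁ b)) (pre ++ post)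
  near-rest pre ns eq = let (l , r) = split-AllPairs pre ns eq in Allᵖ.++⁺ (All.map (λ (≢ , u , w) → ≢ ∘ sym , w , u) l) r

  ∏-q^ : ∀ (v : List (ℕ × ℕ)) → ∏ (λ b → 𝟙 ⊟ om (M * proj₂ b)) v ≈ q^ (M * total v)
  ∏-q^ []            = ≈-sym (≈-trans (≡⇒≈ (cong q^ (*-zeroʳ M))) q^-0)
  ∏-q^ ((y , c) ∷ v) = begin
    (𝟙 ⊟ om (M * c)) · ∏ (λ b → 𝟙 ⊟ om (M * proj₂ b)) v   ≈⟨ ·-cong (solve 1 (λ x → :1 :- (:1 :- x) := x) ≈-refl (q^ (M * c))) (∏-q^ v) ⟩
    q^ (M * c) · q^ (M * total v)                          ≈⟨ q^-+ _ _ ⟨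
    q^ (M * c + M * total v)                               ≡⟨ cong q^ (*-distribˡ-+ M c (total v)) ⟨
    q^ (M * (c + total v))                                 ∎
    where
    open ≈-Reasoning
    open Solver

  -- Partial fractions for q^(M · total) = ∏ (1 - (1 - q^(M c))), with the kernel taken at the
  -- positions. The term of an entry of multiplicity c carries the factor 1 - q^(M c): it vanishes
  -- for c = 0, and otherwise it cancels a factor of `self` and lowers the entry.
  U-recursion : ∀ v → NearPairs v →
    om (M * total v) · U v ≈ splitSum v (lowered λ pre p post → U (pre ++ p ∷ post) · outflow pre p post)
  U-recursion v ns = begin
    om (M * total v) · U v
      ≈⟨ ·-congʳ (≈-trans (⊟-congˡ (≈-trans (≈-sym (∏-q^ v)) (unit-expansion (flip J) (λ x≢z y≢z x≢y → J-three-termᵀ x≢z y≢z x≢y)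
           (λ x≢y → J-sum (x≢y ∘ sym)) position (λ b → om (M * proj₂ b)) v (position-AllPairs ns))))
           (solve 1 (λ x → :1 :- (:1 :- x) := x) ≈-refl (splitSum v R))) ⟩
    splitSum v R · U v
      ≈⟨ ≈-trans (·-comm _ _) (≈-sym (splitSum-· (U v) R v)) ⟩
    splitSum v (λ pre p post → U v · R pre p post)
      ≈⟨ splitSum-cong v (λ { pre p post refl → term pre p post (near-rest pre ns refl) }) ⟩
    splitSum v (lowered λ pre p post → U (pre ++ p ∷ post) · outflow pre p post) ∎
    where
    open ≈-Reasoning
    open Solver
    R : List (ℕ × ℕ) → ℕ × ℕ → List (ℕ × ℕ) → Series
    R pre p post = om (M * proj₂ p) · ∏ (λ b → 𝟙 ⊟ om (M * proj₂ b) · J (position p) (position b)) (pre ++ post)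
    term : ∀ pre p post → All (λ b → Near (proj₁ p) (proj₁ b)) (pre ++ post) →
      U (pre ++ p ∷ post) · R pre p post ≈ lowered (λ pre p post → U (pre ++ p ∷ post) · outflow pre p post) pre p post
    term pre (y , zero) post near = ≈-trans (·-congˡ (≈-trans (·-congʳ (≈-trans (⊟-congˡ (≈-trans (≡⇒≈ (cong q^ (*-zeroʳ M))) q^-0))
      (solve 0 (:1 :- :1 := :0) ≈-refl))) (·-zeroˡ _))) (·-zeroʳ _)
    term pre (y , suc c) post near = begin
      U (pre ++ p ∷ post) · (om (M * suc c) · ∏ ω rest)                     ≈⟨ ·-congʳ (U-middle pre p post) ⟩
      (self p · (∏ (pair p) rest · U rest)) · (om (M * suc c) · ∏ ω rest)
        ≈⟨ solve 5 (λ s p u o w → (s :* (p :* u)) :* (o :* w) := (o :* s) :* ((p :* w) :* u)) ≈-refl (self p) (∏ (pair p) rest) (U rest) (om (M * suc c)) (∏ ω rest) ⟩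
      (om (M * suc c) · self p) · ((∏ (pair p) rest · ∏ ω rest) · U rest)
        ≈⟨ ·-cong (self-raise y c) (·-congʳ (begin
             ∏ (pair p) rest · ∏ ω rest         ≈⟨ ∏-· (pair p) ω rest ⟨
             ∏ (λ b → pair p b · ω b) rest      ≈⟨ ∏-congAll near (λ b nb → pair-raise-complement (y , c) b nb) ⟩
             ∏ (λ b → pair (y , c) b · J (position (y , c)) (position b)) rest ≈⟨ ∏-· _ _ rest ⟩
             ∏ (pair (y , c)) rest · outflow pre (y , c) post ∎)) ⟩
      self (y , c) · ((∏ (pair (y , c)) rest · outflow pre (y , c) post) · U rest)
        ≈⟨ solve 4 (λ s p o u → s :* ((p :* o) :* u) := (s :* (p :* u)) :* o) ≈-refl (self (y , c)) (∏ (pair (y , c)) rest) (outflow pre (y , c) post) (U rest) ⟩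
      (self (y , c) · (∏ (pair (y , c)) rest · U rest)) · outflow pre (y , c) post
        ≈⟨ ·-congʳ (U-middle pre (y , c) post) ⟨
      U (pre ++ (y , c) ∷ post) · outflow pre (y , c) post ∎
      where
      p = (y , suc c)
      rest = pre ++ post
      ω : ℕ × ℕ → Series
      ω b = 𝟙 ⊟ om (M * proj₂ b) · J (position p) (position b)

  poch : ℕ → Series
  poch zero    = 𝟙
  poch (suc r) = om (M * suc r) · poch r

  zeros : List ℕ → List (ℕ × ℕ)
  zeros = map (_, 0)

  compSum-0 : ∀ (F : List (ℕ × ℕ) → Series) ys → compSum ys 0 F ≈ F (zeros ys)
  compSum-0 F []       = ≈-refl
  compSum-0 F (y ∷ ys) = compSum-0 (λ v → F ((y , 0) ∷ v)) ys

  ∏-self-zeros : ∀ ys → ∏ self (zeros ys) ≈ 𝟙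
  ∏-self-zeros []       = ≈-refl
  ∏-self-zeros (y ∷ ys) = ≈-trans (·-identityˡ _) (∏-self-zeros ys)

  ∏-pair-zero : ∀ y ys → ∏ (pair (y , 0)) (zeros ys) ≈ 𝟙
  ∏-pair-zero y []       = ≈-refl
  ∏-pair-zero y (z ∷ ys) = ≈-trans (·-congʳ (·-identityˡ 𝟙)) (≈-trans (·-identityˡ _) (∏-pair-zero y ys))

  ∏₂-pair-zeros : ∀ ys → ∏₂ pair (zeros ys) ≈ 𝟙
  ∏₂-pair-zeros []       = ≈-refl
  ∏₂-pair-zeros (y ∷ ys) = ≈-trans (·-cong (∏-pair-zero y ys) (∏₂-pair-zeros ys)) (·-identityˡ 𝟙)

  U-zeros : ∀ ys → U (zeros ys) ≈ 𝟙
  U-zeros ys = ≈-trans (·-cong (∏-self-zeros ys) (∏₂-pair-zeros ys)) (·-identityˡ 𝟙)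

  NearLabels : List ℕ → Set
  NearLabels = AllPairs Near

  nearPairs : ∀ {ys} → NearLabels ys → ∀ {v : List (ℕ × ℕ)} → map proj₁ v ≡ ys → NearPairs v
  nearPairs ns refl = AllPairsᵖ.map⁻ ns

  compSum-recursion : ∀ ys → NearLabels ys → ∀ (G : List (ℕ × ℕ) → Series) r →
    poch (suc r) · compSum ys (suc r) (λ v → U v · G v) ≈
    poch r · compSum ys r (λ v → U v · splitSum v (λ pre p post → outflow pre p post · G (pre ++ raise p ∷ post)))
  compSum-recursion ys ns G r = begin
    (om (M * suc r) · poch r) · compSum ys (suc r) (λ v → U v · G v)
      ≈⟨ solve 3 (λ o p c → (o :* p) :* c := p :* (o :* c)) ≈-refl (om (M * suc r)) (poch r) (compSum ys (suc r) (λ v → U v · G v)) ⟩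
    poch r · (om (M * suc r) · compSum ys (suc r) (λ v → U v · G v))
      ≈⟨ ·-congˡ (compSum-· (om (M * suc r)) (λ v → U v · G v) ys (suc r)) ⟨
    poch r · compSum ys (suc r) (λ v → om (M * suc r) · (U v · G v))
      ≈⟨ ·-congˡ (compSum-cong ys (suc r) step) ⟩
    poch r · compSum ys (suc r) (λ v → splitSum v (lowered H))
      ≈⟨ ·-congˡ (compSum-raise H ys r) ⟩
    poch r · compSum ys r (λ v → splitSum v H)
      ≈⟨ ·-congˡ (compSum-cong′ ys r λ v → ≈-trans
           (splitSum-cong v λ { pre p post refl → ·-assoc _ _ _ })
           (splitSum-· (U v) _ v)) ⟩
    poch r · compSum ys r (λ v → U v · splitSum v (λ pre p post → outflow pre p post · G (pre ++ raise p ∷ post))) ∎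
    where
    open ≈-Reasoning
    open Solver
    H : List (ℕ × ℕ) → ℕ × ℕ → List (ℕ × ℕ) → Series
    H pre p post = (U (pre ++ p ∷ post) · outflow pre p post) · G (pre ++ raise p ∷ post)
    step : ∀ v → map proj₁ v ≡ ys → total v ≡ suc r → om (M * suc r) · (U v · G v) ≈ splitSum v (lowered H)
    step v v≡ys tot = begin
      om (M * suc r) · (U v · G v)     ≡⟨ cong (λ t → om (M * t) · (U v · G v)) tot ⟨
      om (M * total v) · (U v · G v)   ≈⟨ solve 3 (λ o u g → o :* (u :* g) := g :* (o :* u)) ≈-refl (om (M * total v)) (U v) (G v) ⟩
      G v · (om (M * total v) · U v)   ≈⟨ ·-congˡ (U-recursion v (nearPairs ns v≡ys)) ⟩
      G v · splitSum v (lowered λ pre p post → U (pre ++ p ∷ post) · outflow pre p post)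
        ≈⟨ splitSum-· (G v) _ v ⟨
      splitSum v (λ pre p post → G v · lowered (λ pre p post → U (pre ++ p ∷ post) · outflow pre p post) pre p post)
        ≈⟨ splitSum-cong v (λ { pre (y , zero) post refl → ·-zeroʳ _ ; pre (y , suc c) post refl → ·-comm _ _ }) ⟩
      splitSum v (lowered H) ∎

  -- The outflows of a configuration add up to 1, so each step of `compSum-recursion` with G = 1
  -- leaves the value unchanged.
  compSum-U : ∀ ys → NearLabels ys → 0 < length ys → ∀ r → poch r · compSum ys r U ≈ 𝟙
  compSum-U ys ns nonempty zero    = ≈-trans (·-identityˡ _) (≈-trans (compSum-0 U ys) (U-zeros ys))
  compSum-U ys ns nonempty (suc r) = begin
    poch (suc r) · compSum ys (suc r) U
      ≈⟨ ·-congˡ (compSum-cong′ ys (suc r) λ v → ·-identityʳ (U v)) ⟨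
    poch (suc r) · compSum ys (suc r) (λ v → U v · 𝟙)
      ≈⟨ compSum-recursion ys ns (λ _ → 𝟙) r ⟩
    poch r · compSum ys r (λ v → U v · splitSum v (λ pre p post → outflow pre p post · 𝟙))
      ≈⟨ ·-congˡ (compSum-cong ys r λ { v refl _ → ≈-trans (·-congˡ (≈-trans (splitSum-cong′ v λ pre p post → ·-identityʳ _)
           (splitSum-∏-complement J J-three-term J-sum position v (subst (0 <_) (length-map proj₁ v) nonempty) (position-AllPairs (nearPairs ns {v} refl)))))
           (·-identityʳ (U v)) }) ⟩
    poch r · compSum ys r U
      ≈⟨ compSum-U ys ns nonempty r ⟩
    𝟙 ∎
    where open ≈-Reasoning

  sumBy-weight-raise : ∀ pre p post → sumBy weight (pre ++ raise p ∷ post) ≡ sumBy weight (pre ++ p ∷ post) + position p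
  sumBy-weight-raise []        p post = trans (cong (_+ sumBy weight post) (weight-raise p))
    (ℕ-Solver.solve 3 (λ w x t → w :+ x :+ t := w :+ t :+ x) refl (weight p) (position p) (sumBy weight post))
    where open ℕ-Solver using (_:+_; _:=_)
  sumBy-weight-raise (x ∷ pre) p post = trans (cong (weight x +_) (sumBy-weight-raise pre p post)) (sym (+-assoc (weight x) _ _))

  -- The N → ∞ limit of the sum over the orderings of the alphabet, in terms of the positions
  -- reached after removing one letter at a time.
  Ψ : ℕ → ℕ → ℕ → List (ℕ × ℕ) → Series
  Ψ m k zero    v = splitSum v (λ pre p post → q^ (k * position p) · outflow pre p post)
  Ψ m k (suc r) v = splitSum v (λ pre p post → q^ (m * position p) · (outflow pre p post · Ψ m k r (pre ++ raise p ∷ post)))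

  -- A half unrolled state: `s` letters with part m have been removed and are recorded in `weight`,
  -- while `r` more and the letter with part k are still to come. The induction passes one letter at
  -- a time from the closed form `U` to `Ψ`; the case r = 0 is the one applied later.
  compSum-Ψ : ∀ m k ys → NearLabels ys → ∀ s r →
    poch s · compSum ys s (λ v → U v · (q^ (m * sumBy weight v) · Ψ m k r v)) ≈ Ψ m k (s + r) (zeros ys)
  compSum-Ψ m k ys ns zero    r = ≈-trans (·-identityˡ _) (≈-trans (compSum-0 _ ys) (≈-trans (·-cong (U-zeros ys)
    (≈-trans (·-congʳ (≈-trans (≡⇒≈ (cong q^ (trans (cong (m *_) (weight-zeros ys)) (*-zeroʳ m)))) q^-0)) (·-identityˡ _))) (·-identityˡ _)))
    where
    weight-zeros : ∀ ys → sumBy weight (zeros ys) ≡ 0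
    weight-zeros []       = refl
    weight-zeros (y ∷ ys) = trans (cong (_+ sumBy weight (zeros ys)) (cong₂ _+_ (*-zeroʳ y) (*-zeroʳ M))) (weight-zeros ys)
  compSum-Ψ m k ys ns (suc s) r = begin
    poch (suc s) · compSum ys (suc s) (λ v → U v · (q^ (m * sumBy weight v) · Ψ m k r v))
      ≈⟨ compSum-recursion ys ns (λ v → q^ (m * sumBy weight v) · Ψ m k r v) s ⟩
    poch s · compSum ys s (λ v → U v · splitSum v (λ pre p post → outflow pre p post · (q^ (m * sumBy weight (pre ++ raise p ∷ post)) · Ψ m k r (pre ++ raise p ∷ post))))
      ≈⟨ ·-congˡ (compSum-cong′ ys s λ v → ·-congˡ (≈-trans (splitSum-cong v λ { pre p post refl → term pre p post }) (splitSum-· _ _ v))) ⟩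
    poch s · compSum ys s (λ v → U v · (q^ (m * sumBy weight v) · Ψ m k (suc r) v))
      ≈⟨ compSum-Ψ m k ys ns s (suc r) ⟩
    Ψ m k (s + suc r) (zeros ys)
      ≡⟨ cong (λ t → Ψ m k t (zeros ys)) (+-suc s r) ⟩
    Ψ m k (suc s + r) (zeros ys) ∎
    where
    open ≈-Reasoning
    open Solver
    term : ∀ pre p post → outflow pre p post · (q^ (m * sumBy weight (pre ++ raise p ∷ post)) · Ψ m k r (pre ++ raise p ∷ post)) ≈
      q^ (m * sumBy weight (pre ++ p ∷ post)) · (q^ (m * position p) · (outflow pre p post · Ψ m k r (pre ++ raise p ∷ post)))
    term pre p post = ≈-trans (·-congˡ (·-congʳ (≈-trans (≡⇒≈ (cong q^ (trans (cong (m *_) (sumBy-weight-raise pre p post)) (*-distribˡ-+ m _ (position p))))) (q^-+ _ _))))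
      (solve 4 (λ o a b f → o :* ((a :* b) :* f) := a :* (b :* (o :* f))) ≈-refl (outflow pre p post) (q^ (m * sumBy weight (pre ++ p ∷ post))) (q^ (m * position p)) (Ψ m k r (pre ++ raise p ∷ post)))

-- Numerators of the chain sums

pairSum : (A → A → ℕ) → List A → ℕ
pairSum φ []      = 0
pairSum φ (x ∷ v) = foldr (λ b s → φ x b + s) 0 v + pairSum φ v

sgn-+ : ∀ a b → sgn (a + b) ≈ sgn a · sgn b
sgn-+ zero    b = ≈-sym (·-identityˡ _)
sgn-+ (suc a) b = ≈-trans (neg-cong (sgn-+ a b)) (solve 2 (λ x y → :- (x :* y) := :- x :* y) ≈-refl (sgn a) (sgn b))
  where open Solver

module Multiplicative (χ : ℕ → Series) (χ-0 : χ 0 ≈ 𝟙) (χ-+ : ∀ a b → χ (a + b) ≈ χ a · χ b) where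

  ∏-χ : ∀ (φ : A → ℕ) v → ∏ (χ ∘ φ) v ≈ χ (foldr (λ b s → φ b + s) 0 v)
  ∏-χ φ []      = ≈-sym χ-0
  ∏-χ φ (x ∷ v) = ≈-trans (·-congˡ (∏-χ φ v)) (≈-sym (χ-+ _ _))

  ∏₂-χ : ∀ (φ : A → A → ℕ) v → ∏₂ (λ a b → χ (φ a b)) v ≈ χ (pairSum φ v)
  ∏₂-χ φ []      = ≈-sym χ-0
  ∏₂-χ φ (x ∷ v) = ≈-trans (·-cong (∏-χ (φ x) v) (∏₂-χ φ v)) (≈-sym (χ-+ _ _))

module q^-Multiplicative = Multiplicative q^ q^-0 q^-+
module sgn-Multiplicative = Multiplicative sgn ≈-refl sgn-+

∏₂-· : ∀ (f g : A → A → Series) v → ∏₂ (λ a b → f a b · g a b) v ≈ ∏₂ f v · ∏₂ g v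
∏₂-· f g []      = ≈-sym (·-identityˡ 𝟙)
∏₂-· f g (x ∷ v) = ≈-trans (·-cong (∏-· (f x) (g x) v) (∏₂-· f g v))
  (solve 4 (λ a b c d → (a :* b) :* (c :* d) := (a :* c) :* (b :* d)) ≈-refl (∏ (f x) v) (∏ (g x) v) (∏₂ f v) (∏₂ g v))
  where open Solver

private
  sumBy-const-+ : ∀ (h : A → ℕ) a v → foldr (λ b s → a + h b + s) 0 v ≡ length v * a + sumBy h v
  sumBy-const-+ h a []      = refl
  sumBy-const-+ h a (x ∷ v) = trans (cong (a + h x +_) (sumBy-const-+ h a v))
    (solve 4 (λ a x l s → a :+ x :+ (l :+ s) := a :+ l :+ (x :+ s)) refl a (h x) (length v * a) (sumBy h v))
    where open ℕ-Solver

pairSum-+ : ∀ (h : A → ℕ) v → pairSum (λ a b → h a + h b) v + sumBy h v ≡ length v * sumBy h v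
pairSum-+ h []      = refl
pairSum-+ h (x ∷ v) = begin
  foldr (λ b s → h x + h b + s) 0 v + pairSum (λ a b → h a + h b) v + (h x + sumBy h v)
    ≡⟨ cong (λ e → e + pairSum (λ a b → h a + h b) v + (h x + sumBy h v)) (sumBy-const-+ h (h x) v) ⟩
  length v * h x + sumBy h v + pairSum (λ a b → h a + h b) v + (h x + sumBy h v)
    ≡⟨ solve 4 (λ l s p x → l :+ s :+ p :+ (x :+ s) := l :+ s :+ (p :+ s) :+ x) refl (length v * h x) (sumBy h v) (pairSum (λ a b → h a + h b) v) (h x) ⟩
  length v * h x + sumBy h v + (pairSum (λ a b → h a + h b) v + sumBy h v) + h x
    ≡⟨ cong (λ e → length v * h x + sumBy h v + e + h x) (pairSum-+ h v) ⟩
  length v * h x + sumBy h v + length v * sumBy h v + h x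
    ≡⟨ solve 3 (λ l s x → l :* x :+ s :+ l :* s :+ x := (con 1 :+ l) :* (x :+ s)) refl (length v) (sumBy h v) (h x) ⟩
  suc (length v) * (h x + sumBy h v) ∎
  where
  open ≡-Reasoning
  open ℕ-Solver

pairSum-cong : ∀ {φ ψ : A → A → ℕ} v → (∀ a b → φ a b ≡ ψ a b) → pairSum φ v ≡ pairSum ψ v
pairSum-cong []                  e = refl
pairSum-cong {φ = φ} {ψ} (x ∷ v) e = cong₂ _+_ (go v) (pairSum-cong v e)
  where
  go : ∀ v → foldr (λ b s → φ x b + s) 0 v ≡ foldr (λ b s → ψ x b + s) 0 v
  go []      = refl
  go (y ∷ v) = cong₂ _+_ (e x y) (go v)

tri-+ : ∀ a b → tri (a + b) ≡ tri a + tri b + a * b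
tri-+ zero    b = sym (+-identityʳ (tri b))
tri-+ (suc a) b = trans (cong (a + b +_) (tri-+ a b))
  (solve 4 (λ a b s t → a :+ b :+ (s :+ t :+ a :* b) := a :+ s :+ t :+ (b :+ a :* b)) refl a b (tri a) (tri b))
  where open ℕ-Solver

<ᵇ-true : ∀ {y z} → y < z → (y <ᵇ z) ≡ true
<ᵇ-true {y} {z} y<z with y <ᵇ z | <⇒<ᵇ y<z
... | true | _ = refl

<ᵇ-false : ∀ {y z} → z ≤ y → (y <ᵇ z) ≡ false
<ᵇ-false {y} {z} z≤y with y <ᵇ z | <ᵇ⇒< y z
... | false | _ = refl
... | true  | h = contradiction (h _) (≤⇒≯ z≤y)

-- The factors that survive in the limit: N multiplies the pair factor of U by the finite
-- theta products it has as denominators, and turns out to be a signed sum of two monomials.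
module Numerator (M : ℕ) (0<M : 0 < M) where
  open Chain M 0<M

  rising : ℕ → ℕ → Series
  rising ρ zero    = 𝟙
  rising ρ (suc K) = om (ρ + M * K) · rising ρ K

  -- These are c + d + 1 factors against the c + d rungs of `pair`. Once the rungs with negative
  -- exponent are reflected, they exhaust all factors except 1 - q^e, where e is the distance
  -- between the two positions.
  denominator-< : ℕ × ℕ → ℕ × ℕ → Series
  denominator-< (y , c) (z , d) = rising (z ∸ y) (suc d) · rising (M ∸ (z ∸ y)) c

  oriented : ℕ × ℕ → ℕ × ℕ → Series
  oriented a b = if proj₁ a <ᵇ proj₁ b then denominator-< a b else 𝟙

  denominator : ℕ × ℕ → ℕ × ℕ → Series
  denominator a b = oriented a b · oriented b a

  N : ℕ × ℕ → ℕ × ℕ → Series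
  N a b = pair a b · denominator a b

  N-sym : ∀ a b → N a b ≈ N b a
  N-sym a b = ·-cong (pair-sym a b) (·-comm _ _)

  denominator-≈ : ∀ {a b} → proj₁ a < proj₁ b → denominator a b ≈ denominator-< a b
  denominator-≈ {a} {b} y<z = ≈-trans (·-cong
    (≡⇒≈ (cong (if_then denominator-< a b else 𝟙) (<ᵇ-true y<z)))
    (≡⇒≈ (cong (if_then denominator-< b a else 𝟙) (<ᵇ-false (<⇒≤ y<z)))))
    (·-identityʳ _)

  -- Raising either entry adds the position of the other, which is the power of q that an exchange
  -- of the arguments of `J` costs. Summed over all pairs, it depends on the composition only
  -- through `weight`.
  cross : ℕ × ℕ → ℕ × ℕ → ℕ
  cross (y , c) (z , d) = y * d + z * c + M * (c * d)

  exponent : ℕ × ℕ → ℕ × ℕ → ℕ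
  exponent a b = (weight a + weight b) + (M * (proj₂ a + proj₂ b) + (proj₁ a ⊔ proj₁ b))

  monomial : ℕ × ℕ → ℕ × ℕ → Series
  monomial a b = sgn (proj₂ a + proj₂ b) · q^ (exponent a b)

  monomial-sym : ∀ a b → monomial a b ≈ monomial b a
  monomial-sym a b = ≡⇒≈ (cong₂ (λ c e → sgn c · q^ e) (+-comm (proj₂ a) (proj₂ b))
    (cong₂ _+_ (+-comm (weight a) (weight b)) (cong₂ _+_ (cong (M *_) (+-comm (proj₂ a) (proj₂ b))) (⊔-comm (proj₁ a) (proj₁ b)))))

  private
    N-< : ℕ × ℕ → ℕ × ℕ → Series
    N-< a b = pair a b · denominator-< a b

    Below : ℕ → ℕ → Set
    Below y z = y < z × z < y + M

    below-near : ∀ {y z} → Below y z → Near y z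
    below-near (y<z , z<y+M) = <⇒≢ y<z , <-≤-trans y<z (m≤m+n _ M) , z<y+M

    hi-top : ∀ {y z} c d → y < z → (z + M * suc d) + M * c ≡ (y + M * c) + ((z ∸ y) + M * suc d)
    hi-top {y} {z} c d y<z = trans (cong (λ t → (t + M * suc d) + M * c) (sym (m+[n∸m]≡n (<⇒≤ y<z))))
      (solve 4 (λ y ρ u v → ((y :+ ρ) :+ u) :+ v := (y :+ v) :+ (ρ :+ u)) refl y (z ∸ y) (M * suc d) (M * c))
      where open ℕ-Solver

    lo-top : ∀ {y z} c d → y ≤ z → z ∸ y ≤ M → (y + M * suc c) + M * d ≡ (z + M * d) + ((M ∸ (z ∸ y)) + M * c)
    lo-top {y} {z} c d y≤z ρ≤M = begin
      (y + M * suc c) + M * d                  ≡⟨ solve 4 (λ y M c d → (y :+ M :* (con 1 :+ c)) :+ M :* d := y :+ M :+ (M :* c :+ M :* d)) refl y M c d ⟩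
      y + M + (M * c + M * d)                  ≡⟨ cong (λ t → y + t + (M * c + M * d)) (m+[n∸m]≡n ρ≤M) ⟨
      y + (ρ + (M ∸ ρ)) + (M * c + M * d)      ≡⟨ solve 5 (λ y ρ δ u v → y :+ (ρ :+ δ) :+ (u :+ v) := ((y :+ ρ) :+ v) :+ (δ :+ u)) refl y ρ (M ∸ ρ) (M * c) (M * d) ⟩
      ((y + ρ) + M * d) + ((M ∸ ρ) + M * c)    ≡⟨ cong (λ t → (t + M * d) + ((M ∸ ρ) + M * c)) (m+[n∸m]≡n y≤z) ⟩
      (z + M * d) + ((M ∸ ρ) + M * c)          ∎
      where
      open ≡-Reasoning
      open ℕ-Solver
      ρ = z ∸ y

    zero-top : ∀ {y z} → y < z → z + M * 0 ≡ (y + M * 0) + ((z ∸ y) + M * 0)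
    zero-top {y} {z} y<z = trans (cong (_+ M * 0) (sym (m+[n∸m]≡n (<⇒≤ y<z))))
      (solve 3 (λ y ρ M → y :+ ρ :+ M :* con 0 := y :+ M :* con 0 :+ (ρ :+ M :* con 0)) refl y (z ∸ y) M)
      where open ℕ-Solver

    zero-exponent : ∀ {y z} → y < z → cross (y , 0) (z , 0) + position (z , 0) ≡ exponent (y , 0) (z , 0)
    zero-exponent {y} {z} y<z = trans
      (solve 3 (λ y z M → y :* con 0 :+ z :* con 0 :+ M :* con 0 :+ (z :+ M :* con 0) :=
        (y :* con 0 :+ M :* con 0) :+ (z :* con 0 :+ M :* con 0) :+ (M :* con 0 :+ z)) refl y z M)
      (cong (λ m → (y * 0 + M * 0) + (z * 0 + M * 0) + (M * 0 + m)) (sym (m≤n⇒m⊔n≡n (<⇒≤ y<z))))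
      where open ℕ-Solver

    -- The new factor `om e` of the rising product cancels the rung that `pair-raise` adds at the
    -- far end; the other kernel comes out with its arguments exchanged.
    N-raise-hi : ∀ a b → Below (proj₁ a) (proj₁ b) →
      N-< a (raise b) · J (position a) (position (raise b)) ≈ N-< a b · J (position b) (position a)
    N-raise-hi a@(y , c) b@(z , d) (y<z , z<y+M) = begin
      (pair a (raise b) · ((om e · r) · s)) · J x w′
        ≈⟨ solve 5 (λ p o r s j → (p :* ((o :* r) :* s)) :* j := (p :* j) :* (o :* (r :* s))) ≈-refl (pair a (raise b)) (om e) r s (J x w′) ⟩
      (pair a (raise b) · J x w′) · (om e · (r · s))
        ≈⟨ ·-congʳ (≈-trans (·-congʳ (pair-sym a (raise b))) (≈-sym (pair-raise b a))) ⟩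
      ((pair b a · J w x) · J x (w′ + M * c)) · (om e · (r · s))
        ≈⟨ solve 5 (λ p j k o t → ((p :* j) :* k) :* (o :* t) := (p :* t) :* j :* (o :* k)) ≈-refl (pair b a) (J w x) (J x (w′ + M * c)) (om e) (r · s) ⟩
      ((pair b a · (r · s)) · J w x) · (om e · J x (w′ + M * c))
        ≈⟨ ·-cong (·-congʳ (·-congʳ (pair-sym b a))) (om-J {a = x} (≤-trans (m<n⇒0<n∸m y<z) (m≤m+n _ _)) top) ⟩
      (N-< a b · J w x) · 𝟙
        ≈⟨ ·-identityʳ _ ⟩
      N-< a b · J w x ∎
      where
      open ≈-Reasoning
      open Solver
      x = position a
      w = position b
      w′ = position (raise b)
      e = (z ∸ y) + M * suc d
      r = rising (z ∸ y) (suc d)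
      s = rising (M ∸ (z ∸ y)) c
      top = hi-top c d y<z

    N-raise-lo : ∀ a b → Below (proj₁ a) (proj₁ b) →
      N-< (raise a) b · J (position b) (position (raise a)) ≈ N-< a b · J (position a) (position b)
    N-raise-lo a@(y , c) b@(z , d) (y<z , z<y+M) = begin
      (pair (raise a) b · (r · (om e · s))) · J w x′
        ≈⟨ solve 5 (λ p o r s j → (p :* (r :* (o :* s))) :* j := (p :* j) :* (o :* (r :* s))) ≈-refl (pair (raise a) b) (om e) r s (J w x′) ⟩
      (pair (raise a) b · J w x′) · (om e · (r · s))
        ≈⟨ ·-congʳ (pair-raise a b) ⟨
      ((pair a b · J x w) · J w (x′ + M * d)) · (om e · (r · s))
        ≈⟨ solve 5 (λ p j k o t → ((p :* j) :* k) :* (o :* t) := (p :* t) :* j :* (o :* k)) ≈-refl (pair a b) (J x w) (J w (x′ + M * d)) (om e) (r · s) ⟩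
      ((pair a b · (r · s)) · J x w) · (om e · J w (x′ + M * d))
        ≈⟨ ·-congˡ (om-J {a = w} (≤-trans (m<n⇒0<n∸m ρ<M) (m≤m+n _ _)) top) ⟩
      (N-< a b · J x w) · 𝟙
        ≈⟨ ·-identityʳ _ ⟩
      N-< a b · J x w ∎
      where
      open ≈-Reasoning
      open Solver
      x = position a
      x′ = position (raise a)
      w = position b
      ρ = z ∸ y
      e = (M ∸ ρ) + M * c
      r = rising ρ (suc d)
      s = rising (M ∸ ρ) c
      ρ<M : ρ < M
      ρ<M = +-cancelˡ-< y ρ M (subst (_< y + M) (sym (m+[n∸m]≡n (<⇒≤ y<z))) z<y+M)
      top = lo-top c d (<⇒≤ y<z) (<⇒≤ ρ<M)

    turn : ∀ {x w} → x ≢ w → ∀ t n m → q^ t · (n · (q^ w · J x w)) ≈ m → q^ t · (n · (q^ x · J w x)) ≈ neg m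
    turn {x} {w} x≢w t n m h = begin
      q^ t · (n · (q^ x · J w x))           ≈⟨ ·-congˡ (·-congˡ (J-swap (x≢w ∘ sym))) ⟩
      q^ t · (n · neg (q^ w · J x w))       ≈⟨ solve 3 (λ t n j → t :* (n :* :- j) := :- (t :* (n :* j))) ≈-refl (q^ t) n (q^ w · J x w) ⟩
      neg (q^ t · (n · (q^ w · J x w)))     ≈⟨ neg-cong h ⟩
      neg m                                 ∎
      where
      open ≈-Reasoning
      open Solver

    -- The bookkeeping common to both raises: t grows by the position of the entry that stays, e by
    -- the new position x′ of the raised one, and the sign flips. The factor `x` holds a sign left
    -- by `turn`.
    raise-monomial : ∀ {t t′ x x′ w n n′ j j′ c c′ e e′} → t′ ≡ t + w → c′ ≡ suc c → e′ ≡ x′ + e → n′ · j′ ≈ n · j →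
      q^ t · (n · (q^ w · j)) ≈ x · (sgn c · q^ e) →
      q^ t′ · (n′ · (q^ x′ · j′)) ≈ x · neg (sgn c′ · q^ e′)
    raise-monomial {t} {t′} {x} {x′} {w} {n} {n′} {j} {j′} {c} {c′} {e} {e′} refl refl refl nj h = begin
      q^ (t + w) · (n′ · (q^ x′ · j′))        ≈⟨ ·-congʳ (q^-+ t w) ⟩
      (q^ t · q^ w) · (n′ · (q^ x′ · j′))     ≈⟨ solve 5 (λ t w n x j → (t :* w) :* (n :* (x :* j)) := (x :* t :* w) :* (n :* j)) ≈-refl (q^ t) (q^ w) n′ (q^ x′) j′ ⟩
      (q^ x′ · q^ t · q^ w) · (n′ · j′)       ≈⟨ ·-congˡ nj ⟩
      (q^ x′ · q^ t · q^ w) · (n · j)         ≈⟨ solve 5 (λ t w n x j → (x :* t :* w) :* (n :* j) := x :* (t :* (n :* (w :* j)))) ≈-refl (q^ t) (q^ w) n (q^ x′) j ⟩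
      q^ x′ · (q^ t · (n · (q^ w · j)))       ≈⟨ ·-congˡ h ⟩
      q^ x′ · (x · (sgn c · q^ e))            ≈⟨ solve 4 (λ x′ x s e → x′ :* (x :* (s :* e)) := x :* :- (:- s :* (x′ :* e))) ≈-refl (q^ x′) x (sgn c) (q^ e) ⟩
      x · neg (neg (sgn c) · (q^ x′ · q^ e))  ≈⟨ ·-congˡ (neg-cong (·-congˡ (q^-+ x′ e))) ⟨
      x · neg (neg (sgn c) · q^ (x′ + e))     ∎
      where
      open ≈-Reasoning
      open Solver

    exponent-raiseˡ : ∀ a b → exponent (raise a) b ≡ position (raise a) + exponent a b
    exponent-raiseˡ a@(y , c) b@(z , d) = trans (cong (λ e → (e + weight b) + (M * (suc c + d) + (y ⊔ z))) (weight-raise a))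
      (solve 7 (λ wa wb y M c d m → ((wa :+ (y :+ M :* c)) :+ wb) :+ (M :* (con 1 :+ c :+ d) :+ m) :=
                                     (y :+ M :* (con 1 :+ c)) :+ ((wa :+ wb) :+ (M :* (c :+ d) :+ m))) refl (weight a) (weight b) y M c d (y ⊔ z))
      where open ℕ-Solver

    exponent-raiseʳ : ∀ a b → exponent a (raise b) ≡ position (raise b) + exponent a b
    exponent-raiseʳ a@(y , c) b@(z , d) = trans (cong (λ e → (weight a + e) + (M * (c + suc d) + (y ⊔ z))) (weight-raise b))
      (solve 7 (λ wa wb z M c d m → (wa :+ (wb :+ (z :+ M :* d))) :+ (M :* (c :+ (con 1 :+ d)) :+ m) :=
                                     (z :+ M :* (con 1 :+ d)) :+ ((wa :+ wb) :+ (M :* (c :+ d) :+ m))) refl (weight a) (weight b) z M c d (y ⊔ z))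
      where open ℕ-Solver

    cross-raiseˡ : ∀ a b → cross (raise a) b ≡ cross a b + position b
    cross-raiseˡ (y , c) (z , d) = solve 5 (λ y z M c d → y :* d :+ z :* (con 1 :+ c) :+ M :* ((con 1 :+ c) :* d) :=
      y :* d :+ z :* c :+ M :* (c :* d) :+ (z :+ M :* d)) refl y z M c d
      where open ℕ-Solver

    cross-raiseʳ : ∀ a b → cross a (raise b) ≡ cross a b + position a
    cross-raiseʳ (y , c) (z , d) = solve 5 (λ y z M c d → y :* (con 1 :+ d) :+ z :* c :+ M :* (c :* (con 1 :+ d)) :=
      y :* d :+ z :* c :+ M :* (c :* d) :+ (y :+ M :* c)) refl y z M c d
      where open ℕ-Solver

    -- Induction on d for c = 0, then on c. Every raise exchanges the arguments of `J`, and `turn`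
    -- restores them at the price of a sign, whence (-1)^(c+d).
    N-<-lo-hi : ∀ y z → Below y z → ∀ c d →
      q^ (cross (y , c) (z , d)) · (N-< (y , c) (z , d) · (q^ (position (z , d)) · J (position (y , c)) (position (z , d)))) ≈ monomial (y , c) (z , d)
    N-<-lo-hi y z (y<z , _) zero zero = begin
      q^ t · (((𝟙 · 𝟙) · ((om (ρ + M * 0) · 𝟙) · 𝟙)) · (q^ w · J x w))
        ≈⟨ solve 4 (λ t o x j → t :* (((:1 :* :1) :* ((o :* :1) :* :1)) :* (x :* j)) := (t :* x) :* (o :* j)) ≈-refl (q^ t) (om (ρ + M * 0)) (q^ w) (J x w) ⟩
      (q^ t · q^ w) · (om (ρ + M * 0) · J x w)
        ≈⟨ ·-cong (≈-sym (q^-+ t w)) (om-J {a = x} (≤-trans (m<n⇒0<n∸m y<z) (m≤m+n _ _)) top) ⟩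
      q^ (t + w) · 𝟙                        ≈⟨ ·-comm _ _ ⟩
      𝟙 · q^ (t + w)                        ≡⟨ cong (λ e → 𝟙 · q^ e) exponents ⟩
      monomial (y , 0) (z , 0)              ∎
      where
      open ≈-Reasoning
      open Solver
      ρ = z ∸ y
      x = position (y , 0)
      w = position (z , 0)
      t = cross (y , 0) (z , 0)
      top = zero-top y<z
      exponents = zero-exponent y<z
    N-<-lo-hi y z below zero (suc d) = ≈-trans
      (raise-monomial {x = neg 𝟙} {c = d} (cross-raiseʳ (y , 0) (z , d)) refl (exponent-raiseʳ (y , 0) (z , d)) (N-raise-hi (y , 0) (z , d) below)
          (≈-trans (turn (position-≢ {y , 0} {z , d} (below-near below)) (cross (y , 0) (z , d)) _ _ (N-<-lo-hi y z below zero d))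
            (solve 1 (λ m → :- m := :- :1 :* m) ≈-refl (monomial (y , 0) (z , d)))))
      (solve 1 (λ m → :- :1 :* :- m := m) ≈-refl (monomial (y , 0) (z , suc d)))
      where open Solver
    N-<-lo-hi y z below (suc c) d = ≈-trans (turn (position-≢ {y , suc c} {z , d} (below-near below) ∘ sym) (cross (y , suc c) (z , d)) _ _
      (≈-trans (raise-monomial {x = 𝟙} {c = c + d} (cross-raiseˡ (y , c) (z , d)) refl (exponent-raiseˡ (y , c) (z , d)) (N-raise-lo (y , c) (z , d) below)
          (≈-trans (N-<-lo-hi y z below c d) (≈-sym (·-identityˡ _))))
        (·-identityˡ _)))
      (solve 1 (λ m → :- (:- m) := m) ≈-refl (monomial (y , suc c) (z , d)))
      where open Solver

  Ascending Descending : ℕ → ℕ → Set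
  Ascending y z = y < z × z < y + M
  Descending y z = Ascending z y

  N-lo-hi : ∀ a b → Ascending (proj₁ a) (proj₁ b) →
    q^ (cross a b) · (N a b · (q^ (position b) · J (position a) (position b))) ≈ monomial a b
  N-lo-hi a@(y , c) b@(z , d) asc@(y<z , _) = ≈-trans (·-congˡ (·-congʳ (·-congˡ (denominator-≈ {a} {b} y<z)))) (N-<-lo-hi y z asc c d)

  N-hi-lo : ∀ a b → Ascending (proj₁ a) (proj₁ b) →
    q^ (cross a b) · (N a b · (q^ (position a) · J (position b) (position a))) ≈ neg (monomial a b)
  N-hi-lo a b asc = turn (position-≢ {a} {b} (below-near asc)) (cross a b) _ _ (N-lo-hi a b asc)

-- Vandermonde determinants

∏-signed : ∀ {f g : A → Series} pre {post} → All (λ b → f b ≈ neg (g b)) pre → All (λ b → f b ≈ g b) post →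
  ∏ f (pre ++ post) ≈ sgn (length pre) · ∏ g (pre ++ post)
∏-signed []        []       hs = ≈-trans (∏-congAll hs λ _ h → h) (≈-sym (·-identityˡ _))
∏-signed {f = f} {g} (x ∷ pre) {post} (n ∷ ns) hs = ≈-trans (·-cong n (∏-signed pre ns hs))
  (solve 3 (λ a s p → :- a :* (s :* p) := :- s :* (a :* p)) ≈-refl (g x) (sgn (length pre)) (∏ g (pre ++ post)))
  where open Solver

∏-q^-· : ∀ (φ : A → ℕ) (h : A → Series) v → ∏ (λ b → q^ (φ b) · h b) v ≈ q^ (sumBy φ v) · ∏ h v
∏-q^-· φ h v = ≈-trans (∏-· (q^ ∘ φ) h v) (·-congʳ (q^-Multiplicative.∏-χ φ v))

sumBy-middle : ∀ (φ : A → ℕ) pre p post → sumBy φ (pre ++ p ∷ post) ≡ φ p + sumBy φ (pre ++ post)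
sumBy-middle φ []        p post = refl
sumBy-middle φ (x ∷ pre) p post = trans (cong (φ x +_) (sumBy-middle φ pre p post))
  (solve 3 (λ a b c → a :+ (b :+ c) := b :+ (a :+ c)) refl (φ x) (φ p) (sumBy φ (pre ++ post)))
  where open ℕ-Solver

sumBy-const : ∀ e (v : List A) → sumBy (λ _ → e) v ≡ length v * e
sumBy-const e []      = refl
sumBy-const e (x ∷ v) = cong (e +_) (sumBy-const e v)

splitSum-·· : ∀ f g (H : List A → A → List A → Series) v →
  f · (g · splitSum v H) ≈ splitSum v (λ pre p post → f · (g · H pre p post))
splitSum-·· f g H v = ≈-sym (≈-trans (splitSum-· f _ v) (·-congˡ (splitSum-· g H v)))

-- The exponents of the alternant attached to the monomial x^ls.
staircase : List ℕ → List ℕ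
staircase []       = []
staircase (l ∷ ls) = (l + length ls) ∷ staircase ls

interval : ℕ → ℕ → List ℕ
interval l zero    = []
interval l (suc s) = l ∷ interval (suc l) s

module Vandermonde (M : ℕ) (0<M : 0 < M) where
  open Chain M 0<M
  open Numerator M 0<M

  -- The sum over all orderings w of v of ∏ q^{ls_i P(w_i)} ∏_{i<j} K(P(w_i), P(w_j)).
  ordered : (ℕ → ℕ → Series) → List ℕ → List (ℕ × ℕ) → Series
  ordered K []       v = 𝟙
  ordered K (l ∷ ls) v = splitSum v (λ pre p post → q^ (l * position p) ·
    (∏ (λ b → K (position p) (position b)) (pre ++ post) · ordered K ls (pre ++ post)))

  -- For `J` this is the Schur polynomial of the empty partition. At each step the kernel products
  -- add up to 1 by `splitSum-∏-complement`.
  ordered-zeros : ∀ (K : ℕ → ℕ → Series) → (∀ {x y z} → x ≢ z → y ≢ z → x ≢ y → K x z · K y z ≈ K y x · K x z ⊞ K x y · K y z) →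
    (∀ {x y} → x ≢ y → K x y ⊞ K y x ≈ 𝟙) → ∀ s v → length v ≡ s → AllPairs (λ a b → position a ≢ position b) v →
    ordered K (replicate s 0) v ≈ 𝟙
  ordered-zeros K three two zero    v _   ds = ≈-refl
  ordered-zeros K three two (suc s) v len ds = ≈-trans
    (splitSum-cong v λ pre p post eq → ≈-trans (·-cong q^-0 (·-congˡ
      (ordered-zeros K three two s (pre ++ post) (suc-injective (trans (sym (rest-length pre eq)) len)) (rest-AllPairs pre ds eq))))
      (≈-trans (·-identityˡ _) (·-identityʳ _)))
    (splitSum-∏-complement K three two position v (subst (0 <_) (sym len) (s≤s z≤n)) ds)

  crossN : ℕ × ℕ → ℕ × ℕ → Series
  crossN a b = q^ (cross a b) · N a b

  cross-sym : ∀ a b → cross a b ≡ cross b a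
  cross-sym (y , c) (z , d) = solve 5 (λ y c z d M → y :* d :+ z :* c :+ M :* (c :* d) := z :* c :+ y :* d :+ M :* (d :* c)) refl y c z d M
    where open ℕ-Solver

  crossN-sym : ∀ a b → crossN a b ≈ crossN b a
  crossN-sym a b = ·-cong (≡⇒≈ (cong q^ (cross-sym a b))) (N-sym a b)

  power : ℕ → ℕ × ℕ → Series
  power b p = q^ (b * position p)

  private
    AscendingPairs DescendingPairs : List (ℕ × ℕ) → Set
    AscendingPairs  = AllPairs (λ a b → Ascending (proj₁ a) (proj₁ b))
    DescendingPairs = AllPairs (λ a b → Descending (proj₁ a) (proj₁ b))

    cross-regroup : ∀ t x n j → x · ((t · n) · j) ≈ t · (n · (x · j))
    cross-regroup = solve 4 (λ t x n j → x :* ((t :* n) :* j) := t :* (n :* (x :* j))) ≈-refl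
      where open Solver

    -- The entries before `p` have smaller labels, so each contributes the sign of `N-hi-lo`.
    -- Together these signs are the sign of the cofactor in a Laplace expansion.
    outflow-ascending : ∀ {v} pre {p post} → AscendingPairs v → pre ++ p ∷ post ≡ v →
      q^ (sumBy position (pre ++ post)) · (∏ (crossN p) (pre ++ post) · ∏ (λ b → J (position p) (position b)) (pre ++ post)) ≈
      sgn (length pre) · ∏ (monomial p) (pre ++ post)
    outflow-ascending pre {p} {post} asc eq with split-AllPairs pre asc eq
    ... | l , r = begin
      q^ (sumBy position R) · (∏ (crossN p) R · ∏ (λ b → J (position p) (position b)) R)   ≈⟨ ·-congˡ (∏-· _ _ R) ⟨
      q^ (sumBy position R) · ∏ (λ b → crossN p b · J (position p) (position b)) R         ≈⟨ ∏-q^-· position _ R ⟨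
      ∏ (λ b → q^ (position b) · (crossN p b · J (position p) (position b))) R
        ≈⟨ ∏-signed pre (All.map (λ {b} h → ≈-trans (cross-regroup (q^ (cross p b)) _ _ _) (≈-trans (·-cong (≡⇒≈ (cong q^ (cross-sym p b))) (·-congʳ (N-sym p b)))
               (≈-trans (N-hi-lo b p h) (neg-cong (monomial-sym b p))))) l)
             (All.map (λ {b} h → ≈-trans (cross-regroup (q^ (cross p b)) _ _ _) (N-lo-hi p b h)) r) ⟩
      sgn (length pre) · ∏ (monomial p) R ∎
      where
      open ≈-Reasoning
      R = pre ++ post

    outflow-descending : ∀ {v} pre {p post} → DescendingPairs v → pre ++ p ∷ post ≡ v →
      q^ (length (pre ++ post) * position p) · (∏ (crossN p) (pre ++ post) · ∏ (λ b → J (position b) (position p)) (pre ++ post)) ≈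
      sgn (length pre) · ∏ (monomial p) (pre ++ post)
    outflow-descending pre {p} {post} desc eq with split-AllPairs pre desc eq
    ... | l , r = begin
      q^ (length R * position p) · (∏ (crossN p) R · ∏ (λ b → J (position b) (position p)) R)
        ≈⟨ ·-cong (≡⇒≈ (cong q^ (sym (sumBy-const (position p) R)))) (≈-sym (∏-· _ _ R)) ⟩
      q^ (sumBy (λ _ → position p) R) · ∏ (λ b → crossN p b · J (position b) (position p)) R         ≈⟨ ∏-q^-· (λ _ → position p) _ R ⟨
      ∏ (λ b → q^ (position p) · (crossN p b · J (position b) (position p))) R
        ≈⟨ ∏-signed pre (All.map (λ {b} h → ≈-trans (cross-regroup (q^ (cross p b)) _ _ _) (N-hi-lo p b h)) l)
             (All.map (λ {b} h → ≈-trans (cross-regroup (q^ (cross p b)) _ _ _) (≈-trans (·-cong (≡⇒≈ (cong q^ (cross-sym p b))) (·-congʳ (N-sym p b)))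
               (≈-trans (N-lo-hi b p h) (monomial-sym b p)))) r) ⟩
      sgn (length pre) · ∏ (monomial p) R ∎
      where
      open ≈-Reasoning
      R = pre ++ post

    q^-split₂ : ∀ {e} a b → e ≡ a + b → q^ e ≈ q^ a · q^ b
    q^-split₂ a b refl = q^-+ a b

    q^-split₄ : ∀ {e} a b c d → e ≡ a + (b + (c + d)) → q^ e ≈ q^ a · (q^ b · (q^ c · q^ d))
    q^-split₄ a b c d refl = ≈-trans (q^-+ a _) (·-congˡ (≈-trans (q^-+ b _) (·-congˡ (q^-+ c d))))

  -- The bialternant formula: for a partition ls, `ordered J ls` is its Schur polynomial in the
  -- powers q^position, and its Vandermonde denominator cancels against the binomials in `N`.
  -- Singling out the first letter of the ordering is the expansion along the first row. The factor
  -- q^(Σ position) stands on both sides so that no exponent involves a subtraction.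
  ordered-ascending : ∀ ls v → length v ≡ length ls → AscendingPairs v →
    q^ (length v * sumBy position v) · (∏₂ crossN v · ordered J ls v) ≈
    q^ (sumBy position v) · (∏₂ monomial v · det power (staircase ls) v)
  ordered-ascending []       []      _   _   = ≈-refl
  ordered-ascending (l ∷ ls) v       len asc = begin
    q^ (length v * sumBy position v) · (∏₂ crossN v · splitSum v _)
      ≈⟨ splitSum-·· _ _ _ v ⟩
    splitSum v (λ pre p post → q^ (length v * sumBy position v) · (∏₂ crossN v · (q^ (l * position p) · (∏ (λ b → J (position p) (position b)) (pre ++ post) · ordered J ls (pre ++ post)))))
      ≈⟨ splitSum-cong v (λ { pre p post refl → term pre p post len asc }) ⟩
    splitSum v (λ pre p post → q^ (sumBy position v) · (∏₂ monomial v · (sgn (length pre) · (power (l + length ls) p · det power (staircase ls) (pre ++ post)))))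
      ≈⟨ splitSum-·· _ _ _ v ⟨
    q^ (sumBy position v) · (∏₂ monomial v · splitSum v _) ∎
    where
    open ≈-Reasoning
    term : ∀ pre p post → length (pre ++ p ∷ post) ≡ suc (length ls) → AscendingPairs (pre ++ p ∷ post) → _ ≈ _
    term pre p post len asc = begin
      q^ (length v′ * sumBy position v′) · (∏₂ crossN v′ · (q^ (l * P) · (j · O)))
        ≈⟨ ·-cong (q^-split₄ (s * P) P ΣR (length R * ΣR) exponents) (·-congʳ (∏₂-middle crossN-sym pre p post)) ⟩
      (q^ (s * P) · (q^ P · (q^ ΣR · q^ (length R * ΣR)))) · ((∏ (crossN p) R · ∏₂ crossN R) · (q^ (l * P) · (j · O)))
        ≈⟨ Solver.solve 9 (λ a b c d n N x j o → let open Solver in (a :* (b :* (c :* d))) :* ((n :* N) :* (x :* (j :* o))) := ((x :* a) :* b) :* ((c :* (n :* j)) :* (d :* (N :* o)))) ≈-refl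
             (q^ (s * P)) (q^ P) (q^ ΣR) (q^ (length R * ΣR)) (∏ (crossN p) R) (∏₂ crossN R) (q^ (l * P)) j O ⟩
      ((q^ (l * P) · q^ (s * P)) · q^ P) · ((q^ ΣR · (∏ (crossN p) R · j)) · (q^ (length R * ΣR) · (∏₂ crossN R · O)))
        ≈⟨ ·-cong (·-congʳ (q^-split₂ (l * P) (s * P) (*-distribʳ-+ P l s)))
             (≈-sym (·-cong (outflow-ascending pre asc refl) (ordered-ascending ls R len″ (rest-AllPairs pre asc refl)))) ⟨
      (q^ ((l + s) * P) · q^ P) · ((sgn (length pre) · ∏ (monomial p) R) · (q^ ΣR · (∏₂ monomial R · D)))
        ≈⟨ Solver.solve 7 (λ a b s m c N d → let open Solver in (a :* b) :* ((s :* m) :* (c :* (N :* d))) := (b :* c) :* ((m :* N) :* (s :* (a :* d)))) ≈-refl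
             (q^ ((l + s) * P)) (q^ P) (sgn (length pre)) (∏ (monomial p) R) (q^ ΣR) (∏₂ monomial R) D ⟩
      (q^ P · q^ ΣR) · ((∏ (monomial p) R · ∏₂ monomial R) · (sgn (length pre) · (q^ ((l + s) * P) · D)))
        ≈⟨ ·-cong (q^-split₂ P ΣR (sumBy-middle position pre p post)) (·-congʳ (∏₂-middle monomial-sym pre p post)) ⟨
      q^ (sumBy position v′) · (∏₂ monomial v′ · (sgn (length pre) · (q^ ((l + s) * P) · D))) ∎
      where
      v′ = pre ++ p ∷ post
      R = pre ++ post
      P = position p
      ΣR = sumBy position R
      s = length ls
      j = ∏ (λ b → J (position p) (position b)) R
      O = ordered J ls R
      D = det power (staircase ls) R
      len″ : length R ≡ s
      len″ = suc-injective (trans (sym (rest-length pre refl)) len)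
      exponents : length v′ * sumBy position v′ ≡ s * P + (P + (ΣR + length R * ΣR))
      exponents = trans (cong₂ _*_ len (sumBy-middle position pre p post)) (trans
        (ℕ-Solver.solve 3 (λ s P Σ → (con 1 :+ s) :* (P :+ Σ) := s :* P :+ (P :+ (Σ :+ s :* Σ))) refl s P ΣR)
        (cong (λ t → s * P + (P + (ΣR + t * ΣR))) (sym len″)))
        where open ℕ-Solver using (con; _:+_; _:*_; _:=_)

  -- The counterpart for decreasing labels. The reversed kernel makes the rows appear in increasing
  -- order, as the transposed determinant has them, so no sign of a reordering is needed. The start
  -- `l` is general because the minors lose the first row.
  ordered-descending : ∀ l s v → length v ≡ s → DescendingPairs v →
    q^ ((l + s) * sumBy position v) · (∏₂ crossN v · ordered (flip J) (replicate s 0) v) ≈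
    q^ (sumBy position v) · (∏₂ monomial v · det power (interval l s) v)
  ordered-descending l zero    []      _   _    = ·-congʳ (≡⇒≈ (cong q^ (*-zeroʳ (l + 0))))
  ordered-descending l (suc s) v       len desc = begin
    q^ ((l + suc s) * sumBy position v) · (∏₂ crossN v · splitSum v _)
      ≈⟨ splitSum-·· _ _ _ v ⟩
    splitSum v (λ pre p post → q^ ((l + suc s) * sumBy position v) · (∏₂ crossN v · (q^ 0 · (∏ (λ b → J (position b) (position p)) (pre ++ post) · ordered (flip J) (replicate s 0) (pre ++ post)))))
      ≈⟨ splitSum-cong v (λ { pre p post refl → term pre p post len desc }) ⟩
    splitSum v (λ pre p post → q^ (sumBy position v) · (∏₂ monomial v · (sgn (length pre) · (power l p · det power (interval (suc l) s) (pre ++ post)))))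
      ≈⟨ splitSum-·· _ _ _ v ⟨
    q^ (sumBy position v) · (∏₂ monomial v · splitSum v _) ∎
    where
    open ≈-Reasoning
    term : ∀ pre p post → length (pre ++ p ∷ post) ≡ suc s → DescendingPairs (pre ++ p ∷ post) → _ ≈ _
    term pre p post len desc = begin
      q^ ((l + suc s) * sumBy position v′) · (∏₂ crossN v′ · (q^ 0 · (j · O)))
        ≈⟨ ·-cong (q^-split₄ (l * P) P (length R * P) ((suc l + s) * ΣR) exponents) (·-cong (∏₂-middle crossN-sym pre p post) (≈-trans (·-congʳ q^-0) (·-identityˡ _))) ⟩
      (q^ (l * P) · (q^ P · (q^ (length R * P) · q^ ((suc l + s) * ΣR)))) · ((∏ (crossN p) R · ∏₂ crossN R) · (j · O))
        ≈⟨ Solver.solve 8 (λ a b c d n N j o → let open Solver in (a :* (b :* (c :* d))) :* ((n :* N) :* (j :* o)) := (a :* b) :* ((c :* (n :* j)) :* (d :* (N :* o)))) ≈-refl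
             (q^ (l * P)) (q^ P) (q^ (length R * P)) (q^ ((suc l + s) * ΣR)) (∏ (crossN p) R) (∏₂ crossN R) j O ⟩
      (q^ (l * P) · q^ P) · ((q^ (length R * P) · (∏ (crossN p) R · j)) · (q^ ((suc l + s) * ΣR) · (∏₂ crossN R · O)))
        ≈⟨ ·-congˡ (·-cong (outflow-descending pre desc refl) (ordered-descending (suc l) s R len″ (rest-AllPairs pre desc refl))) ⟩
      (q^ (l * P) · q^ P) · ((sgn (length pre) · ∏ (monomial p) R) · (q^ ΣR · (∏₂ monomial R · D)))
        ≈⟨ Solver.solve 7 (λ a b s m c N d → let open Solver in (a :* b) :* ((s :* m) :* (c :* (N :* d))) := (b :* c) :* ((m :* N) :* (s :* (a :* d)))) ≈-refl
             (q^ (l * P)) (q^ P) (sgn (length pre)) (∏ (monomial p) R) (q^ ΣR) (∏₂ monomial R) D ⟩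
      (q^ P · q^ ΣR) · ((∏ (monomial p) R · ∏₂ monomial R) · (sgn (length pre) · (q^ (l * P) · D)))
        ≈⟨ ·-cong (q^-split₂ P ΣR (sumBy-middle position pre p post)) (·-congʳ (∏₂-middle monomial-sym pre p post)) ⟨
      q^ (sumBy position v′) · (∏₂ monomial v′ · (sgn (length pre) · (q^ (l * P) · D))) ∎
      where
      v′ = pre ++ p ∷ post
      R = pre ++ post
      P = position p
      ΣR = sumBy position R
      j = ∏ (λ b → J (position b) (position p)) R
      O = ordered (flip J) (replicate s 0) R
      D = det power (interval (suc l) s) R
      len″ : length R ≡ s
      len″ = suc-injective (trans (sym (rest-length pre refl)) len)
      exponents : (l + suc s) * sumBy position v′ ≡ l * P + (P + (length R * P + (suc l + s) * ΣR))
      exponents = trans (cong ((l + suc s) *_) (sumBy-middle position pre p post)) (trans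
        (ℕ-Solver.solve 4 (λ l s P Σ → (l :+ (con 1 :+ s)) :* (P :+ Σ) := l :* P :+ (P :+ (s :* P :+ (con 1 :+ l :+ s) :* Σ))) refl l s P ΣR)
        (cong (λ t → l * P + (P + (t * P + (suc l + s) * ΣR))) (sym len″)))
        where open ℕ-Solver using (con; _:+_; _:*_; _:=_)

  -- The right side depends on the labels and the total alone. Up to the weight, the cross terms can
  -- therefore be taken out of the sum over compositions.
  pairSum-cross : ∀ v → pairSum cross v + sumBy weight v ≡ sumBy proj₁ v * total v + M * tri (total v)
  pairSum-cross []            = sym (*-zeroʳ M)
  pairSum-cross ((y , c) ∷ v) = begin
    sumBy (cross (y , c)) v + pairSum cross v + (weight (y , c) + sumBy weight v)
      ≡⟨ cong (λ e → e + pairSum cross v + (weight (y , c) + sumBy weight v)) (row v) ⟩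
    y * total v + sumBy proj₁ v * c + M * (c * total v) + pairSum cross v + (weight (y , c) + sumBy weight v)
      ≡⟨ solve 4 (λ a p w s → a :+ p :+ (w :+ s) := a :+ w :+ (p :+ s)) refl (y * total v + sumBy proj₁ v * c + M * (c * total v)) (pairSum cross v) (weight (y , c)) (sumBy weight v) ⟩
    y * total v + sumBy proj₁ v * c + M * (c * total v) + weight (y , c) + (pairSum cross v + sumBy weight v)
      ≡⟨ cong (y * total v + sumBy proj₁ v * c + M * (c * total v) + weight (y , c) +_) (pairSum-cross v) ⟩
    y * total v + sumBy proj₁ v * c + M * (c * total v) + (y * c + M * tri c) + (sumBy proj₁ v * total v + M * tri (total v))
      ≡⟨ solve 7 (λ y t Y c M a b → y :* t :+ Y :* c :+ M :* (c :* t) :+ (y :* c :+ M :* a) :+ (Y :* t :+ M :* b) := (y :+ Y) :* (c :+ t) :+ M :* (a :+ b :+ c :* t))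
           refl y (total v) (sumBy proj₁ v) c M (tri c) (tri (total v)) ⟩
    (y + sumBy proj₁ v) * (c + total v) + M * (tri c + tri (total v) + c * total v)
      ≡⟨ cong (λ e → (y + sumBy proj₁ v) * (c + total v) + M * e) (tri-+ c (total v)) ⟨
    (y + sumBy proj₁ v) * (c + total v) + M * tri (c + total v) ∎
    where
    open ≡-Reasoning
    open ℕ-Solver
    row : ∀ v → sumBy (cross (y , c)) v ≡ y * total v + sumBy proj₁ v * c + M * (c * total v)
    row []            = solve 3 (λ y M c → con 0 := y :* con 0 :+ con 0 :+ M :* (c :* con 0)) refl y M c
    row ((z , d) ∷ v) = trans (cong (cross (y , c) (z , d) +_) (row v))
      (solve 7 (λ y c z d t Y M → y :* d :+ z :* c :+ M :* (c :* d) :+ (y :* t :+ Y :* c :+ M :* (c :* t)) := y :* (d :+ t) :+ (z :+ Y) :* c :+ M :* (c :* (d :+ t)))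
        refl y c z d (total v) (sumBy proj₁ v) M)

  sumBy-position : ∀ v → sumBy position v ≡ sumBy proj₁ v + M * total v
  sumBy-position []            = sym (*-zeroʳ M)
  sumBy-position ((y , c) ∷ v) = trans (cong (y + M * c +_) (sumBy-position v))
    (solve 5 (λ y M c Y t → y :+ M :* c :+ (Y :+ M :* t) := y :+ Y :+ M :* (c :+ t)) refl y M c (sumBy proj₁ v) (total v))
    where open ℕ-Solver

  private
    total-sumBy : ∀ (v : List (ℕ × ℕ)) → sumBy proj₂ v ≡ total v
    total-sumBy []            = refl
    total-sumBy ((y , c) ∷ v) = cong (c +_) (total-sumBy v)

    maxSum : List (ℕ × ℕ) → ℕ
    maxSum = pairSum (λ a b → proj₁ a ⊔ proj₁ b)

    pairSum-⊕ : ∀ (φ ψ : ℕ × ℕ → ℕ × ℕ → ℕ) v → pairSum (λ a b → φ a b + ψ a b) v ≡ pairSum φ v + pairSum ψ v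
    pairSum-⊕ φ ψ []      = refl
    pairSum-⊕ φ ψ (x ∷ v) = trans (cong₂ _+_ (row v) (pairSum-⊕ φ ψ v))
      (solve 4 (λ a b c d → a :+ b :+ (c :+ d) := a :+ c :+ (b :+ d)) refl (sumBy (φ x) v) (sumBy (ψ x) v) (pairSum φ v) (pairSum ψ v))
      where
      open ℕ-Solver
      row : ∀ v → sumBy (λ b → φ x b + ψ x b) v ≡ sumBy (φ x) v + sumBy (ψ x) v
      row []      = refl
      row (y ∷ v) = trans (cong (φ x y + ψ x y +_) (row v))
        (solve 4 (λ a b c d → a :+ b :+ (c :+ d) := a :+ c :+ (b :+ d)) refl (φ x y) (ψ x y) (sumBy (φ x) v) (sumBy (ψ x) v))

    pairSum-* : ∀ (φ : ℕ × ℕ → ℕ × ℕ → ℕ) v → pairSum (λ a b → M * φ a b) v ≡ M * pairSum φ v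
    pairSum-* φ []      = sym (*-zeroʳ M)
    pairSum-* φ (x ∷ v) = trans (cong₂ _+_ (row v) (pairSum-* φ v)) (sym (*-distribˡ-+ M (sumBy (φ x) v) (pairSum φ v)))
      where
      row : ∀ v → sumBy (λ b → M * φ x b) v ≡ M * sumBy (φ x) v
      row []      = sym (*-zeroʳ M)
      row (y ∷ v) = trans (cong (M * φ x y +_) (row v)) (sym (*-distribˡ-+ M (φ x y) (sumBy (φ x) v)))

  pairTotal : List (ℕ × ℕ) → ℕ
  pairTotal v = pairSum (λ a b → proj₂ a + proj₂ b) v

  pairTotal-≡ : ∀ v → pairTotal v ≡ length v * total v ∸ total v
  pairTotal-≡ v = trans (sym (m+n∸n≡m (pairTotal v) (total v)))
    (cong (_∸ total v) (trans (cong (pairTotal v +_) (sym (total-sumBy v))) (trans (pairSum-+ proj₂ v) (cong (length v *_) (total-sumBy v)))))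

  private
    pairSum-exponent : ∀ v → pairSum exponent v + sumBy weight v ≡ length v * sumBy weight v + (M * pairTotal v + maxSum v)
    pairSum-exponent v = begin
      pairSum exponent v + W
        ≡⟨ cong (_+ W) (trans (pairSum-⊕ _ _ v) (cong (pairSum (λ a b → weight a + weight b) v +_) (trans (pairSum-⊕ _ _ v) (cong (_+ maxSum v) (pairSum-* (λ a b → proj₂ a + proj₂ b) v))))) ⟩
      pairSum (λ a b → weight a + weight b) v + (M * pairTotal v + maxSum v) + W
        ≡⟨ solve 3 (λ a b c → a :+ b :+ c := a :+ c :+ b) refl (pairSum (λ a b → weight a + weight b) v) (M * pairTotal v + maxSum v) W ⟩
      pairSum (λ a b → weight a + weight b) v + W + (M * pairTotal v + maxSum v)
        ≡⟨ cong (_+ (M * pairTotal v + maxSum v)) (pairSum-+ weight v) ⟩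
      length v * W + (M * pairTotal v + maxSum v) ∎
      where
      open ≡-Reasoning
      open ℕ-Solver
      W = sumBy weight v

  maxSum-labels : List ℕ → ℕ
  maxSum-labels = pairSum _⊔_

  private
    maxSum-≡ : ∀ v → maxSum v ≡ maxSum-labels (map proj₁ v)
    maxSum-≡ []      = refl
    maxSum-≡ (x ∷ v) = cong₂ _+_ (row v) (maxSum-≡ v)
      where
      row : ∀ v → sumBy (λ b → proj₁ x ⊔ proj₁ b) v ≡ sumBy (proj₁ x ⊔_) (map proj₁ v)
      row []      = refl
      row (y ∷ v) = cong (proj₁ x ⊔ proj₁ y +_) (row v)

    sumBy-labels : ∀ v → sumBy proj₁ v ≡ sumℕ (map {A = ℕ × ℕ} proj₁ v)
    sumBy-labels []      = refl
    sumBy-labels (x ∷ v) = cong (proj₁ x +_) (sumBy-labels v)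

  -- The powers of q shared by all compositions of r over `ys`: the first multiplies the side of
  -- `N`, the second the side of the determinant.
  lowExponent highExponent : List ℕ → ℕ → ℕ
  lowExponent ys r = length ys * (sumℕ ys + M * r) + (sumℕ ys * r + M * tri r)
  highExponent ys r = (sumℕ ys + M * r) + (M * (length ys * r ∸ r) + maxSum-labels ys)

  normalize : ∀ {ys r f} rows v → map proj₁ v ≡ ys → total v ≡ r →
    q^ (length v * sumBy position v) · (∏₂ crossN v · f) ≈ q^ (sumBy position v) · (∏₂ monomial v · det power rows v) →
    q^ (lowExponent ys r) · (∏₂ N v · f) ≈ (sgn (length ys * r ∸ r) · q^ (highExponent ys r)) · (q^ (length ys * sumBy weight v) · det power rows v)
  normalize {f = f} rows v refl refl h = begin
    q^ (lowExponent ys r) · (∏₂ N v · f)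
      ≈⟨ ·-congʳ (≈-trans (≡⇒≈ (cong q^ low)) (≈-trans (q^-+ _ _) (·-congˡ (q^-+ _ _)))) ⟩
    (q^ (length v * S) · (q^ (pairSum cross v) · q^ W)) · (∏₂ N v · f)
      ≈⟨ solve 5 (λ a b c n f → (a :* (b :* c)) :* (n :* f) := c :* (a :* ((b :* n) :* f))) ≈-refl (q^ (length v * S)) (q^ (pairSum cross v)) (q^ W) (∏₂ N v) f ⟩
    q^ W · (q^ (length v * S) · ((q^ (pairSum cross v) · ∏₂ N v) · f))
      ≈⟨ ·-congˡ (·-congˡ (·-congʳ (≈-trans (∏₂-· (λ a b → q^ (cross a b)) N v) (·-congʳ (q^-Multiplicative.∏₂-χ cross v))))) ⟨
    q^ W · (q^ (length v * S) · (∏₂ crossN v · f))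
      ≈⟨ ·-congˡ h ⟩
    q^ W · (q^ S · (∏₂ monomial v · D))
      ≈⟨ ·-congˡ (·-congˡ (·-congʳ (≈-trans (∏₂-· (λ a b → sgn (proj₂ a + proj₂ b)) (λ a b → q^ (exponent a b)) v)
           (·-cong (sgn-Multiplicative.∏₂-χ _ v) (q^-Multiplicative.∏₂-χ exponent v))))) ⟩
    q^ W · (q^ S · ((sgn (pairTotal v) · q^ (pairSum exponent v)) · D))
      ≈⟨ solve 5 (λ w p s e d → w :* (p :* ((s :* e) :* d)) := (s :* (p :* (e :* w))) :* d) ≈-refl (q^ W) (q^ S) (sgn (pairTotal v)) (q^ (pairSum exponent v)) D ⟩
    (sgn (pairTotal v) · (q^ S · (q^ (pairSum exponent v) · q^ W))) · D
      ≈⟨ ·-congʳ (·-cong (≡⇒≈ (cong sgn pt)) (≈-trans (≈-trans (·-congˡ (≈-sym (q^-+ _ _))) (≈-sym (q^-+ _ _))) (≈-trans (≡⇒≈ (cong q^ high)) (q^-+ _ _)))) ⟩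
    (sgn (length ys * r ∸ r) · (q^ (highExponent ys r) · q^ (length ys * W))) · D
      ≈⟨ solve 4 (λ s h w d → (s :* (h :* w)) :* d := (s :* h) :* (w :* d)) ≈-refl (sgn (length ys * r ∸ r)) (q^ (highExponent ys r)) (q^ (length ys * W)) D ⟩
    (sgn (length ys * r ∸ r) · q^ (highExponent ys r)) · (q^ (length ys * W) · D) ∎
    where
    open ≈-Reasoning
    open Solver
    ys = map proj₁ v
    r = total v
    S = sumBy position v
    W = sumBy weight v
    D = det power rows v
    len : length ys ≡ length v
    len = length-map proj₁ v
    S≡ : S ≡ sumℕ ys + M * r
    S≡ = trans (sumBy-position v) (cong (_+ M * r) (sumBy-labels v))
    low : lowExponent ys r ≡ length v * S + (pairSum cross v + W)
    low = cong₂ _+_ (cong₂ _*_ len (sym S≡)) (sym (trans (pairSum-cross v) (cong (λ Y → Y * r + M * tri r) (sumBy-labels v))))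
    pt : pairTotal v ≡ length ys * r ∸ r
    pt = trans (pairTotal-≡ v) (cong (λ l → l * r ∸ r) (sym len))
    high : S + (pairSum exponent v + W) ≡ highExponent ys r + length ys * W
    high = trans (cong₂ _+_ S≡ (trans (pairSum-exponent v) (cong₂ _+_ (cong (_* W) (sym len)) (cong₂ _+_ (cong (M *_) pt) (maxSum-≡ v)))))
      (ℕ-Solver.solve 3 (λ a b c → a ℕ-Solver.:+ (b ℕ-Solver.:+ c) ℕ-Solver.:= (a ℕ-Solver.:+ c) ℕ-Solver.:+ b) refl (sumℕ ys + M * r) (length ys * W) (M * (length ys * r ∸ r) + maxSum-labels ys))

-- Level–rank exchange by transposition

double-tri : ∀ s → tri s + tri s + s ≡ s * s
double-tri zero    = refl
double-tri (suc s) = trans (solve 2 (λ s t → (s :+ t) :+ (s :+ t) :+ (con 1 :+ s) := con 1 :+ s :+ s :+ (t :+ t :+ s)) refl s (tri s))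
  (trans (cong (1 + s + s +_) (double-tri s)) (solve 1 (λ s → con 1 :+ s :+ s :+ s :* s := (con 1 :+ s) :* (con 1 :+ s)) refl s))
  where open ℕ-Solver

interval-bounds : ∀ l s → All (λ b → l ≤ b × b < l + s) (interval l s)
interval-bounds l zero    = []
interval-bounds l (suc s) = (≤-refl , m<m+n l (s≤s z≤n)) ∷
  All.map (λ {b} (l<b , b<) → <⇒≤ l<b , subst (b <_) (sym (+-suc l s)) b<) (interval-bounds (suc l) s)

length-interval : ∀ l s → length (interval l s) ≡ s
length-interval l zero    = refl
length-interval l (suc s) = cong suc (length-interval (suc l) s)

sumℕ-interval : ∀ l s → sumℕ (interval l s) ≡ s * l + tri s
sumℕ-interval l zero    = refl
sumℕ-interval l (suc s) = trans (cong (l +_) (sumℕ-interval (suc l) s))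
  (solve 3 (λ l s t → l :+ (s :* (con 1 :+ l) :+ t) := (l :+ s :* l) :+ (s :+ t)) refl l s (tri s))
  where open ℕ-Solver

descent : ℕ → List ℕ
descent s = staircase (replicate s 0)

length-descent : ∀ s → length (descent s) ≡ s
length-descent zero    = refl
length-descent (suc s) = cong suc (length-descent s)

descent-bounds : ∀ s → All (_< s) (descent s)
descent-bounds zero    = []
descent-bounds (suc s) = subst (_< suc s) (sym (length-replicate s)) ≤-refl ∷ All.map m<n⇒m<1+n (descent-bounds s)

sumℕ-descent : ∀ s → sumℕ (descent s) ≡ tri s
sumℕ-descent zero    = refl
sumℕ-descent (suc s) = cong₂ _+_ (length-replicate s) (sumℕ-descent s)

private
  sumBy-⊔-≤ : ∀ {x} ys → All (x ≤_) ys → sumBy (x ⊔_) ys ≡ sumℕ ys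
  sumBy-⊔-≤ []       []         = refl
  sumBy-⊔-≤ (y ∷ ys) (x≤y ∷ ps) = cong₂ _+_ (m≤n⇒m⊔n≡n x≤y) (sumBy-⊔-≤ ys ps)

  sumBy-⊔-≥ : ∀ {x} ys → All (_≤ x) ys → sumBy (x ⊔_) ys ≡ length ys * x
  sumBy-⊔-≥ []       []         = refl
  sumBy-⊔-≥ (y ∷ ys) (y≤x ∷ ps) = cong₂ _+_ (m≥n⇒m⊔n≡m y≤x) (sumBy-⊔-≥ ys ps)

  squares : ℕ → ℕ
  squares zero    = 0
  squares (suc s) = s * s + squares s

  pairSum-⊔-interval : ∀ l s → pairSum _⊔_ (interval l s) ≡ l * tri s + squares s
  pairSum-⊔-interval l zero    = sym (trans (+-identityʳ _) (*-zeroʳ l))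
  pairSum-⊔-interval l (suc s) = begin
    sumBy (l ⊔_) (interval (suc l) s) + pairSum _⊔_ (interval (suc l) s)
      ≡⟨ cong₂ _+_ (trans (sumBy-⊔-≤ _ (All.map (<⇒≤ ∘ proj₁) (interval-bounds (suc l) s))) (sumℕ-interval (suc l) s)) (pairSum-⊔-interval (suc l) s) ⟩
    s * suc l + tri s + (suc l * tri s + squares s)
      ≡⟨ solve 4 (λ s l t q → s :* (con 1 :+ l) :+ t :+ ((con 1 :+ l) :* t :+ q) := l :* (s :+ t) :+ ((t :+ t :+ s) :+ q)) refl s l (tri s) (squares s) ⟩
    l * (s + tri s) + ((tri s + tri s + s) + squares s)
      ≡⟨ cong (λ e → l * (s + tri s) + (e + squares s)) (double-tri s) ⟩
    l * (s + tri s) + (s * s + squares s) ∎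
    where
    open ≡-Reasoning
    open ℕ-Solver

  pairSum-⊔-descent : ∀ s → pairSum _⊔_ (descent s) ≡ squares s
  pairSum-⊔-descent zero    = refl
  pairSum-⊔-descent (suc s) = cong₂ _+_
    (trans (cong (λ x → sumBy (x ⊔_) (descent s)) (length-replicate s)) (trans (sumBy-⊔-≥ _ (All.map <⇒≤ (descent-bounds s))) (cong (_* s) (length-descent s))))
    (pairSum-⊔-descent s)

-- The numerators of the two chain sums, for modulus n and for modulus κ = m + n, are exchanged by
-- transposing the determinants: the matrix entries agree because
-- κ (j c + n tri c) + b (j + n c) = n (b c + κ tri c) + j (b + κ c).
module Comparison (m n′ k : ℕ) (k≤m : k ≤ m) where
  n κ : ℕ
  n = suc n′
  κ = m + n

  0<n : 0 < n
  0<n = s≤s z≤n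

  0<κ : 0 < κ
  0<κ = ≤-trans 0<n (m≤n+m n m)

  residues alternant : List ℕ
  residues  = interval 0 n
  alternant = staircase (k ∷ replicate n′ 0)

  length-alternant : length alternant ≡ n
  length-alternant = cong suc (length-descent n′)

  private
    module C₁ = Chain n 0<n
    module N₁ = Numerator n 0<n
    module V₁ = Vandermonde n 0<n
    module C₂ = Chain κ 0<κ
    module N₂ = Numerator κ 0<κ
    module V₂ = Vandermonde κ 0<κ

  residues-ascending : AllPairs N₁.Ascending residues
  residues-ascending = go 0 n ≤-refl
    where
    go : ∀ l s → s ≤ n → AllPairs N₁.Ascending (interval l s)
    go l zero    _   = []
    go l (suc s) s<n = All.map (λ (l<b , b<) → l<b , <-≤-trans b< (subst (_≤ l + n) (+-suc l s) (+-monoʳ-≤ l s<n))) (interval-bounds (suc l) s)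
                       ∷ go (suc l) s (<⇒≤ s<n)

  -- By k ≤ m the largest label k + n - 1 stays below κ, so that the labels are less than κ apart.
  alternant-descending : AllPairs N₂.Descending alternant
  alternant-descending = All.map (λ {b} b<n′ → subst (λ t → b < k + t) (sym (length-replicate n′)) (<-≤-trans b<n′ (m≤n+m n′ k)) ,
      ≤-trans (subst (λ t → k + t < κ) (sym (length-replicate n′)) (<-≤-trans (+-monoʳ-< k ≤-refl) (+-monoˡ-≤ n k≤m))) (m≤n+m κ b)) (descent-bounds n′)
    ∷ go n′ (m≤n⇒m≤1+n ≤-refl)
    where
    go : ∀ s → s ≤ n → AllPairs N₂.Descending (descent s)
    go zero    _   = []
    go (suc s) s<n = All.map (λ {b} b<s → subst (b <_) (sym (length-replicate s)) b<s ,
        ≤-trans (subst (_< κ) (sym (length-replicate s)) (<-≤-trans s<n (m≤n+m n m))) (m≤n+m κ b)) (descent-bounds s) ∷ go s (<⇒≤ s<n)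

  -- In `sum₁` the sum over orderings is h_k in the powers q^position, the contribution of the last
  -- letter. `sum₂` carries no weight, since it belongs to the chain sum evaluated by `compSum-U`.
  sum₁ sum₂ : ℕ → Series
  sum₁ r = compSum residues r (λ v → ∏₂ N₁.N v · (q^ (m * sumBy C₁.weight v) · V₁.ordered J (k ∷ replicate n′ 0) v))
  sum₂ r = compSum alternant r (∏₂ N₂.N)

  private
    entry : ℕ → ℕ → ℕ → Series
    entry b j c = q^ (κ * C₁.weight (j , c)) · q^ (b * C₁.position (j , c))

    entry-≈ : ∀ j b c → entry b j c ≈ q^ (n * C₂.weight (b , c)) · q^ (j * C₂.position (b , c))
    entry-≈ j b c = ≈-trans (≈-sym (q^-+ _ _)) (≈-trans (≡⇒≈ (cong q^
      (solve 6 (λ m n j b c t → (m :+ n) :* (j :* c :+ n :* t) :+ b :* (j :+ n :* c) := n :* (b :* c :+ (m :+ n) :* t) :+ j :* (b :+ (m :+ n) :* c))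
        refl m n j b c (tri c)))) (q^-+ _ _))
      where open ℕ-Solver

    det-weight : ∀ (weight position : ℕ × ℕ → ℕ) e rows v →
      q^ (e * sumBy weight v) · det (λ b p → q^ (b * position p)) rows v ≈ det (λ b p → q^ (e * weight p) · q^ (b * position p)) rows v
    det-weight weight position e rows v = ≈-sym (≈-trans (det-scale _ (λ p → q^ (e * weight p)) rows v)
      (·-congʳ (≈-trans (q^-Multiplicative.∏-χ (λ p → e * weight p) v) (≡⇒≈ (cong q^ (distrib v))))))
      where
      distrib : ∀ v → sumBy (λ p → e * weight p) v ≡ e * sumBy weight v
      distrib []      = sym (*-zeroʳ e)
      distrib (x ∷ v) = trans (cong (e * weight x +_) (distrib v)) (sym (*-distribˡ-+ e (weight x) (sumBy weight v)))

    common : ℕ → Series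
    common r = compSum residues r (det (λ b (j , c) → entry b j c) alternant)

    sign : ℕ → Series
    sign r = sgn (n * r ∸ r)

    descending-near : ∀ {v : List (ℕ × ℕ)} → map proj₁ v ≡ alternant → AllPairs (λ a b → N₂.Descending (proj₁ a) (proj₁ b)) v
    descending-near eq = AllPairsᵖ.map⁻ (subst (AllPairs N₂.Descending) (sym eq) alternant-descending)

    sum₁-≈ : ∀ r → q^ (V₁.lowExponent residues r) · sum₁ r ≈ (sign r · q^ (V₁.highExponent residues r)) · common r
    sum₁-≈ r = ≈-trans (≈-sym (compSum-· _ F residues r)) (≈-trans (compSum-cong residues r λ v eq tot → begin
      q^ (V₁.lowExponent residues r) · (∏₂ N₁.N v · (q^ (m * W v) · V v))
        ≈⟨ solve 4 (λ a b c d → a :* (b :* (c :* d)) := c :* (a :* (b :* d))) ≈-refl (q^ (V₁.lowExponent residues r)) (∏₂ N₁.N v) (q^ (m * W v)) (V v) ⟩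
      q^ (m * W v) · (q^ (V₁.lowExponent residues r) · (∏₂ N₁.N v · V v))
        ≈⟨ ·-congˡ (V₁.normalize {residues} {r} alternant v eq tot (V₁.ordered-ascending (k ∷ replicate n′ 0) v (len v eq)
             (AllPairsᵖ.map⁻ (subst (AllPairs N₁.Ascending) (sym eq) residues-ascending)))) ⟩
      q^ (m * W v) · ((sgn (length residues * r ∸ r) · H) · (q^ (length residues * W v) · D v))
        ≡⟨ cong (λ l → q^ (m * W v) · ((sgn (l * r ∸ r) · H) · (q^ (l * W v) · D v))) (length-interval 0 n) ⟩
      q^ (m * W v) · ((sign r · H) · (q^ (n * W v) · D v))
        ≈⟨ solve 5 (λ a s h b d → a :* ((s :* h) :* (b :* d)) := (s :* h) :* ((a :* b) :* d)) ≈-refl (q^ (m * W v)) (sign r) H (q^ (n * W v)) (D v) ⟩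
      (sign r · H) · ((q^ (m * W v) · q^ (n * W v)) · D v)
        -- The exponent m comes from the parts and n from `normalize`. Their sum is the origin of
        -- the second modulus κ.
        ≈⟨ ·-congˡ (·-congʳ (≈-trans (≡⇒≈ (cong q^ (*-distribʳ-+ (W v) m n))) (q^-+ _ _))) ⟨
      (sign r · H) · (q^ (κ * W v) · D v)
        ≈⟨ ·-congˡ (det-weight C₁.weight C₁.position κ alternant v) ⟩
      (sign r · H) · det (λ b (j , c) → entry b j c) alternant v ∎)
      (compSum-· _ (det (λ b (j , c) → entry b j c) alternant) residues r))
      where
      open ≈-Reasoning
      open Solver
      F : List (ℕ × ℕ) → Series
      F v = ∏₂ N₁.N v · (q^ (m * sumBy C₁.weight v) · V₁.ordered J (k ∷ replicate n′ 0) v)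
      W : List (ℕ × ℕ) → ℕ
      W = sumBy C₁.weight
      V D : List (ℕ × ℕ) → Series
      V = V₁.ordered J (k ∷ replicate n′ 0)
      D = det V₁.power alternant
      H = q^ (V₁.highExponent residues r)
      len : ∀ v → map proj₁ v ≡ residues → length v ≡ suc (length (replicate n′ 0))
      len v eq = trans (sym (length-map proj₁ v)) (trans (cong length eq) (trans (length-interval 0 n) (cong suc (sym (length-replicate n′)))))

    sum₂-≈ : ∀ r → q^ (V₂.lowExponent alternant r) · sum₂ r ≈ (sign r · q^ (V₂.highExponent alternant r)) · common r
    sum₂-≈ r = ≈-trans (≈-sym (compSum-· _ (∏₂ N₂.N) alternant r)) (≈-trans (compSum-cong alternant r λ v eq tot → begin
      q^ (V₂.lowExponent alternant r) · ∏₂ N₂.N v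
        -- The constant 1 is written as a sum over orderings, so that a determinant appears on this
        -- side as well.
        ≈⟨ ·-congˡ (≈-trans (·-congˡ (V₂.ordered-zeros (flip J) J-three-termᵀ (λ x≢y → J-sum (x≢y ∘ sym)) n v (len v eq)
             (C₂.position-AllPairs (AllPairs.map (λ (z<y , y<) → (<⇒≢ z<y ∘ sym) , y< , <-≤-trans z<y (m≤m+n _ κ)) (descending-near eq))))) (·-identityʳ _)) ⟨
      q^ (V₂.lowExponent alternant r) · (∏₂ N₂.N v · V₂.ordered (flip J) (replicate n 0) v)
        ≈⟨ V₂.normalize {alternant} {r} residues v eq tot (subst (λ l → q^ (l * sumBy C₂.position v) · (∏₂ V₂.crossN v · V₂.ordered (flip J) (replicate n 0) v)
               ≈ q^ (sumBy C₂.position v) · (∏₂ N₂.monomial v · det V₂.power residues v)) (sym (len v eq))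
             (V₂.ordered-descending 0 n v (len v eq) (descending-near eq))) ⟩
      (sgn (length alternant * r ∸ r) · H) · (q^ (length alternant * W v) · D v)
        ≡⟨ cong (λ l → (sgn (l * r ∸ r) · H) · (q^ (l * W v) · D v)) length-alternant ⟩
      (sign r · H) · (q^ (n * W v) · D v)
        ≈⟨ ·-congˡ (det-weight C₂.weight C₂.position n residues v) ⟩
      (sign r · H) · det (λ j p → q^ (n * C₂.weight p) · q^ (j * C₂.position p)) residues v
        ≈⟨ ·-congˡ (det-cong residues v λ j (b , c) → entry-≈ j b c) ⟨
      (sign r · H) · det (λ j (b , c) → entry b j c) residues v ∎)
      (≈-trans (compSum-· _ (det (λ j (b , c) → entry b j c) residues) alternant r) (·-congˡ (≈-sym (compSum-det entry alternant residues r)))))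
      where
      open ≈-Reasoning
      W : List (ℕ × ℕ) → ℕ
      W = sumBy C₂.weight
      D : List (ℕ × ℕ) → Series
      D = det V₂.power residues
      H = q^ (V₂.highExponent alternant r)
      len : ∀ v → map proj₁ v ≡ alternant → length v ≡ n
      len v eq = trans (sym (length-map proj₁ v)) (trans (cong length eq) length-alternant)

    high low : ℕ → ℕ → ℕ → ℕ → ℕ → ℕ
    high M l Y X r = (Y + M * r) + (M * (l * r ∸ r) + X)
    low  M l Y _ r = l * (Y + M * r) + (Y * r + M * tri r)

    closed : (f : ℕ → ℕ → ℕ → ℕ) → ∀ ys {l Y X} → length ys ≡ l → sumℕ ys ≡ Y → pairSum _⊔_ ys ≡ X →
      f (length ys) (sumℕ ys) (pairSum _⊔_ ys) ≡ f l Y X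
    closed f ys refl refl refl = refl

    closed₁ : (f : ℕ → ℕ → ℕ → ℕ) → f (length residues) (sumℕ residues) (pairSum _⊔_ residues) ≡ f n (n * 0 + tri n) (squares n)
    closed₁ f = closed f residues (length-interval 0 n) (sumℕ-interval 0 n) (pairSum-⊔-interval 0 n)

    closed₂ : (f : ℕ → ℕ → ℕ → ℕ) → f (length alternant) (sumℕ alternant) (pairSum _⊔_ alternant) ≡ f n (k + n′ + tri n′) (n′ * (k + n′) + squares n′)
    closed₂ f = closed f alternant length-alternant (cong₂ _+_ (cong (k +_) (length-replicate n′)) (sumℕ-descent n′))
      (cong₂ _+_ (trans (cong (λ x → sumBy (x ⊔_) (descent n′)) (cong (k +_) (length-replicate n′)))
                   (trans (sumBy-⊔-≥ _ (All.map (λ b< → ≤-trans (<⇒≤ b<) (m≤n+m n′ k)) (descent-bounds n′))) (cong (_* (k + n′)) (length-descent n′))))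
                 (pairSum-⊔-descent n′))

    -- The power of q in the theorem appears here: `tri r` enters the low exponents with the factors
    -- κ and n, which differ by m, and the label sums of `alternant` and `residues` differ by k.
    -- Everything else cancels.
    exponents : ∀ r → V₁.highExponent residues r + V₂.lowExponent alternant r ≡
      (V₂.highExponent alternant r + V₁.lowExponent residues r) + (m * tri r + k * r)
    exponents r = begin
      V₁.highExponent residues r + V₂.lowExponent alternant r
        ≡⟨ cong₂ _+_ (closed₁ λ l Y X → high n l Y X r) (closed₂ λ l Y X → low κ l Y X r) ⟩
      high n n (n * 0 + tri n) (squares n) r + low κ n (k + n′ + tri n′) (n′ * (k + n′) + squares n′) r
        ≡⟨ cong (λ c → (n * 0 + tri n + n * r) + (n * c + squares n) + low κ n (k + n′ + tri n′) (n′ * (k + n′) + squares n′) r) (m+n∸m≡n r (n′ * r)) ⟩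
      (n * 0 + tri n + n * r) + (n * (n′ * r) + squares n) + low κ n (k + n′ + tri n′) (n′ * (k + n′) + squares n′) r
        ≡⟨ solve 7 (λ m n k r t T s → let N = con 1 :+ n in
             ((N :* con 0 :+ (n :+ t)) :+ N :* r) :+ (N :* (n :* r) :+ (n :* n :+ s))
               :+ (N :* ((k :+ n :+ t) :+ (m :+ N) :* r) :+ ((k :+ n :+ t) :* r :+ (m :+ N) :* T))
             := (((k :+ n :+ t) :+ (m :+ N) :* r) :+ ((m :+ N) :* (n :* r) :+ (n :* (k :+ n) :+ s))
               :+ (N :* ((N :* con 0 :+ (n :+ t)) :+ N :* r) :+ ((N :* con 0 :+ (n :+ t)) :* r :+ N :* T)))
               :+ (m :* T :+ k :* r))
           refl m n′ k r (tri n′) (tri r) (squares n′) ⟩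
      (((k + n′ + tri n′) + κ * r) + (κ * (n′ * r) + (n′ * (k + n′) + squares n′)) + low n n (n * 0 + tri n) (squares n) r) + (m * tri r + k * r)
        ≡⟨ cong (λ c → (((k + n′ + tri n′) + κ * r) + (κ * c + (n′ * (k + n′) + squares n′)) + low n n (n * 0 + tri n) (squares n) r) + (m * tri r + k * r)) (m+n∸m≡n r (n′ * r)) ⟨
      high κ n (k + n′ + tri n′) (n′ * (k + n′) + squares n′) r + low n n (n * 0 + tri n) (squares n) r + (m * tri r + k * r)
        ≡⟨ cong (_+ (m * tri r + k * r)) (cong₂ _+_ (closed₂ λ l Y X → high κ l Y X r) (closed₁ λ l Y X → low n l Y X r)) ⟨
      (V₂.highExponent alternant r + V₁.lowExponent residues r) + (m * tri r + k * r) ∎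
      where
      open ≡-Reasoning
      open ℕ-Solver

  sum₁≈sum₂ : ∀ r → sum₁ r ≈ q^ (m * tri r + k * r) · sum₂ r
  sum₁≈sum₂ r = q^-cancel (h₂ + l₁) (begin
    q^ (h₂ + l₁) · sum₁ r                          ≈⟨ ≈-trans (·-congʳ (q^-+ h₂ l₁)) (·-assoc _ _ _) ⟩
    q^ h₂ · (q^ l₁ · sum₁ r)                       ≈⟨ ·-congˡ (sum₁-≈ r) ⟩
    q^ h₂ · ((sign r · q^ h₁) · common r)          ≈⟨ solve 4 (λ a s b c → a :* ((s :* b) :* c) := b :* ((s :* a) :* c)) ≈-refl (q^ h₂) (sign r) (q^ h₁) (common r) ⟩
    q^ h₁ · ((sign r · q^ h₂) · common r)          ≈⟨ ·-congˡ (sum₂-≈ r) ⟨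
    q^ h₁ · (q^ l₂ · sum₂ r)                       ≈⟨ ≈-trans (·-congʳ (q^-+ h₁ l₂)) (·-assoc _ _ _) ⟨
    q^ (h₁ + l₂) · sum₂ r                          ≈⟨ ·-congʳ (≈-trans (≡⇒≈ (cong q^ (exponents r))) (q^-+ _ _)) ⟩
    (q^ (h₂ + l₁) · q^ (m * tri r + k * r)) · sum₂ r ≈⟨ ·-assoc _ _ _ ⟩
    q^ (h₂ + l₁) · (q^ (m * tri r + k * r) · sum₂ r) ∎)
    where
    open ≈-Reasoning
    open Solver
    h₁ = V₁.highExponent residues r
    h₂ = V₂.highExponent alternant r
    l₁ = V₁.lowExponent residues r
    l₂ = V₂.lowExponent alternant r

-- Congruence modulo powers of q

infix 4 _≈[_]_

record _≈[_]_ (f : Series) (K : ℕ) (g : Series) : Set where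
  constructor upto
  field below : ∀ d → d < K → coef f d ≡ coef g d
open _≈[_]_

truncate : ∀ {f g} K → f ≈ g → f ≈[ K ] g
truncate K p .below d _ = at p d

≈[]-setoid : ℕ → Setoid 0ℓ 0ℓ
≈[]-setoid K = record
  { Carrier = Series ; _≈_ = _≈[ K ]_
  ; isEquivalence = record
    { refl  = upto λ d _ → refl
    ; sym   = λ p → upto λ d d<K → sym (below p d d<K)
    ; trans = λ p r → upto λ d d<K → trans (below p d d<K) (below r d d<K) } }

module ≈[]-Reasoning (K : ℕ) = Relation.Binary.Reasoning.Setoid (≈[]-setoid K)

≈[]-refl : ∀ {f K} → f ≈[ K ] f
≈[]-refl .below d _ = refl

≈[]-sym : ∀ {f g K} → f ≈[ K ] g → g ≈[ K ] f
≈[]-sym p .below d d<K = sym (below p d d<K)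

≈[]-trans : ∀ {f g h K} → f ≈[ K ] g → g ≈[ K ] h → f ≈[ K ] h
≈[]-trans p r .below d d<K = trans (below p d d<K) (below r d d<K)

weaken : ∀ {f g K L} → K ≤ L → f ≈[ L ] g → f ≈[ K ] g
weaken K≤L p .below d d<K = below p d (<-≤-trans d<K K≤L)

⊞-cong[] : ∀ {f f′ g g′ K} → f ≈[ K ] f′ → g ≈[ K ] g′ → f ⊞ g ≈[ K ] f′ ⊞ g′
⊞-cong[] p r .below d d<K = cong₂ ℤ._+_ (below p d d<K) (below r d d<K)

·-cong[] : ∀ {f f′ g g′ K} → f ≈[ K ] f′ → g ≈[ K ] g′ → f · g ≈[ K ] f′ · g′
·-cong[] p r .below d d<K = ⊛-at-cong d (λ i i≤d → below p i (≤-<-trans i≤d d<K)) (λ i i≤d → below r i (≤-<-trans i≤d d<K))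

·-zero[] : ∀ {f K} g → f ≈[ K ] 𝟘 → f · g ≈[ K ] 𝟘
·-zero[] {K = K} g p = ≈[]-trans (·-cong[] p ≈[]-refl) (truncate K (·-zeroˡ g))

-- A factor q^a raises the precision from K to a + K. This is why approximating the summands modulo
-- q^K suffices for coefficients that lie beyond q^(shift r).
q^-·-cong[] : ∀ a {f g K} → f ≈[ K ] g → q^ a · f ≈[ a + K ] q^ a · g
q^-·-cong[] a {f} {g} {K} p .below d d<a+K with <-≤-connex d a
... | inj₁ d<a = trans (coef-q^-·-< a f d d<a) (sym (coef-q^-·-< a g d d<a))
... | inj₂ a≤d = subst (λ e → coef (q^ a · f) e ≡ coef (q^ a · g) e) (m+[n∸m]≡n a≤d)
  (trans (coef-q^-· a f (d ∸ a)) (trans (below p (d ∸ a) (+-cancelˡ-< a (d ∸ a) K (subst (_< a + K) (sym (m+[n∸m]≡n a≤d)) d<a+K))) (sym (coef-q^-· a g (d ∸ a)))))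

q^-zero[] : ∀ a → q^ a ≈[ a ] 𝟘
q^-zero[] a .below d d<a = trans (sym (at (·-identityʳ (q^ a)) d)) (coef-q^-·-< a 𝟙 d d<a)

om-one[] : ∀ {K e} → K ≤ e → om e ≈[ K ] 𝟙
om-one[] {K} {e} K≤e .below d d<K = trans (cong (λ x → coef 𝟙 d ℤ.+ ℤ.- x) (below (q^-zero[] e) d (<-≤-trans d<K K≤e))) (ℤᵖ.+-identityʳ _)

unit-cancel[] : ∀ f {g h K} → coef f 0 ≡ ℤ.+ 1 → f · g ≈[ K ] f · h → g ≈[ K ] h
unit-cancel[] f {g} {h} {K} f0 p = ≈[]-trans (truncate K (≈-sym (inverse-· f g f0)))
  (≈[]-trans (·-cong[] ≈[]-refl p) (truncate K (inverse-· f h f0)))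

·-order-suc : ∀ {f g K} → coef f 0 ≡ ℤ.+ 0 → g ≈[ K ] 𝟘 → f · g ≈[ suc K ] 𝟘
·-order-suc {f} {g} f0 p .below zero    _         = trans (⊛-zero (coef f) (coef g)) (cong (ℤ._* coef g 0) f0)
·-order-suc {f} {g} f0 p .below (suc d) (s≤s d<K) = trans (⊛-suc (coef f) (coef g) d) (cong₂ ℤ._+_ (cong (ℤ._* coef g (suc d)) f0)
  (trans (⊛-at-cong {f = tail (coef f)} {g = coef g} d (λ _ _ → refl) (λ i i≤d → below p i (≤-<-trans i≤d d<K))) (at (·-zeroʳ (series (tail (coef f)))) d)))

∏-cong[] : ∀ {P : A → Set} {f g : A → Series} {xs K} → All P xs → (∀ x → P x → f x ≈[ K ] g x) → ∏ f xs ≈[ K ] ∏ g xs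
∏-cong[] []         h = ≈[]-refl
∏-cong[] (px ∷ pxs) h = ·-cong[] (h _ px) (∏-cong[] pxs h)

∏-zero[] : ∀ (f : A → Series) {xs K x} → x ∈ xs → f x ≈[ K ] 𝟘 → ∏ f xs ≈[ K ] 𝟘
∏-zero[] f (here refl)                h = ·-zero[] _ h
∏-zero[] f {x ∷ xs} {K} (there x∈xs) h = ≈[]-trans (·-cong[] ≈[]-refl (∏-zero[] f x∈xs h)) (truncate K (·-zeroʳ (f x)))

∏₂-cong[] : ∀ {P : A → Set} {f g : A → A → Series} {xs K} → All P xs → (∀ x y → P x → P y → f x y ≈[ K ] g x y) → ∏₂ f xs ≈[ K ] ∏₂ g xs
∏₂-cong[] []         h = ≈[]-refl
∏₂-cong[] (px ∷ pxs) h = ·-cong[] (∏-cong[] pxs (λ y → h _ y px)) (∏₂-cong[] pxs h)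

splitSum-cong[] : ∀ {H H′ : List A → A → List A → Series} {K} xs →
  (∀ pre p post → pre ++ p ∷ post ≡ xs → H pre p post ≈[ K ] H′ pre p post) → splitSum xs H ≈[ K ] splitSum xs H′
splitSum-cong[] []       h = ≈[]-refl
splitSum-cong[] (x ∷ xs) h = ⊞-cong[] (h [] x xs refl) (splitSum-cong[] xs λ pre p post eq → h (x ∷ pre) p post (cong (x ∷_) eq))

antidiag-cong[] : ∀ {G H : ℕ → ℕ → Series} {K} r → (∀ s t → s + t ≡ r → G s t ≈[ K ] H s t) → antidiag r G ≈[ K ] antidiag r H
antidiag-cong[] zero    h = h 0 0 refl
antidiag-cong[] (suc r) h = ⊞-cong[] (h 0 (suc r) refl) (antidiag-cong[] r λ s t eq → h (suc s) t (cong suc eq))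

compSum-cong[] : ∀ {F G : List (A × ℕ) → Series} {K} ys r → (∀ v → map proj₁ v ≡ ys → total v ≡ r → F v ≈[ K ] G v) → compSum ys r F ≈[ K ] compSum ys r G
compSum-cong[] []       zero    h = h [] refl refl
compSum-cong[] []       (suc r) h = ≈[]-refl
compSum-cong[] (y ∷ ys) r       h = antidiag-cong[] r λ s t s+t≡r → compSum-cong[] ys t λ v eq tot →
  h ((y , s) ∷ v) (cong (y ∷_) eq) (trans (cong (s +_) tot) s+t≡r)

series-∏ : ∀ (f : A → PS) xs → series (prodL (map f xs)) ≈ ∏ (series ∘ f) xs
series-∏ f []       = pw λ _ → refl
series-∏ f (x ∷ xs) = ≈-trans (pw λ _ → refl) (·-congˡ {series (f x)} (series-∏ f xs))

series-om : ∀ e → series (onePS ⊖ mono e) ≈ om e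
series-om e .at d = refl

pochFin-suc : ∀ ρ M c → series (pochFin ρ M (suc c)) ≈ series (pochFin ρ M c) · om (ρ + M * c)
pochFin-suc ρ M c = begin
  series (pochFin ρ M (suc c))         ≈⟨ series-∏ _ (upTo (suc c)) ⟩
  ∏ factor (upTo (suc c))              ≡⟨ cong (∏ factor) (upTo-∷ʳ c) ⟨
  ∏ factor (upTo c ++ c ∷ [])          ≈⟨ ∏-++ factor (upTo c) (c ∷ []) ⟩
  ∏ factor (upTo c) · (factor c · 𝟙)   ≈⟨ ·-cong (series-∏ _ (upTo c)) (≈-sym (≈-trans (·-identityʳ _) (series-om _))) ⟨
  series (pochFin ρ M c) · om (ρ + M * c) ∎
  where
  open ≈-Reasoning
  factor : ℕ → Series
  factor j = series (onePS ⊖ mono (ρ + M * j))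

infinite : ℕ → ℕ → Series
infinite ρ M = series (poch∞ ρ M)

pochFin-limit : ∀ ρ {M c K} → 0 < M → K ≤ c → series (pochFin ρ M c) ≈[ K ] infinite ρ M
pochFin-limit ρ {M} {c} {K} 0<M K≤c .below d d<K = trans (stable c (≤-trans d<K K≤c)) (sym (stable (suc d) ≤-refl))
  where
  stable : ∀ c → suc d ≤ c → pochFin ρ M c d ≡ pochFin ρ M (suc d) d
  stable (suc c) (s≤s d≤c) with m≤n⇒m<n∨m≡n d≤c
  ... | inj₂ refl = refl
  ... | inj₁ d<c  = trans (at (pochFin-suc ρ M c) d) (trans
    (below (≈[]-trans (·-cong[] {f = series (pochFin ρ M c)} {K = suc d} ≈[]-refl (om-one[] (≤-trans d<c (≤-trans (≤-trans (≤-reflexive (sym (*-identityˡ c))) (*-monoˡ-≤ c 0<M)) (m≤n+m _ ρ))))) (truncate (suc d) (·-identityʳ _))) d ≤-refl)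
    (stable c d<c))

-- Limits of the chain sums

J-order : ∀ {x w} → w < x → coef (J x w) 0 ≡ ℤ.+ 0
J-order {x} {w} w<x = trans (cong (λ f → coef f 0) (J-≥ (<⇒≤ w<x)))
  (cong ℤ.-_ (coef-q^-·-< (x ∸ w) (inverse (om (x ∸ w))) 0 (m<n⇒0<n∸m w<x)))

module Limit (M : ℕ) (0<M : 0 < M) where
  open Chain M 0<M
  open Numerator M 0<M

  -- By `J-order` every rung below x has constant term 0 and so raises the order by one.
  ladder-order : ∀ {x z} K c → K ≤ c → z + M * K < x → ladder x z c ≈[ K ] 𝟘
  ladder-order         zero    c       _         _ = upto λ _ ()
  ladder-order {x} {z} (suc K) (suc c) (s≤s K≤c) h = ·-order-suc
    (J-order (≤-<-trans (≤-trans (≤-reflexive (+-comm M z)) (+-monoʳ-≤ z (m≤m*n M (suc K)))) h))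
    (ladder-order K c K≤c (subst (_< x) (solve 3 (λ z M K → z :+ M :* (con 1 :+ K) := M :+ z :+ M :* K) refl z M K) h))
    where open ℕ-Solver

  pair-order : ∀ a b K → Near (proj₁ a) (proj₁ b) → suc (proj₂ a + K) ≤ proj₂ b → pair a b ≈[ K ] 𝟘
  pair-order a@(y , c) b@(z , d) K (_ , y<z+M , _) h = ≈[]-trans (truncate K (·-comm _ _))
    (·-zero[] _ (ladder-order K d (≤-trans (m≤n+m K c) (<⇒≤ h)) (begin-strict
      y + M * c + M * K       <⟨ +-monoˡ-< (M * K) (+-monoˡ-< (M * c) y<z+M) ⟩
      z + M + M * c + M * K   ≡⟨ solve 4 (λ z M c K → z :+ M :+ M :* c :+ M :* K := z :+ M :* (con 1 :+ (c :+ K))) refl z M c K ⟩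
      z + M * suc (c + K)     ≤⟨ +-monoʳ-≤ z (*-monoʳ-≤ M h) ⟩
      z + M * d               ∎)))
    where
    open ≤-Reasoning
    open ℕ-Solver

  rising-limit : ∀ ρ {c K} → K ≤ c → rising ρ c ≈[ K ] infinite ρ M
  rising-limit ρ {c} {K} K≤c = ≈[]-trans (truncate K (finite c)) (pochFin-limit ρ 0<M K≤c)
    where
    finite : ∀ c → rising ρ c ≈ series (pochFin ρ M c)
    finite zero    = pw λ _ → refl
    finite (suc c) = ≈-trans (·-comm _ _) (≈-trans (·-congʳ (finite c)) (≈-sym (pochFin-suc ρ M c)))

  poch-limit : ∀ {c K} → K ≤ c → poch c ≈[ K ] infinite M M
  poch-limit {c} {K} K≤c = ≈[]-trans (truncate K (finite c)) (pochFin-limit M 0<M K≤c)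
    where
    finite : ∀ c → poch c ≈ series (pochFin M M c)
    finite zero    = pw λ _ → refl
    finite (suc c) = ≈-trans (·-cong (≡⇒≈ (cong om (*-suc M c))) (finite c)) (≈-trans (·-comm _ _) (≈-sym (pochFin-suc M M c)))

  thetaFactor : ℕ → ℕ → Series
  thetaFactor y z = if y <ᵇ z then infinite (z ∸ y) M · infinite (M ∸ (z ∸ y)) M else 𝟙

  theta₂ : ℕ → ℕ → Series
  theta₂ y z = thetaFactor y z · thetaFactor z y

  -- The limit of `denominators v` when all multiplicities grow; only the labels remain.
  Θ : List ℕ → Series
  Θ ys = ∏ (λ _ → infinite M M) ys · ∏₂ theta₂ ys

  denominators : List (ℕ × ℕ) → Series
  denominators v = ∏ (poch ∘ proj₂) v · ∏₂ denominator v

  poch-self : ∀ p → poch (proj₂ p) · self p ≈ 𝟙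
  poch-self (y , zero)  = ·-identityˡ 𝟙
  poch-self (y , suc c) = ≈-trans (solve 3 (λ o p s → (o :* p) :* s := p :* (o :* s)) ≈-refl (om (M * suc c)) (poch c) (self (y , suc c)))
    (≈-trans (·-congˡ (self-raise y c)) (poch-self (y , c)))
    where open Solver

  U-denominators : ∀ v → U v · denominators v ≈ ∏₂ N v
  U-denominators v = begin
    (∏ self v · ∏₂ pair v) · (∏ (poch ∘ proj₂) v · ∏₂ denominator v)
      ≈⟨ solve 4 (λ a b c d → (a :* b) :* (c :* d) := (c :* a) :* (b :* d)) ≈-refl (∏ self v) (∏₂ pair v) (∏ (poch ∘ proj₂) v) (∏₂ denominator v) ⟩
    (∏ (poch ∘ proj₂) v · ∏ self v) · (∏₂ pair v · ∏₂ denominator v)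
      ≈⟨ ·-cong (≈-sym (∏-· _ _ v)) (≈-sym (∏₂-· pair denominator v)) ⟩
    ∏ (λ p → poch (proj₂ p) · self p) v · ∏₂ N v
      ≈⟨ ·-congʳ (≈-trans (∏-cong v poch-self) (∏-𝟙 v)) ⟩
    𝟙 · ∏₂ N v
      ≈⟨ ·-identityˡ _ ⟩
    ∏₂ N v ∎
    where
    open ≈-Reasoning
    open Solver

  private
    ∏₂-map : ∀ (φ : ℕ → ℕ → Series) (v : List (ℕ × ℕ)) → ∏₂ φ (map proj₁ v) ≈ ∏₂ (λ a b → φ (proj₁ a) (proj₁ b)) v
    ∏₂-map φ []      = ≈-refl
    ∏₂-map φ (x ∷ v) = ·-cong (∏-map _ proj₁ v) (∏₂-map φ v)

    denominator-limit : ∀ {K} a b → K ≤ proj₂ a → K ≤ proj₂ b → denominator a b ≈[ K ] theta₂ (proj₁ a) (proj₁ b)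
    denominator-limit {K} a b K≤c K≤d = ·-cong[] (half a b K≤c K≤d) (half b a K≤d K≤c)
      where
      half : ∀ a b → K ≤ proj₂ a → K ≤ proj₂ b → oriented a b ≈[ K ] thetaFactor (proj₁ a) (proj₁ b)
      half (y , c) (z , d) K≤c K≤d with y <ᵇ z
      ... | true  = ·-cong[] (rising-limit (z ∸ y) (m≤n⇒m≤1+n K≤d)) (rising-limit (M ∸ (z ∸ y)) K≤c)
      ... | false = ≈[]-refl

  denominators-limit : ∀ {K} v → All (λ p → K ≤ proj₂ p) v → denominators v ≈[ K ] Θ (map proj₁ v)
  denominators-limit {K} v large = ≈[]-trans
    (·-cong[] (∏-cong[] large λ p K≤c → poch-limit K≤c) (∏₂-cong[] large λ a b → denominator-limit a b))
    (truncate K (≈-sym (·-cong (∏-map _ proj₁ v) (∏₂-map theta₂ v))))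

  private
    small-split : ∀ K (v : List (ℕ × ℕ)) → All (λ p → K ≤ proj₂ p) v ⊎
      ∃[ pre ] ∃[ p ] ∃[ post ] (pre ++ p ∷ post ≡ v × proj₂ p < K)
    small-split K []      = inj₁ []
    small-split K (p ∷ v) with <-≤-connex (proj₂ p) K
    ... | inj₁ c<K = inj₂ ([] , p , v , refl , c<K)
    ... | inj₂ K≤c with small-split K v
    ...   | inj₁ large                         = inj₁ (K≤c ∷ large)
    ...   | inj₂ (pre , p′ , post , refl , lt) = inj₂ (p ∷ pre , p′ , post , refl , lt)

    large-member : ∀ B (v : List (ℕ × ℕ)) → (∃[ b ] (b ∈ v × B ≤ proj₂ b)) ⊎ total v ≤ length v * B
    large-member B []      = inj₂ z≤n
    large-member B (p ∷ v) with <-≤-connex (proj₂ p) B | large-member B v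
    ... | inj₂ B≤c | _                     = inj₁ (p , here refl , B≤c)
    ... | inj₁ _   | inj₁ (b , b∈v , B≤c) = inj₁ (b , there b∈v , B≤c)
    ... | inj₁ c<B | inj₂ bound           = inj₂ (+-mono-≤ (<⇒≤ c<B) bound)

    total-middle : ∀ pre (p : ℕ × ℕ) post → total (pre ++ p ∷ post) ≡ proj₂ p + total (pre ++ post)
    total-middle []        p post = refl
    total-middle (x ∷ pre) p post = trans (cong (proj₂ x +_) (total-middle pre p post))
      (solve 3 (λ a b c → a :+ (b :+ c) := b :+ (a :+ c)) refl (proj₂ x) (proj₂ p) (total (pre ++ post)))
      where open ℕ-Solver

  -- If one multiplicity is below K, the size of the total forces another one of at least 2 K. The
  -- ladder of the latter then begins with K rungs lying below its own position, and each of them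
  -- raises the order by one.
  U-balanced : ∀ K v → NearPairs v → length v * (K + K) ≤ total v → All (λ p → K ≤ proj₂ p) v ⊎ U v ≈[ K ] 𝟘
  U-balanced K v near bound with small-split K v
  ... | inj₁ large                          = inj₁ large
  ... | inj₂ (pre , p , post , refl , c<K) with large-member (K + K) (pre ++ post)
  ...   | inj₁ (b , b∈ , 2K≤d) = inj₂ (≈[]-trans (truncate K (≈-trans (U-middle pre p post)
            (solve 3 (λ s p u → s :* (p :* u) := p :* (s :* u)) ≈-refl (self p) (∏ (pair p) (pre ++ post)) (U (pre ++ post)))))
          (·-zero[] _ (∏-zero[] (pair p) b∈ (pair-order p b K (All.lookup (near-rest pre near refl) b∈) (≤-trans (+-monoˡ-< K c<K) 2K≤d)))))
    where open Solver
  ...   | inj₂ small = contradiction bound (<⇒≱ (begin-strict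
            total (pre ++ p ∷ post)                      ≡⟨ total-middle pre p post ⟩
            proj₂ p + total (pre ++ post)                <⟨ +-mono-<-≤ (<-≤-trans c<K (m≤m+n K K)) small ⟩
            K + K + length (pre ++ post) * (K + K)       ≡⟨ cong (_* (K + K)) (rest-length pre refl) ⟨
            length (pre ++ p ∷ post) * (K + K)           ∎))
    where open ≤-Reasoning

  -- Uniform in the composition: for balanced v the finite denominators have reached their limit,
  -- and otherwise both sides vanish modulo q^K because the numerators are a multiple of `U`.
  Θ-U : ∀ K {ys} v → NearLabels ys → map proj₁ v ≡ ys → length ys * (K + K) ≤ total v → Θ ys · U v ≈[ K ] ∏₂ N v
  Θ-U K v near refl bound with U-balanced K v (nearPairs near {v} refl) (subst (λ l → l * (K + K) ≤ total v) (length-map proj₁ v) bound)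
  ... | inj₁ large = begin
    Θ (map proj₁ v) · U v    ≈⟨ ·-cong[] (≈[]-sym (denominators-limit v large)) ≈[]-refl ⟩
    denominators v · U v     ≈⟨ truncate K (≈-trans (·-comm _ _) (U-denominators v)) ⟩
    ∏₂ N v                   ∎
    where open ≈[]-Reasoning K
  ... | inj₂ zero′ = begin
    Θ (map proj₁ v) · U v    ≈⟨ truncate K (·-comm _ _) ⟩
    U v · Θ (map proj₁ v)    ≈⟨ ·-zero[] _ zero′ ⟩
    𝟘                        ≈⟨ ·-zero[] _ zero′ ⟨
    U v · denominators v     ≈⟨ truncate K (U-denominators v) ⟩
    ∏₂ N v                   ∎
    where open ≈[]-Reasoning K

-- A label set of total r stands for r distinct natural numbers, whose sum is at least 0 + 1 + … + (r − 1).
private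
  squareSum : List (ℕ × ℕ) → ℕ
  squareSum = sumBy (λ p → proj₂ p * proj₂ p)

  moment : List (ℕ × ℕ) → ℕ
  moment = sumBy (λ p → proj₁ p * proj₂ p)

  -- The integer inequality (a - b)² ≥ a - b with the negative terms moved across.
  two-squares : ∀ a b → (a * b + a * b) + a ≤ (a * a + b * b) + b
  two-squares a b with ≤-total a b
  ... | inj₁ a≤b = subst (λ b → (a * b + a * b) + a ≤ (a * a + b * b) + b) (m+[n∸m]≡n a≤b) (go a (b ∸ a))
    where
    go : ∀ a e → (a * (a + e) + a * (a + e)) + a ≤ (a * a + (a + e) * (a + e)) + (a + e)
    go a e = ≤-trans (m≤m+n _ (e * e + e)) (≤-reflexive
      (solve 2 (λ a e → (a :* (a :+ e) :+ a :* (a :+ e)) :+ a :+ (e :* e :+ e) := (a :* a :+ (a :+ e) :* (a :+ e)) :+ (a :+ e)) refl a e))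
      where open ℕ-Solver
  ... | inj₂ b≤a = subst (λ a → (a * b + a * b) + a ≤ (a * a + b * b) + b) (m+[n∸m]≡n b≤a) (go b (a ∸ b))
    where
    e≤e*e : ∀ e → e ≤ e * e
    e≤e*e zero    = z≤n
    e≤e*e (suc e) = m≤m*n (suc e) (suc e)
    go : ∀ b e → ((b + e) * b + (b + e) * b) + (b + e) ≤ ((b + e) * (b + e) + b * b) + b
    go b e = begin
      ((b + e) * b + (b + e) * b) + (b + e)     ≡⟨ solve 2 (λ b e → ((b :+ e) :* b :+ (b :+ e) :* b) :+ (b :+ e) := ((b :+ e) :* b :+ (b :+ e) :* b) :+ b :+ e) refl b e ⟩
      ((b + e) * b + (b + e) * b) + b + e       ≤⟨ +-monoʳ-≤ (((b + e) * b + (b + e) * b) + b) (e≤e*e e) ⟩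
      ((b + e) * b + (b + e) * b) + b + e * e   ≡⟨ solve 2 (λ b e → ((b :+ e) :* b :+ (b :+ e) :* b) :+ b :+ e :* e := ((b :+ e) :* (b :+ e) :+ b :* b) :+ b) refl b e ⟩
      ((b + e) * (b + e) + b * b) + b           ∎
      where
      open ≤-Reasoning
      open ℕ-Solver

  two-squares-sum : ∀ a v → (a * total v + a * total v) + length v * a ≤ (length v * (a * a) + squareSum v) + total v
  two-squares-sum a []            = ≤-reflexive (solve 1 (λ a → a :* con 0 :+ a :* con 0 :+ con 0 := con 0) refl a)
    where open ℕ-Solver
  two-squares-sum a ((y , b) ∷ v) = begin
    (a * (b + total v) + a * (b + total v)) + (a + length v * a)
      ≡⟨ solve 4 (λ a b t l → (a :* (b :+ t) :+ a :* (b :+ t)) :+ (a :+ l) := ((a :* b :+ a :* b) :+ a) :+ ((a :* t :+ a :* t) :+ l)) refl a b (total v) (length v * a) ⟩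
    ((a * b + a * b) + a) + ((a * total v + a * total v) + length v * a)
      ≤⟨ +-mono-≤ (two-squares a b) (two-squares-sum a v) ⟩
    ((a * a + b * b) + b) + ((length v * (a * a) + squareSum v) + total v)
      ≡⟨ solve 6 (λ a b x l s t → ((x :+ b :* b) :+ b) :+ ((l :+ s) :+ t) := ((x :+ l) :+ (b :* b :+ s)) :+ (b :+ t)) refl a b (a * a) (length v * (a * a)) (squareSum v) (total v) ⟩
    ((a * a + length v * (a * a)) + (b * b + squareSum v)) + (b + total v) ∎
    where
    open ≤-Reasoning
    open ℕ-Solver

  -- The sum of `two-squares` over all pairs of labels y < z: the squares (c_y - c_z)² add up to s ·
  -- Σ c² - (Σ c)², and the differences c_y - c_z give the terms linear in the multiplicities.
  square-bound : ∀ l s v → map proj₁ v ≡ interval l s →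
    (total v * total v + s * total v) + (l * total v + l * total v) ≤ (s * squareSum v + (moment v + moment v)) + total v
  square-bound l zero    []            _  = ≤-reflexive (solve 1 (λ l → con 0 :+ (l :* con 0 :+ l :* con 0) := con 0) refl l)
    where open ℕ-Solver
  square-bound l (suc s) ((y , a) ∷ v) eq with ∷-injective eq
  ... | refl , eq′ = begin
    ((a + t) * (a + t) + suc s * (a + t)) + (l * (a + t) + l * (a + t))
      ≡⟨ solve 4 (λ l s a t → ((a :+ t) :* (a :+ t) :+ (con 1 :+ s) :* (a :+ t)) :+ (l :* (a :+ t) :+ l :* (a :+ t)) :=
           ((a :* t :+ a :* t) :+ s :* a) :+ (((t :* t :+ s :* t) :+ ((l :* t :+ l :* t) :+ t)) :+ (a :* a :+ a :+ (l :* a :+ l :* a)))) refl l s a t ⟩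
    ((a * t + a * t) + s * a) + (((t * t + s * t) + ((l * t + l * t) + t)) + (a * a + a + (l * a + l * a)))
      ≤⟨ +-monoˡ-≤ _ (subst (λ s → (a * t + a * t) + s * a ≤ (s * (a * a) + squareSum v) + t) len (two-squares-sum a v)) ⟩
    ((s * (a * a) + squareSum v) + t) + (((t * t + s * t) + ((l * t + l * t) + t)) + (a * a + a + (l * a + l * a)))
      ≡⟨ solve 5 (λ l s a t q → ((s :* (a :* a) :+ q) :+ t) :+ (((t :* t :+ s :* t) :+ ((l :* t :+ l :* t) :+ t)) :+ (a :* a :+ a :+ (l :* a :+ l :* a))) :=
           ((t :* t :+ s :* t) :+ ((con 1 :+ l) :* t :+ (con 1 :+ l) :* t)) :+ (s :* (a :* a) :+ q :+ a :* a :+ a :+ (l :* a :+ l :* a))) refl l s a t (squareSum v) ⟩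
    ((t * t + s * t) + (suc l * t + suc l * t)) + (s * (a * a) + squareSum v + a * a + a + (l * a + l * a))
      ≤⟨ +-monoˡ-≤ _ (square-bound (suc l) s v eq′) ⟩
    ((s * squareSum v + (moment v + moment v)) + t) + (s * (a * a) + squareSum v + a * a + a + (l * a + l * a))
      ≡⟨ solve 6 (λ l s a t q y → ((s :* q :+ (y :+ y)) :+ t) :+ (s :* (a :* a) :+ q :+ a :* a :+ a :+ (l :* a :+ l :* a)) :=
           ((con 1 :+ s) :* (a :* a :+ q) :+ ((l :* a :+ y) :+ (l :* a :+ y))) :+ (a :+ t)) refl l s a t (squareSum v) (moment v) ⟩
    (suc s * (a * a + squareSum v) + ((l * a + moment v) + (l * a + moment v))) + (a + t) ∎
    where
    open ≤-Reasoning
    open ℕ-Solver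
    t = total v
    len : length v ≡ s
    len = trans (sym (length-map proj₁ v)) (trans (cong length eq′) (length-interval (suc l) s))

module _ (n : ℕ) (0<n : 0 < n) where
  open Chain n 0<n

  private
    double-weight : ∀ v → (sumBy weight v + sumBy weight v) + n * total v ≡ n * squareSum v + (moment v + moment v)
    double-weight []            = sym (+-identityʳ _)
    double-weight ((y , c) ∷ v) = begin
      ((y * c + n * tri c + W) + (y * c + n * tri c + W)) + n * (c + total v)
        ≡⟨ solve 6 (λ n y c x W t → ((y :* c :+ n :* x :+ W) :+ (y :* c :+ n :* x :+ W)) :+ n :* (c :+ t) :=
             (y :* c :+ y :* c) :+ n :* (x :+ x :+ c) :+ ((W :+ W) :+ n :* t)) refl n y c (tri c) W (total v) ⟩
      (y * c + y * c) + n * (tri c + tri c + c) + ((W + W) + n * total v)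
        ≡⟨ cong₂ (λ a b → (y * c + y * c) + n * a + b) (double-tri c) (double-weight v) ⟩
      (y * c + y * c) + n * (c * c) + (n * squareSum v + (moment v + moment v))
        ≡⟨ solve 5 (λ n a x s y → (a :+ a) :+ n :* x :+ (n :* s :+ (y :+ y)) := n :* (x :+ s) :+ ((a :+ y) :+ (a :+ y))) refl n (y * c) (c * c) (squareSum v) (moment v) ⟩
      n * (c * c + squareSum v) + ((y * c + moment v) + (y * c + moment v)) ∎
      where
      open ≡-Reasoning
      open ℕ-Solver
      W = sumBy weight v

  tri≤weight : ∀ v → map proj₁ v ≡ interval 0 n → tri (total v) ≤ sumBy weight v
  tri≤weight v eq = halve (+-cancelʳ-≤ (r + n * r) (tri r + tri r) (W + W) (begin
    (tri r + tri r) + (r + n * r)                        ≡⟨ +-assoc (tri r + tri r) r (n * r) ⟨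
    (tri r + tri r + r) + n * r                          ≡⟨ cong (_+ n * r) (double-tri r) ⟩
    r * r + n * r                                        ≡⟨ +-identityʳ _ ⟨
    (r * r + n * r) + (0 * r + 0 * r)                    ≤⟨ square-bound 0 n v eq ⟩
    (n * squareSum v + (moment v + moment v)) + r        ≡⟨ cong (_+ r) (double-weight v) ⟨
    ((W + W) + n * r) + r                                ≡⟨ solve 3 (λ w x r → (w :+ x) :+ r := w :+ (r :+ x)) refl (W + W) (n * r) r ⟩
    (W + W) + (r + n * r)                                ∎))
    where
    open ≤-Reasoning
    open ℕ-Solver
    r = total v
    W = sumBy weight v
    halve : ∀ {a b} → a + a ≤ b + b → a ≤ b
    halve {a} {b} h with ≤-<-connex a b
    ... | inj₁ a≤b = a≤b
    ... | inj₂ b<a = contradiction h (<⇒≱ (+-mono-< b<a b<a))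

  private
    total-raise : ∀ pre p post → total (pre ++ raise p ∷ post) ≡ suc (total (pre ++ p ∷ post))
    total-raise []        p post = refl
    total-raise (x ∷ pre) p post = trans (cong (proj₂ x +_) (total-raise pre p post)) (+-suc (proj₂ x) _)

  -- Write m as k + (m - k). The k copies use the bound for r + 1 letters, including the one that
  -- carries k, and the m - k copies use the bound for the first r letters.
  shift-bound : ∀ {m k} → k ≤ m → ∀ pre p post → map proj₁ (pre ++ p ∷ post) ≡ interval 0 n →
    let v = pre ++ p ∷ post in m * tri (total v) + k * total v ≤ m * sumBy weight v + k * position p
  shift-bound {m} {k} k≤m pre p post eq = subst (λ m → m * tri r + k * r ≤ m * W + k * P) (m+[n∸m]≡n k≤m) (begin
    (k + (m ∸ k)) * tri r + k * r      ≡⟨ solve 4 (λ k d t r → (k :+ d) :* t :+ k :* r := k :* (r :+ t) :+ d :* t) refl k (m ∸ k) (tri r) r ⟩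
    k * (r + tri r) + (m ∸ k) * tri r  ≤⟨ +-mono-≤ (*-monoʳ-≤ k raised) (*-monoʳ-≤ (m ∸ k) (tri≤weight v eq)) ⟩
    k * (W + P) + (m ∸ k) * W          ≡⟨ solve 4 (λ k d w p → k :* (w :+ p) :+ d :* w := (k :+ d) :* w :+ k :* p) refl k (m ∸ k) W P ⟩
    (k + (m ∸ k)) * W + k * P          ∎)
    where
    open ≤-Reasoning
    open ℕ-Solver
    v = pre ++ p ∷ post
    r = total v
    W = sumBy weight v
    P = position p
    raised : r + tri r ≤ W + P
    raised = subst₂ _≤_ (cong tri (total-raise pre p post)) (sumBy-weight-raise pre p post)
      (tri≤weight (pre ++ raise p ∷ post) (trans (labels-raise pre p post) eq))

module ChainLimit (m n′ k : ℕ) (k≤m : k ≤ m) where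
  open Comparison m n′ k k≤m

  private
    module C₁ = Chain n 0<n
    module N₁ = Numerator n 0<n
    module V₁ = Vandermonde n 0<n
    module L₁ = Limit n 0<n
    module C₂ = Chain κ 0<κ
    module N₂ = Numerator κ 0<κ
    module L₂ = Limit κ 0<κ

  residues-near : C₁.NearLabels residues
  residues-near = AllPairs.map (λ (y<z , z<) → <⇒≢ y<z , <-≤-trans y<z (m≤m+n _ n) , z<) residues-ascending

  alternant-near : C₂.NearLabels alternant
  alternant-near = AllPairs.map (λ (z<y , y<) → (<⇒≢ z<y ∘ sym) , y< , <-≤-trans z<y (m≤m+n _ κ)) alternant-descending

  shift : ℕ → ℕ
  shift r = m * tri r + k * r

  -- `Θ-U` turns the numerators back into `Θ · U`, whose sum over all compositions is given by
  -- `compSum-U`.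
  sum₂-limit : ∀ K r → n * (K + K) ≤ r → K ≤ r → infinite κ κ · sum₂ r ≈[ K ] L₂.Θ alternant
  sum₂-limit K r bound K≤r = begin
    infinite κ κ · sum₂ r
      ≈⟨ ·-cong[] (L₂.poch-limit {r} K≤r) (compSum-cong[] alternant r λ v eq tot →
           L₂.Θ-U K v alternant-near eq (subst₂ (λ l t → l * (K + K) ≤ t) (sym length-alternant) (sym tot) bound)) ⟨
    C₂.poch r · compSum alternant r (λ v → L₂.Θ alternant · C₂.U v)
      ≈⟨ truncate K (≈-trans (·-congˡ (compSum-· (L₂.Θ alternant) C₂.U alternant r))
           (solve 3 (λ p t c → p :* (t :* c) := t :* (p :* c)) ≈-refl (C₂.poch r) (L₂.Θ alternant) (compSum alternant r C₂.U))) ⟩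
    L₂.Θ alternant · (C₂.poch r · compSum alternant r C₂.U)
      ≈⟨ truncate K (≈-trans (·-congˡ (C₂.compSum-U alternant alternant-near (s≤s z≤n) r)) (·-identityʳ _)) ⟩
    L₂.Θ alternant ∎
    where
    open ≈[]-Reasoning K
    open Solver

  private
    -- Knowing `Θ · U` modulo q^K is enough, because the remaining power of q in each term is at
    -- least `shift r` by `shift-bound`.
    Ψ-summand : ∀ K r → n * (K + K) ≤ r → ∀ v → map proj₁ v ≡ residues → total v ≡ r →
      L₁.Θ residues · (C₁.U v · (q^ (m * sumBy C₁.weight v) · C₁.Ψ m k 0 v)) ≈[ shift r + K ]
      ∏₂ N₁.N v · (q^ (m * sumBy C₁.weight v) · V₁.ordered J (k ∷ replicate n′ 0) v)
    Ψ-summand K r bound v eq tot = begin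
      Θ · (C₁.U v · (q^ W · C₁.Ψ m k 0 v))
        ≈⟨ truncate L (≈-trans (solve 4 (λ t u w s → t :* (u :* (w :* s)) := (t :* u) :* (w :* s)) ≈-refl Θ (C₁.U v) (q^ W) (C₁.Ψ m k 0 v)) (spread (Θ · C₁.U v))) ⟩
      splitSum v (λ pre p post → q^ (W + k * C₁.position p) · (C₁.outflow pre p post · (Θ · C₁.U v)))
        ≈⟨ splitSum-cong[] v (λ { pre p post refl → weaken (+-monoˡ-≤ K (subst (λ t → m * tri t + k * t ≤ m * sumBy C₁.weight (pre ++ p ∷ post) + k * C₁.position p) tot (shift-bound n 0<n k≤m pre p post eq)))
             (q^-·-cong[] (m * sumBy C₁.weight (pre ++ p ∷ post) + k * C₁.position p) (·-cong[] {f = C₁.outflow pre p post} ≈[]-refl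
               (L₁.Θ-U K (pre ++ p ∷ post) residues-near eq (subst₂ (λ l t → l * (K + K) ≤ t) (sym (length-interval 0 n)) (sym tot) bound)))) }) ⟩
      splitSum v (λ pre p post → q^ (W + k * C₁.position p) · (C₁.outflow pre p post · ∏₂ N₁.N v))
        -- `Ψ m k 0` is the first step of the sum over orderings for (k, 0, ..., 0); the later steps
        -- contribute 1.
        ≈⟨ truncate L (≈-trans (≈-sym (spread (∏₂ N₁.N v))) (·-congˡ (·-congˡ (≈-sym (splitSum-cong v λ pre p post eq′ →
             ·-congˡ (≈-trans (·-congˡ (V₁.ordered-zeros J J-three-term J-sum n′ (pre ++ post) (len pre eq′) (rest-AllPairs pre distinct eq′))) (·-identityʳ _))))))) ⟩
      ∏₂ N₁.N v · (q^ W · V₁.ordered J (k ∷ replicate n′ 0) v) ∎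
      where
      L = shift r + K
      open ≈[]-Reasoning L
      open Solver
      Θ = L₁.Θ residues
      W = m * sumBy C₁.weight v
      distinct = C₁.position-AllPairs (C₁.nearPairs residues-near {v} eq)
      len : ∀ pre {p post} → pre ++ p ∷ post ≡ v → length (pre ++ post) ≡ n′
      len pre eq′ = suc-injective (trans (sym (rest-length pre eq′)) (trans (sym (length-map proj₁ v)) (trans (cong length eq) (length-interval 0 n))))
      spread : ∀ g → g · (q^ W · C₁.Ψ m k 0 v) ≈ splitSum v (λ pre p post → q^ (W + k * C₁.position p) · (C₁.outflow pre p post · g))
      spread g = ≈-trans (splitSum-·· g (q^ W) _ v) (splitSum-cong′ v λ pre p post → ≈-trans
        (solve 4 (λ g w x o → g :* (w :* (x :* o)) := (w :* x) :* (o :* g)) ≈-refl g (q^ W) (q^ (k * C₁.position p)) (C₁.outflow pre p post))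
        (·-congʳ (≈-sym (q^-+ W _))))

  Ψ-limit : ∀ K r → n * (K + K) ≤ r → K ≤ r →
    infinite κ κ · (L₁.Θ residues · C₁.Ψ m k r (C₁.zeros residues)) ≈[ shift r + K ] q^ (shift r) · (infinite n n · L₂.Θ alternant)
  Ψ-limit K r bound K≤r = begin
    infinite κ κ · (Θ · C₁.Ψ m k r (C₁.zeros residues))
      ≈⟨ truncate L (·-congˡ (·-congˡ (≈-sym (≈-trans (C₁.compSum-Ψ m k residues residues-near r 0) (≡⇒≈ (cong (λ t → C₁.Ψ m k t (C₁.zeros residues)) (+-identityʳ r))))))) ⟩
    infinite κ κ · (Θ · (C₁.poch r · compSum residues r F))
      ≈⟨ truncate L (≈-trans (·-congˡ (solve 3 (λ t p c → t :* (p :* c) := p :* (t :* c)) ≈-refl Θ (C₁.poch r) (compSum residues r F)))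
           (·-congˡ (·-congˡ (≈-sym (compSum-· Θ F residues r))))) ⟩
    infinite κ κ · (C₁.poch r · compSum residues r (λ v → Θ · F v))
      ≈⟨ ·-cong[] {f = infinite κ κ} ≈[]-refl (·-cong[] {f = C₁.poch r} ≈[]-refl (compSum-cong[] residues r (Ψ-summand K r bound))) ⟩
    infinite κ κ · (C₁.poch r · sum₁ r)
      ≈⟨ truncate L (≈-trans (·-congˡ (·-congˡ (sum₁≈sum₂ r)))
           (solve 4 (λ i p s t → i :* (p :* (s :* t)) := s :* (p :* (i :* t))) ≈-refl (infinite κ κ) (C₁.poch r) (q^ (shift r)) (sum₂ r))) ⟩
    q^ (shift r) · (C₁.poch r · (infinite κ κ · sum₂ r))
      ≈⟨ q^-·-cong[] (shift r) (·-cong[] (L₁.poch-limit {r} K≤r) (sum₂-limit K r bound K≤r)) ⟩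
    q^ (shift r) · (infinite n n · L₂.Θ alternant) ∎
    where
    L = shift r + K
    open ≈[]-Reasoning L
    open Solver
    Θ = L₁.Θ residues
    F : List (ℕ × ℕ) → Series
    F v = C₁.U v · (q^ (m * sumBy C₁.weight v) · C₁.Ψ m k 0 v)

-- The symmetrizing sum over a finite alphabet

∑ : (A → Series) → List A → Series
∑ F []       = 𝟘
∑ F (x ∷ xs) = F x ⊞ ∑ F xs

∑-cong : ∀ {F G : A → Series} xs → (∀ x → F x ≈ G x) → ∑ F xs ≈ ∑ G xs
∑-cong []       h = ≈-refl
∑-cong (x ∷ xs) h = +-cong (h x) (∑-cong xs h)

∑-congAll : ∀ {P : A → Set} {F G : A → Series} {xs} → All P xs → (∀ x → P x → F x ≈ G x) → ∑ F xs ≈ ∑ G xs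
∑-congAll []         h = ≈-refl
∑-congAll (px ∷ pxs) h = +-cong (h _ px) (∑-congAll pxs h)

∑-⊞ : ∀ (F G : A → Series) xs → ∑ (λ x → F x ⊞ G x) xs ≈ ∑ F xs ⊞ ∑ G xs
∑-⊞ F G []       = ≈-sym (⊞-identityˡ 𝟘)
∑-⊞ F G (x ∷ xs) = ≈-trans (⊞-congˡ (∑-⊞ F G xs))
  (solve 4 (λ a b c d → (a :+ b) :+ (c :+ d) := (a :+ c) :+ (b :+ d)) ≈-refl (F x) (G x) (∑ F xs) (∑ G xs))
  where open Solver

∑-· : ∀ f (G : A → Series) xs → ∑ (λ x → f · G x) xs ≈ f · ∑ G xs
∑-· f G []       = ≈-sym (·-zeroʳ f)
∑-· f G (x ∷ xs) = ≈-trans (⊞-congˡ (∑-· f G xs)) (≈-sym (·-distribˡ f _ _))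

∑-++ : ∀ (F : A → Series) xs ys → ∑ F (xs ++ ys) ≈ ∑ F xs ⊞ ∑ F ys
∑-++ F []       ys = ≈-sym (⊞-identityˡ _)
∑-++ F (x ∷ xs) ys = ≈-trans (⊞-congˡ (∑-++ F xs ys)) (≈-sym (⊞-assoc _ _ _))

∑-map : ∀ (F : B → Series) (h : A → B) xs → ∑ F (map h xs) ≈ ∑ (F ∘ h) xs
∑-map F h []       = ≈-refl
∑-map F h (x ∷ xs) = ⊞-congˡ (∑-map F h xs)

∑-concatMap : ∀ (F : B → Series) (h : A → List B) xs → ∑ F (concatMap h xs) ≈ ∑ (λ x → ∑ F (h x)) xs
∑-concatMap F h []       = ≈-refl
∑-concatMap F h (x ∷ xs) = ≈-trans (∑-++ F (h x) (concatMap h xs)) (⊞-congˡ (∑-concatMap F h xs))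

series-∑ : ∀ (F : A → PS) xs → series (sumL (map F xs)) ≈ ∑ (series ∘ F) xs
series-∑ F []       = pw λ _ → refl
series-∑ F (x ∷ xs) = ≈-trans (pw λ _ → refl) (⊞-congˡ {series (F x)} (series-∑ F xs))

-- `perms` inserts the first entry everywhere, whereas the symmetrizing sum is taken apart from the
-- front of the ordering. In `later` the entry x goes behind another head, and the induction is
-- applied to the function `later` itself.
perms-split : ∀ (F : List ℕ → Series) x xs →
  ∑ F (perms (x ∷ xs)) ≈ splitSum (x ∷ xs) (λ pre p post → ∑ (F ∘ (p ∷_)) (perms (pre ++ post)))
perms-split F x xs = begin
  ∑ F (concatMap (inserts x) (perms xs))              ≈⟨ ∑-concatMap F (inserts x) (perms xs) ⟩
  ∑ (λ w → ∑ F (inserts x w)) (perms xs)              ≈⟨ ∑-cong (perms xs) front ⟩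
  ∑ (λ w → F (x ∷ w) ⊞ later w) (perms xs)            ≈⟨ ∑-⊞ _ later (perms xs) ⟩
  ∑ (F ∘ (x ∷_)) (perms xs) ⊞ ∑ later (perms xs)      ≈⟨ ⊞-congˡ (go xs) ⟩
  ∑ (F ∘ (x ∷_)) (perms xs) ⊞ splitSum xs (λ pre p post → ∑ (F ∘ (p ∷_)) (perms (x ∷ pre ++ post))) ∎
  where
  open ≈-Reasoning
  later : List ℕ → Series
  later []       = 𝟘
  later (y ∷ ys) = ∑ (F ∘ (y ∷_)) (inserts x ys)
  front : ∀ w → ∑ F (inserts x w) ≈ F (x ∷ w) ⊞ later w
  front []       = ≈-refl
  front (y ∷ ys) = ⊞-congˡ (∑-map F (y ∷_) (inserts x ys))
  go : ∀ xs → ∑ later (perms xs) ≈ splitSum xs (λ pre p post → ∑ (F ∘ (p ∷_)) (perms (x ∷ pre ++ post)))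
  go []       = ⊞-identityʳ 𝟘
  go (y ∷ ys) = ≈-trans (perms-split later y ys) (splitSum-cong′ (y ∷ ys) λ pre p post →
    ≈-sym (∑-concatMap (F ∘ (p ∷_)) (inserts x) (perms (pre ++ post))))

inserts-↭ : ∀ x w → All (_↭ x ∷ w) (inserts x w)
inserts-↭ x []       = ↭-refl ∷ []
inserts-↭ x (y ∷ ys) = ↭-refl ∷ Allᵖ.map⁺ (All.map (λ p → ↭-trans (prep y p) (swap y x ↭-refl)) (inserts-↭ x ys))

perms-↭ : ∀ xs → All (_↭ xs) (perms xs)
perms-↭ []       = ↭-refl ∷ []
perms-↭ (x ∷ xs) = go (perms-↭ xs)
  where
  go : ∀ {ws} → All (_↭ xs) ws → All (_↭ x ∷ xs) (concatMap (inserts x) ws)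
  go []                = []
  go {w ∷ ws} (p ∷ ps) = Allᵖ.++⁺ (All.map (λ r → ↭-trans r (prep x p)) (inserts-↭ x w)) (go ps)

splitSum-↭ : ∀ (H : A → List A → Series) → (∀ p {R R′} → R ↭ R′ → H p R ≈ H p R′) → ∀ {xs ys} → xs ↭ ys →
  splitSum xs (λ pre p post → H p (pre ++ post)) ≈ splitSum ys (λ pre p post → H p (pre ++ post))
splitSum-↭ H inv ↭.refl        = ≈-refl
splitSum-↭ H inv (prep x p)    = +-cong (inv x p) (splitSum-↭ (λ q R → H q (x ∷ R)) (λ q r → inv q (prep x r)) p)
splitSum-↭ H inv (swap {xs} {ys} x y p) = ≈-trans
  (solve 3 (λ a b c → a :+ (b :+ c) := b :+ (a :+ c)) ≈-refl (H x (y ∷ xs)) (H y (x ∷ xs)) (splitSum xs (λ pre q post → H q (x ∷ y ∷ pre ++ post))))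
  (+-cong (inv y (prep x p)) (+-cong (inv x (prep y p)) (≈-trans
    (splitSum-↭ (λ q R → H q (x ∷ y ∷ R)) (λ q r → inv q (prep x (prep y r))) p)
    (splitSum-cong′ ys λ pre q post → inv q (swap x y ↭-refl)))))
  where open Solver
splitSum-↭ H inv (↭.trans p r) = ≈-trans (splitSum-↭ H inv p) (splitSum-↭ H inv r)

∏-zero : ∀ (f : A → Series) {xs x} → x ∈ xs → f x ≈ 𝟘 → ∏ f xs ≈ 𝟘
∏-zero f (here refl)         h = ≈-trans (·-congʳ h) (·-zeroˡ _)
∏-zero f {y ∷ xs} (there x∈) h = ≈-trans (·-congˡ (∏-zero f x∈ h)) (·-zeroʳ (f y))

pow : Series → ℕ → Series
pow f zero    = 𝟙
pow f (suc e) = f · pow f e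

J-limit : ∀ {K p b} → p < b → p + K ≤ b → J p b ≈[ K ] 𝟙
J-limit {K} {p} {b} p<b p+K≤b = begin
  J p b                  ≈⟨ truncate K (·-identityˡ _) ⟨
  𝟙 · J p b              ≈⟨ ·-cong[] (om-one[] (subst (_≤ b ∸ p) (m+n∸m≡n p K) (∸-monoˡ-≤ p p+K≤b))) ≈[]-refl ⟨
  om (b ∸ p) · J p b     ≈⟨ truncate K (om-J (m<n⇒0<n∸m p<b) (sym (m+[n∸m]≡n (<⇒≤ p<b)))) ⟩
  𝟙                      ∎
  where open ≈[]-Reasoning K

module Alphabet (n : ℕ) (0<n : 0 < n) where
  open Chain n 0<n

  hl : ℕ → ℕ → Series
  hl p b = series (hlFactor n p b)

  -- Brings both cases of `hlFactor` into the form 1 - s · K of the partial fractions, with s = 1 -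
  -- t.
  hl-J : ∀ {p b} → p ≢ b → hl p b ≈ 𝟙 ⊟ om n · J b p
  hl-J {p} {b} p≢b with p <ᵇ b | <ᵇ⇒< p b | <⇒<ᵇ {p} {b}
  ... | true  | lt | _  = begin
    series ((onePS ⊖ mono (n + e)) ⊛ inv (onePS ⊖ mono e))    ≈⟨ pw (λ _ → refl) ⟩
    om (n + e) · i                                            ≈⟨ ·-congʳ (⊟-congˡ (q^-+ n e)) ⟩
    (𝟙 ⊟ q^ n · q^ e) · i                                     ≈⟨ solve 3 (λ t e i → (:1 :- t :* e) :* i := (:1 :- e) :* i :- (:1 :- t) :* (:- (e :* i))) ≈-refl (q^ n) (q^ e) i ⟩
    om e · i ⊟ om n · neg (q^ e · i)                          ≈⟨ ⊟-cong (inverse-right (om e) (om-unit (m<n⇒0<n∸m p<b))) (·-congˡ (≡⇒≈ (sym (J-≥ (<⇒≤ p<b))))) ⟩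
    𝟙 ⊟ om n · J b p                                          ∎
    where
    open ≈-Reasoning
    open Solver
    p<b = lt _
    e = b ∸ p
    i = inverse (om e)
  ... | false | _  | ge = begin
    series ((mono n ⊖ mono e) ⊛ inv (onePS ⊖ mono e))         ≈⟨ pw (λ _ → refl) ⟩
    (q^ n ⊟ q^ e) · i                                         ≈⟨ solve 3 (λ t e i → (t :- e) :* i := (:1 :- e) :* i :- (:1 :- t) :* i) ≈-refl (q^ n) (q^ e) i ⟩
    om e · i ⊟ om n · i                                       ≈⟨ ⊟-cong (inverse-right (om e) (om-unit (m<n⇒0<n∸m b<p))) (·-congˡ (≡⇒≈ (sym (J-< b<p)))) ⟩
    𝟙 ⊟ om n · J b p                                          ∎
    where
    open ≈-Reasoning
    open Solver
    b<p : b < p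
    b<p with <-cmp p b
    ... | tri< p<b _ _ = ⊥-elim (ge p<b)
    ... | tri≈ _ p≡b _ = contradiction p≡b p≢b
    ... | tri> _ _ b<p = b<p
    e = p ∸ b
    i = inverse (om e)

  hl-vanish : ∀ {p b} → n + b ≡ p → hl p b ≈ 𝟘
  hl-vanish {p} {b} refl = ≈-trans (hl-J (<⇒≢ (m<n+m b 0<n) ∘ sym)) (≈-trans (⊟-congˡ (om-J 0<n (+-comm n b)))
    (solve 0 (:1 :- :1 := :0) ≈-refl))
    where open Solver

  -- Since t x_b is x_(n+b), the factor (x_p - t x_b) / (x_p - x_b) is a quotient of two kernels, at
  -- b and at the next letter of its class.
  hl-telescope : ∀ {p b} → p ≢ b → p ≢ n + b → hl p b · J p (n + b) ≈ J p b
  hl-telescope {p} {b} p≢b p≢n+b = difference-cancel p≢b (difference-cancel p≢n+b (begin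
    (P ⊟ q^ (n + b)) · ((P ⊟ Y) · (hl p b · J p (n + b)))
      ≈⟨ ·-congˡ (·-congˡ (·-congʳ (hl-J p≢b))) ⟩
    (P ⊟ q^ (n + b)) · ((P ⊟ Y) · ((𝟙 ⊟ om n · J b p) · J p (n + b)))
      ≈⟨ solve 6 (λ P C Y t j k → (P :- C) :* ((P :- Y) :* ((:1 :- t :* j) :* k)) := ((P :- Y) :+ t :* ((Y :- P) :* j)) :* ((P :- C) :* k)) ≈-refl P (q^ (n + b)) Y (om n) (J b p) (J p (n + b)) ⟩
    ((P ⊟ Y) ⊞ om n · ((Y ⊟ P) · J b p)) · ((P ⊟ q^ (n + b)) · J p (n + b))
      ≈⟨ ·-cong (⊞-congˡ (·-congˡ (J-defining (p≢b ∘ sym)))) (J-defining p≢n+b) ⟩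
    ((P ⊟ Y) ⊞ om n · Y) · P
      ≈⟨ ·-congʳ (solve 3 (λ P Y t → (P :- Y) :+ (:1 :- t) :* Y := P :- t :* Y) ≈-refl P Y (q^ n)) ⟩
    (P ⊟ q^ n · Y) · P
      ≈⟨ ·-cong (⊟-congˡ (≈-sym (q^-+ n b))) (≈-sym (J-defining p≢b)) ⟩
    (P ⊟ q^ (n + b)) · ((P ⊟ Y) · J p b) ∎))
    where
    open ≈-Reasoning
    open Solver
    P = q^ p
    Y = q^ b

  -- The symmetrizing sum, with the first letter of the ordering singled out repeatedly.
  sym-sum : List ℕ → List ℕ → Series
  sym-sum []        xs = 𝟙
  sym-sum (l ∷ lam) xs = splitSum xs (λ pre p post → q^ (l * p) · (∏ (hl p) (pre ++ post) · sym-sum lam (pre ++ post)))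

  series-pairProd : ∀ p w → series (pairProd n (p ∷ w)) ≈ ∏ (hl p) w · series (pairProd n w)
  series-pairProd p w = ≈-trans (pw λ _ → refl) (·-congʳ {series (prodL (map (hlFactor n p) w))} (series-∏ (hlFactor n p) w))

  perms-sym-sum : ∀ lam xs → length lam ≡ length xs →
    ∑ (λ w → q^ (sumℕ (zipWith _*_ lam w)) · series (pairProd n w)) (perms xs) ≈ sym-sum lam xs
  perms-sym-sum []        []       _   = ≈-trans (⊞-identityʳ _) (≈-trans (·-cong q^-0 (pw λ _ → refl)) (·-identityˡ 𝟙))
  perms-sym-sum (l ∷ lam) (x ∷ xs) len = ≈-trans (perms-split _ x xs) (splitSum-cong (x ∷ xs) λ pre p post eq → begin
    ∑ (λ w → q^ (l * p + sumℕ (zipWith _*_ lam w)) · series (pairProd n (p ∷ w))) (perms (pre ++ post))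
      ≈⟨ ∑-congAll (perms-↭ (pre ++ post)) (λ w w↭ → ≈-trans
           (·-cong (q^-+ (l * p) _) (≈-trans (series-pairProd p w) (·-congʳ (∏-↭ (hl p) w↭))))
           (solve 4 (λ a b c d → (a :* b) :* (c :* d) := (a :* c) :* (b :* d)) ≈-refl (q^ (l * p)) (q^ (sumℕ (zipWith _*_ lam w))) (∏ (hl p) (pre ++ post)) (series (pairProd n w)))) ⟩
    ∑ (λ w → (q^ (l * p) · ∏ (hl p) (pre ++ post)) · (q^ (sumℕ (zipWith _*_ lam w)) · series (pairProd n w))) (perms (pre ++ post))
      ≈⟨ ∑-· _ _ (perms (pre ++ post)) ⟩
    (q^ (l * p) · ∏ (hl p) (pre ++ post)) · ∑ (λ w → q^ (sumℕ (zipWith _*_ lam w)) · series (pairProd n w)) (perms (pre ++ post))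
      ≈⟨ ≈-trans (·-congˡ (perms-sym-sum lam (pre ++ post) (suc-injective (trans len (rest-length pre eq))))) (·-assoc _ _ _) ⟩
    q^ (l * p) · (∏ (hl p) (pre ++ post) · sym-sum lam (pre ++ post)) ∎)
    where
    open ≈-Reasoning
    open Solver

  Distinct : List ℕ → Set
  Distinct = AllPairs _≢_

  private
    hl-products : ∀ {xs} → Distinct xs → splitSum xs (λ pre p post → om n · ∏ (hl p) (pre ++ post)) ≈ om (n * length xs)
    hl-products {xs} ds = begin
      splitSum xs (λ pre p post → om n · ∏ (hl p) (pre ++ post))
        ≈⟨ splitSum-cong xs (λ pre p post eq → let (l , r) = split-AllPairs pre ds eq in
             ·-congˡ (∏-congAll (Allᵖ.++⁺ (All.map (λ b≢p → b≢p ∘ sym) l) r) λ b p≢b → hl-J p≢b)) ⟩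
      S                    ≈⟨ solve 1 (λ s → s := :1 :- (:1 :- s)) ≈-refl S ⟩
      𝟙 ⊟ (𝟙 ⊟ S)          ≈⟨ ⊟-congˡ (unit-expansion J J-three-term J-sum id (λ _ → om n) xs ds) ⟨
      𝟙 ⊟ ∏ (λ _ → 𝟙 ⊟ om n) xs
        ≈⟨ ⊟-congˡ (≈-trans (∏-cong xs λ _ → solve 1 (λ t → :1 :- (:1 :- t) := t) ≈-refl (q^ n)) (≈-trans (q^-Multiplicative.∏-χ (λ _ → n) xs)
             (≡⇒≈ (cong q^ (trans (sumBy-const n xs) (*-comm (length xs) n)))))) ⟩
      om (n * length xs)   ∎
      where
      open ≈-Reasoning
      open Solver
      S = splitSum xs (λ pre p post → om n · ∏ (λ b → 𝟙 ⊟ om n · J b p) (pre ++ post))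

  -- The classical evaluation of the symmetrizing sum for the empty partition. Removing the first
  -- letter of the ordering gives the factor 1 - t^s by `hl-products`.
  sym-sum-zeros : ∀ s xs → length xs ≡ s → Distinct xs → pow (om n) s · sym-sum (replicate s 0) xs ≈ poch s
  sym-sum-zeros zero    xs _   _  = ·-identityˡ 𝟙
  sym-sum-zeros (suc s) xs len ds = begin
    (om n · pow (om n) s) · splitSum xs (λ pre p post → q^ 0 · (∏ (hl p) (pre ++ post) · sym-sum (replicate s 0) (pre ++ post)))
      ≈⟨ splitSum-· _ _ xs ⟨
    splitSum xs (λ pre p post → (om n · pow (om n) s) · (q^ 0 · (∏ (hl p) (pre ++ post) · sym-sum (replicate s 0) (pre ++ post))))
      ≈⟨ splitSum-cong xs (λ pre p post eq → ≈-trans (·-congˡ (≈-trans (·-congʳ q^-0) (·-identityˡ _))) (≈-trans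
           (solve 4 (λ a b c d → (a :* b) :* (c :* d) := (b :* d) :* (a :* c)) ≈-refl (om n) (pow (om n) s) (∏ (hl p) (pre ++ post)) (sym-sum (replicate s 0) (pre ++ post)))
           (·-congʳ (sym-sum-zeros s (pre ++ post) (suc-injective (trans (sym (rest-length pre eq)) len)) (rest-AllPairs pre ds eq))))) ⟩
    splitSum xs (λ pre p post → poch s · (om n · ∏ (hl p) (pre ++ post)))
      ≈⟨ ≈-trans (splitSum-· (poch s) _ xs) (·-congˡ (hl-products ds)) ⟩
    poch s · om (n * length xs)
      ≡⟨ cong (λ l → poch s · om (n * l)) len ⟩
    poch s · om (n * suc s)
      ≈⟨ ·-comm _ _ ⟩
    poch (suc s) ∎
    where
    open ≈-Reasoning
    open Solver

  module _ (m k : ℕ) where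

    -- The counterpart of `Ψ` for a finite alphabet. Each chosen letter gets its own factor 1 - t,
    -- which will cancel the 1 / (1 - t) produced by the other letters of its class.
    ΨN : ℕ → List ℕ → Series
    ΨN zero    xs = splitSum xs (λ pre p post → q^ (k * p) · (om n · ∏ (hl p) (pre ++ post)))
    ΨN (suc r) xs = splitSum xs (λ pre p post → q^ (m * p) · ((om n · ∏ (hl p) (pre ++ post)) · ΨN r (pre ++ post)))

    sym-sum-ΨN : ∀ r s xs → length xs ≡ suc r + s → Distinct xs →
      pow (om n) (length xs) · sym-sum (replicate r m ++ k ∷ replicate s 0) xs ≈ ΨN r xs · poch s
    sym-sum-ΨN zero s xs len ds rewrite len = begin
      (om n · pow (om n) s) · splitSum xs _
        ≈⟨ ≈-trans (≈-sym (splitSum-· _ _ xs)) (splitSum-cong xs λ pre p post eq → begin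
             (om n · pow (om n) s) · (q^ (k * p) · (∏ (hl p) (pre ++ post) · sym-sum (replicate s 0) (pre ++ post)))
               ≈⟨ solve 5 (λ o w x h y → (o :* w) :* (x :* (h :* y)) := (w :* y) :* (x :* (o :* h))) ≈-refl (om n) (pow (om n) s) (q^ (k * p)) (∏ (hl p) (pre ++ post)) (sym-sum (replicate s 0) (pre ++ post)) ⟩
             (pow (om n) s · sym-sum (replicate s 0) (pre ++ post)) · (q^ (k * p) · (om n · ∏ (hl p) (pre ++ post)))
               ≈⟨ ·-congʳ (sym-sum-zeros s (pre ++ post) (suc-injective (trans (sym (rest-length pre eq)) len)) (rest-AllPairs pre ds eq)) ⟩
             poch s · (q^ (k * p) · (om n · ∏ (hl p) (pre ++ post))) ∎) ⟩
      splitSum xs (λ pre p post → poch s · (q^ (k * p) · (om n · ∏ (hl p) (pre ++ post))))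
        ≈⟨ ≈-trans (splitSum-· (poch s) _ xs) (·-comm _ _) ⟩
      ΨN 0 xs · poch s ∎
      where
      open ≈-Reasoning
      open Solver
    sym-sum-ΨN (suc r) s xs len ds = begin
      pow (om n) (length xs) · splitSum xs _
        ≈⟨ ≈-trans (≈-sym (splitSum-· _ _ xs)) (splitSum-cong xs λ pre p post eq → begin
             pow (om n) (length xs) · (q^ (m * p) · (∏ (hl p) (pre ++ post) · sym-sum lam (pre ++ post)))
               ≡⟨ cong (λ l → pow (om n) l · (q^ (m * p) · (∏ (hl p) (pre ++ post) · sym-sum lam (pre ++ post)))) (rest-length pre eq) ⟩
             (om n · pow (om n) (length (pre ++ post))) · (q^ (m * p) · (∏ (hl p) (pre ++ post) · sym-sum lam (pre ++ post)))
               ≈⟨ solve 5 (λ o w x h y → (o :* w) :* (x :* (h :* y)) := x :* ((o :* h) :* (w :* y))) ≈-refl (om n) (pow (om n) (length (pre ++ post))) (q^ (m * p)) (∏ (hl p) (pre ++ post)) (sym-sum lam (pre ++ post)) ⟩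
             q^ (m * p) · ((om n · ∏ (hl p) (pre ++ post)) · (pow (om n) (length (pre ++ post)) · sym-sum lam (pre ++ post)))
               ≈⟨ ·-congˡ (·-congˡ (sym-sum-ΨN r s (pre ++ post) (suc-injective (trans (sym (rest-length pre eq)) len)) (rest-AllPairs pre ds eq))) ⟩
             q^ (m * p) · ((om n · ∏ (hl p) (pre ++ post)) · (ΨN r (pre ++ post) · poch s))
               ≈⟨ solve 4 (λ x y z w → x :* (y :* (z :* w)) := w :* (x :* (y :* z))) ≈-refl (q^ (m * p)) (om n · ∏ (hl p) (pre ++ post)) (ΨN r (pre ++ post)) (poch s) ⟩
             poch s · (q^ (m * p) · ((om n · ∏ (hl p) (pre ++ post)) · ΨN r (pre ++ post))) ∎) ⟩
      splitSum xs (λ pre p post → poch s · (q^ (m * p) · ((om n · ∏ (hl p) (pre ++ post)) · ΨN r (pre ++ post))))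
        ≈⟨ ≈-trans (splitSum-· (poch s) _ xs) (·-comm _ _) ⟩
      ΨN (suc r) xs · poch s ∎
      where
      open ≈-Reasoning
      open Solver
      lam = replicate r m ++ k ∷ replicate s 0

    ΨN-↭ : ∀ r {xs ys} → xs ↭ ys → ΨN r xs ≈ ΨN r ys
    ΨN-↭ zero    = splitSum-↭ (λ p R → q^ (k * p) · (om n · ∏ (hl p) R)) (λ p r → ·-congˡ (·-congˡ (∏-↭ (hl p) r)))
    ΨN-↭ (suc r) = splitSum-↭ (λ p R → q^ (m * p) · ((om n · ∏ (hl p) R) · ΨN r R)) (λ p e → ·-congˡ (·-cong (·-congˡ (∏-↭ (hl p) e)) (ΨN-↭ r e)))

-- Residue classes of letters

-- Only the first remaining letter of each residue class can be removed next, since hl p b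
-- vanishes when b + n = p and b comes later.
module Letters (n : ℕ) (0<n : 0 < n) (L : ℕ → ℕ) where
  open Chain n 0<n
  open Alphabet n 0<n

  run : ℕ → ℕ → List ℕ
  run a zero    = []
  run a (suc l) = a ∷ run (n + a) l

  remaining : ℕ × ℕ → List ℕ
  remaining (y , c) = run (position (y , c)) (L y ∸ c)

  letters : List (ℕ × ℕ) → List ℕ
  letters []      = []
  letters (p ∷ v) = remaining p ++ letters v

  private
    remaining-raise : ∀ q → proj₂ q < L (proj₁ q) → remaining q ≡ position q ∷ remaining (raise q)
    remaining-raise q@(y , c) c<L = trans (cong (run (position q)) length≡) (cong (λ a → position q ∷ run a (L y ∸ suc c)) (sym (position-raise q)))
      where
      length≡ : L y ∸ c ≡ suc (L y ∸ suc c)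
      length≡ = +-∸-assoc 1 c<L

    run-vanish : ∀ (G : List ℕ → ℕ → List ℕ → Series) a l →
      (∀ pre p post b → b ∈ pre → n + b ≡ p → G pre p post ≈ 𝟘) → (∀ post → G [] (n + a) post ≈ 𝟘) →
      splitSum (run (n + a) l) G ≈ 𝟘
    run-vanish G a zero    h h₀ = ≈-refl
    run-vanish G a (suc l) h h₀ = ≈-trans (+-cong (h₀ _) (run-vanish (G ∘ ((n + a) ∷_)) (n + a) l
      (λ pre p post b b∈ → h _ p post b (there b∈)) (λ post → h _ _ post (n + a) (here refl) refl))) (⊞-identityˡ 𝟘)

  splitSum-letters : ∀ (H : ℕ → List ℕ → Series) → (∀ p b R → b ∈ R → n + b ≡ p → H p R ≈ 𝟘) →
    ∀ v → All (λ q → proj₂ q < L (proj₁ q)) v →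
    splitSum (letters v) (λ pre p post → H p (pre ++ post)) ≈ splitSum v (λ pre q post → H (position q) (letters (pre ++ raise q ∷ post)))
  splitSum-letters H vanish []      _          = ≈-refl
  splitSum-letters H vanish (q ∷ v) (c<L ∷ cs) = begin
    splitSum (remaining q ++ letters v) (λ pre p post → H p (pre ++ post))
      ≈⟨ splitSum-++ _ (remaining q) (letters v) ⟩
    splitSum (remaining q) (λ pre p post → H p (pre ++ post ++ letters v)) ⊞ splitSum (letters v) (λ pre p post → H p ((remaining q ++ pre) ++ post))
      ≈⟨ +-cong head-term (≈-trans
           (splitSum-cong′ (letters v) λ pre p post → ≡⇒≈ (cong (H p) (++-assoc (remaining q) pre post)))
           (splitSum-letters (λ p R → H p (remaining q ++ R)) (λ p b R b∈R → vanish p b _ (∈-++⁺ʳ (remaining q) b∈R)) v cs)) ⟩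
    H (position q) (letters (raise q ∷ v)) ⊞ splitSum v (λ pre q′ post → H (position q′) (letters ((q ∷ pre) ++ raise q′ ∷ post))) ∎
    where
    open ≈-Reasoning
    head-term : splitSum (remaining q) (λ pre p post → H p (pre ++ post ++ letters v)) ≈ H (position q) (letters (raise q ∷ v))
    head-term = begin
      splitSum (remaining q) (λ pre p post → H p (pre ++ post ++ letters v))
        ≡⟨ cong (λ xs → splitSum xs (λ pre p post → H p (pre ++ post ++ letters v))) (trans (remaining-raise q c<L) (cong (λ a → position q ∷ run a l) (position-raise q))) ⟩
      H (position q) (run (n + position q) l ++ letters v) ⊞ splitSum (run (n + position q) l) (λ pre p post → H p (position q ∷ pre ++ post ++ letters v))
        ≈⟨ ⊞-congˡ (run-vanish _ (position q) l (λ pre p post b b∈ → vanish p b _ (there (∈-++⁺ˡ b∈))) (λ post → vanish _ (position q) _ (here refl) refl)) ⟩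
      H (position q) (run (n + position q) l ++ letters v) ⊞ 𝟘
        ≈⟨ ⊞-identityʳ _ ⟩
      H (position q) (run (n + position q) l ++ letters v)
        ≡⟨ cong (λ a → H (position q) (run a l ++ letters v)) (position-raise q) ⟨
      H (position q) (letters (raise q ∷ v)) ∎
      where l = L (proj₁ q) ∸ suc (proj₂ q)

  private
    run-telescope : ∀ P y c l → (∀ j → P ≢ position (y , c + j)) →
      ∏ (hl P) (run (position (y , c)) l) · J P (position (y , c + l)) ≈ J P (position (y , c))
    run-telescope P y c zero    _ = ≈-trans (·-identityˡ _) (≡⇒≈ (cong (λ c → J P (position (y , c))) (+-identityʳ c)))
    run-telescope P y c (suc l) P≢ = begin
      (hl P a · ∏ (hl P) (run (n + a) l)) · J P (position (y , c + suc l))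
        ≡⟨ cong₂ (λ a′ c′ → (hl P a · ∏ (hl P) (run a′ l)) · J P (position (y , c′))) (sym (position-raise (y , c))) (+-suc c l) ⟩
      (hl P a · ∏ (hl P) (run (position (y , suc c)) l)) · J P (position (y , suc c + l))
        ≈⟨ ≈-trans (·-assoc _ _ _) (·-congˡ (run-telescope P y (suc c) l λ j → subst (λ c → P ≢ position (y , c)) (+-suc c j) (P≢ (suc j)))) ⟩
      hl P a · J P (position (y , suc c))
        ≡⟨ cong (λ b → hl P a · J P b) (position-raise (y , c)) ⟩
      hl P a · J P (n + a)
        ≈⟨ hl-telescope (subst (λ c → P ≢ position (y , c)) (+-identityʳ c) (P≢ 0))
             (subst (P ≢_) (trans (cong (λ c → position (y , c)) (+-comm c 1)) (position-raise (y , c))) (P≢ 1)) ⟩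
      J P a ∎
      where
      open ≈-Reasoning
      a = position (y , c)

    position-< : ∀ y c j → position (y , c) < position (y , suc c + j)
    position-< y c j = subst (position (y , c) <_) (sym (position-raise (y , c + j)))
      (≤-<-trans (+-monoʳ-≤ y (*-monoʳ-≤ n (m≤m+n c j))) (m<n+m _ 0<n))

  module _ (K : ℕ) where

    -- The class extends at least K beyond P, so the last kernel of a telescoped product is 1 modulo
    -- q^K.
    End : ℕ → ℕ × ℕ → Set
    End P (y , c) = c ≤ L y × P < position (y , L y) × P + K ≤ position (y , L y)

    private
      remaining-limit : ∀ P b → End P b → (∀ j → P ≢ position (proj₁ b , proj₂ b + j)) →
        ∏ (hl P) (remaining b) ≈[ K ] J P (position b)
      remaining-limit P (y , c) (c≤L , P<end , P+K≤end) P≢ = begin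
        ∏ (hl P) (remaining (y , c))                                     ≈⟨ truncate K (·-identityʳ _) ⟨
        ∏ (hl P) (remaining (y , c)) · 𝟙                                 ≈⟨ ·-cong[] {f = ∏ (hl P) (remaining (y , c))} ≈[]-refl (J-limit P<end P+K≤end) ⟨
        ∏ (hl P) (remaining (y , c)) · J P (position (y , L y))          ≡⟨ cong (λ e → ∏ (hl P) (remaining (y , c)) · J P (position (y , e))) (m+[n∸m]≡n c≤L) ⟨
        ∏ (hl P) (remaining (y , c)) · J P (position (y , c + (L y ∸ c))) ≈⟨ truncate K (run-telescope P y c (L y ∸ c) P≢) ⟩
        J P (position (y , c))                                           ∎
        where open ≈[]-Reasoning K

      ∏-letters : ∀ f v → ∏ f (letters v) ≈ ∏ (∏ f ∘ remaining) v
      ∏-letters f []      = ≈-refl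
      ∏-letters f (p ∷ v) = ≈-trans (∏-++ f (remaining p) (letters v)) (·-congˡ (∏-letters f v))

    -- Within the class of q the product telescopes to 1 / (1 - q^n), which `om n` removes; in every
    -- other class it telescopes to the kernel in `outflow`.
    step-limit : ∀ pre q post → All (λ b → Near (proj₁ q) (proj₁ b)) (pre ++ post) →
      End (position q) (raise q) → All (End (position q)) (pre ++ post) →
      om n · ∏ (hl (position q)) (letters (pre ++ raise q ∷ post)) ≈[ K ] outflow pre q post
    step-limit pre q@(y , c) post near end ends = begin
      om n · ∏ (hl P) (letters (pre ++ raise q ∷ post))
        ≈⟨ truncate K (·-congˡ (≈-trans (∏-letters (hl P) (pre ++ raise q ∷ post)) (∏-middle _ pre (raise q) post))) ⟩
      om n · (∏ (hl P) (remaining (raise q)) · ∏ (∏ (hl P) ∘ remaining) (pre ++ post))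
        ≈⟨ ·-cong[] {f = om n} ≈[]-refl (·-cong[] (remaining-limit P (raise q) end (λ j → <⇒≢ (position-< y c j)))
             (∏-cong[] (All.zip (near , ends)) λ b (nb , eb) → remaining-limit P b eb (λ j → position-≢ {q} {proj₁ b , proj₂ b + j} nb))) ⟩
      om n · (J P (position (raise q)) · outflow pre q post)
        ≈⟨ truncate K (≈-trans (≈-sym (·-assoc _ _ _)) (≈-trans (·-congʳ (om-J 0<n (trans (position-raise q) (+-comm n P)))) (·-identityˡ _))) ⟩
      outflow pre q post ∎
      where
      open ≈[]-Reasoning K
      P = position q

    module _ (m k r₀ : ℕ) (long : ∀ y → suc r₀ + K ≤ L y) where

      -- The multiplicities never exceed r₀ while `r` further raises are to come, so `long` keeps
      -- the end of every class out of reach.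
      Bounded : ℕ → ℕ × ℕ → Set
      Bounded r (y , c) = y < n × c + r ≤ r₀

      private
        bounded-end : ∀ {q b r} → Bounded r q → Bounded r b → End (position q) b
        bounded-end {y , c} {z , d} {r} (y<n , c≤) (_ , d≤) =
          ≤-trans (≤-trans (m≤m+n d r) (≤-trans d≤ (n≤1+n r₀))) (≤-trans (m≤m+n (suc r₀) K) (long z)) ,
          <-≤-trans inside (≤-trans (*-monoʳ-≤ n (≤-trans (m≤m+n (suc r₀) K) (long z))) (m≤n+m _ z)) ,
          ≤-trans (+-mono-≤ (<⇒≤ inside) (m≤n*m K n ⦃ >-nonZero 0<n ⦄)) (≤-trans (≤-reflexive (sym (*-distribˡ-+ n (suc r₀) K))) (≤-trans (*-monoʳ-≤ n (long z)) (m≤n+m _ z)))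
          where
          inside : y + n * c < n * suc r₀
          inside = <-≤-trans (+-monoˡ-< (n * c) y<n) (≤-trans (≤-reflexive (sym (*-suc n c))) (*-monoʳ-≤ n (s≤s (≤-trans (m≤m+n c r) c≤))))

        bounded-raise-end : ∀ {q r} → Bounded r q → End (position q) (raise q)
        bounded-raise-end {q@(y , c)} {r} b = ≤-trans (s≤s (≤-trans (m≤m+n c r) (proj₂ b))) (≤-trans (m≤m+n (suc r₀) K) (long y)) , proj₂ (bounded-end {q} {q} b b)

        bounded-weaken : ∀ {q r} → Bounded (suc r) q → Bounded r q
        bounded-weaken {y , c} (y<n , c≤) = y<n , ≤-trans (+-monoʳ-≤ c (n≤1+n _)) c≤

        bounded-short : ∀ {q r} → Bounded r q → proj₂ q < L (proj₁ q)
        bounded-short {y , c} {r} b = proj₁ (bounded-raise-end {y , c} {r} b)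

        bounded-step : ∀ {r v} pre {q post} → All (Bounded (suc r)) v → pre ++ q ∷ post ≡ v → All (Bounded r) (pre ++ raise q ∷ post)
        bounded-step []        {q} ((y<n , c≤) ∷ bs) refl = (y<n , subst (_≤ r₀) (+-suc (proj₂ q) _) c≤) ∷ All.map (λ {q} → bounded-weaken {q}) bs
        bounded-step (x ∷ pre) (b ∷ bs) refl = bounded-weaken {x} b ∷ bounded-step pre bs refl

        hl-product-vanish : ∀ p b R → b ∈ R → n + b ≡ p → om n · ∏ (hl p) R ≈ 𝟘
        hl-product-vanish p b R b∈R eq = ≈-trans (·-congˡ (∏-zero (hl p) b∈R (hl-vanish eq))) (·-zeroʳ _)

      ΨN-letters : ∀ r v → NearPairs v → All (Bounded r) v → ΨN m k r (letters v) ≈[ K ] Ψ m k r v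
      ΨN-letters zero v near bs = ≈[]-trans
        (truncate K (splitSum-letters (λ p R → q^ (k * p) · (om n · ∏ (hl p) R))
          (λ p b R b∈R eq → ≈-trans (·-congˡ (hl-product-vanish p b R b∈R eq)) (·-zeroʳ _)) v (All.map (λ {q} → bounded-short {q}) bs)))
        (splitSum-cong[] v λ pre q post eq → ·-cong[] {f = q^ (k * position q)} ≈[]-refl
          (step-limit pre q post (near-rest pre near eq) (bounded-raise-end {q} (split-All pre bs eq)) (All.map (λ {b} → bounded-end {q} {b} (split-All pre bs eq)) (rest-All pre bs eq))))
      ΨN-letters (suc r) v near bs = ≈[]-trans
        (truncate K (splitSum-letters (λ p R → q^ (m * p) · ((om n · ∏ (hl p) R) · ΨN m k r R))
          (λ p b R b∈R eq → ≈-trans (·-congˡ (≈-trans (·-congʳ (hl-product-vanish p b R b∈R eq)) (·-zeroˡ _))) (·-zeroʳ _)) v (All.map (λ {q} → bounded-short {q}) bs)))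
        (splitSum-cong[] v λ pre q post eq → ·-cong[] {f = q^ (m * position q)} ≈[]-refl (·-cong[]
          (step-limit pre q post (near-rest pre near eq) (bounded-raise-end {q} (split-All pre bs eq)) (All.map (λ {b} → bounded-end {q} {b} (split-All pre bs eq)) (rest-All pre bs eq)))
          (ΨN-letters r (pre ++ raise q ∷ post) (AllPairsᵖ.map⁻ (subst (AllPairs Near) (trans (cong (map proj₁) (sym eq)) (sym (labels-raise pre q post))) (AllPairsᵖ.map⁺ near))) (bounded-step pre bs eq))))

-- Sorting an initial segment of the natural numbers into residue classes

interval-++ : ∀ l s t → interval l (s + t) ≡ interval l s ++ interval (l + s) t
interval-++ l zero    t = cong (λ l → interval l t) (sym (+-identityʳ l))
interval-++ l (suc s) t = cong (l ∷_) (trans (interval-++ (suc l) s t) (cong (λ e → interval (suc l) s ++ interval e t) (sym (+-suc l s))))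

interval-map : ∀ s l t → interval (s + l) t ≡ map (s +_) (interval l t)
interval-map s l zero    = refl
interval-map s l (suc t) = cong (s + l ∷_) (trans (cong (λ e → interval e t) (sym (+-suc s l))) (interval-map s (suc l) t))

upTo-interval : ∀ N → upTo N ≡ interval 0 N
upTo-interval N = go id 0 N (λ _ → refl)
  where
  go : ∀ (f : ℕ → ℕ) l N → (∀ i → f i ≡ l + i) → applyUpTo f N ≡ interval l N
  go f l zero    h = refl
  go f l (suc N) h = cong₂ _∷_ (trans (h 0) (+-identityʳ l)) (go (f ∘ suc) (suc l) N (λ i → trans (h (suc i)) (+-suc l i)))

map-++-concatMap : ∀ (h : A → B) (t : A → List B) xs → map h xs ++ concatMap t xs ↭ concatMap (λ x → h x ∷ t x) xs
map-++-concatMap h t []       = ↭-refl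
map-++-concatMap h t (x ∷ xs) = prep (h x) (↭-trans (↭-sym (↭-trans
    (↭ᵖ.++⁺ˡ (t x) (↭-sym (map-++-concatMap h t xs))) (↭-trans (↭.↭-reflexive (sym (++-assoc (t x) (map h xs) (concatMap t xs))))
    (↭-trans (↭ᵖ.++⁺ʳ (concatMap t xs) (↭ᵖ.++-comm (t x) (map h xs))) (↭.↭-reflexive (++-assoc (map h xs) (t x) (concatMap t xs)))))))
  ↭-refl)

module Residues (n : ℕ) (0<n : 0 < n) (ρ : ℕ) (ρ≤n : ρ ≤ n) where

  -- An alphabet of Q n + ρ letters has one letter more in each of the first ρ classes.
  extra : ℕ → ℕ
  extra y = if y <ᵇ ρ then 1 else 0

  module _ (Q : ℕ) where
    open Letters n 0<n (λ y → Q + extra y) public using (run; letters; remaining)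

  private
    run′ = Letters.run n 0<n (λ y → 0)

    base : ∀ s l t → l + t ≡ n → interval (s + l) (ρ ∸ l) ≡ concatMap (λ y → run′ (s + y) (extra y)) (interval l t)
    base s l zero    eq = cong (interval (s + l)) (m≤n⇒m∸n≡0 (subst (ρ ≤_) (trans (sym eq) (+-identityʳ l)) ρ≤n))
    base s l (suc t) eq with l <ᵇ ρ | <ᵇ⇒< l ρ | <⇒<ᵇ {l} {ρ}
    ... | true  | lt | _  = trans (cong (interval (s + l)) (+-∸-assoc 1 (lt _)))
      (cong (s + l ∷_) (trans (cong (λ e → interval e (ρ ∸ suc l)) (sym (+-suc s l))) (base s (suc l) t (trans (sym (+-suc l t)) eq))))
    ... | false | _  | ge = trans (cong (interval (s + l)) (trans (m≤n⇒m∸n≡0 ρ≤l) (sym (m≤n⇒m∸n≡0 (m≤n⇒m≤1+n ρ≤l)))))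
      (trans (interval-0 (m≤n⇒m∸n≡0 (m≤n⇒m≤1+n ρ≤l))) (base s (suc l) t (trans (sym (+-suc l t)) eq)))
      where
      ρ≤l : ρ ≤ l
      ρ≤l = ≮⇒≥ ge
      interval-0 : ∀ {e a b} → e ≡ 0 → interval a e ≡ interval b e
      interval-0 refl = refl

    -- The first n letters head the n classes, and the remaining letters form the same arrangement
    -- moved up by n.
    runs : ∀ Q s → interval s (Q * n + ρ) ↭ concatMap (λ y → run′ (s + y) (Q + extra y)) (interval 0 n)
    runs zero    s = ↭.↭-reflexive (trans (cong (λ e → interval e ρ) (sym (+-identityʳ s))) (base s 0 n refl))
    runs (suc Q) s = ↭-trans
      (↭.↭-reflexive (trans (cong (interval s) (+-assoc n (Q * n) ρ)) (trans (interval-++ s n (Q * n + ρ))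
        (cong₂ _++_ (trans (cong (λ e → interval e n) (sym (+-identityʳ s))) (interval-map s 0 n)) (cong (λ e → interval e (Q * n + ρ)) (+-comm s n))))))
      (↭-trans (↭ᵖ.++⁺ˡ (map (s +_) (interval 0 n)) (↭-trans (runs Q (n + s)) (↭.↭-reflexive (cong-concat (interval 0 n)))))
        (map-++-concatMap (s +_) (λ y → run′ (n + (s + y)) (Q + extra y)) (interval 0 n)))
      where
      cong-concat : ∀ ys → concatMap (λ y → run′ (n + s + y) (Q + extra y)) ys ≡ concatMap (λ y → run′ (n + (s + y)) (Q + extra y)) ys
      cong-concat []       = refl
      cong-concat (y ∷ ys) = cong₂ _++_ (cong (λ a → run′ a (Q + extra y)) (+-assoc n s y)) (cong-concat ys)

  upTo-letters : ∀ Q → upTo (Q * n + ρ) ↭ letters Q (map (_, 0) (interval 0 n))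
  upTo-letters Q = ↭-trans (↭.↭-reflexive (upTo-interval _)) (↭-trans (runs Q 0) (↭.↭-reflexive (go (interval 0 n))))
    where
    run-≡ : ∀ a l → run′ a l ≡ run Q a l
    run-≡ a zero    = refl
    run-≡ a (suc l) = cong (a ∷_) (run-≡ (n + a) l)
    go : ∀ ys → concatMap (λ y → run′ (0 + y) (Q + extra y)) ys ≡ letters Q (map (_, 0) ys)
    go []       = refl
    go (y ∷ ys) = cong₂ _++_ (trans (run-≡ y (Q + extra y)) (cong (λ a → run Q a (Q + extra y)) (sym (trans (cong (y +_) (*-zeroʳ n)) (+-identityʳ y))))) (go ys)

-- Products of theta functions

eventually : ∀ {f g} → (∀ K → f ≈[ K ] g) → f ≈ g
eventually h .at d = below (h (suc d)) d ≤-refl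

∏-const : ∀ f (xs : List A) → ∏ (λ _ → f) xs ≈ pow f (length xs)
∏-const f []       = ≈-refl
∏-const f (x ∷ xs) = ·-congˡ (∏-const f xs)

pow-· : ∀ f g e → pow (f · g) e ≈ pow f e · pow g e
pow-· f g zero    = ≈-sym (·-identityˡ 𝟙)
pow-· f g (suc e) = ≈-trans (·-congˡ (pow-· f g e))
  (solve 4 (λ a b c d → (a :* b) :* (c :* d) := (a :* c) :* (b :* d)) ≈-refl f g (pow f e) (pow g e))
  where open Solver

pow-cong : ∀ {f g} e → f ≈ g → pow f e ≈ pow g e
pow-cong zero    h = ≈-refl
pow-cong (suc e) h = ·-cong h (pow-cong e h)

-- The classes 1, …, n modulo n exhaust the positive integers.
infinite-classes : ∀ n → 0 < n → ∏ (λ ρ → infinite ρ n) (interval 1 n) ≈ infinite 1 1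
infinite-classes n 0<n = eventually λ K → ≈[]-trans
  (∏-cong[] (interval-bounds 1 n) λ ρ _ → ≈[]-sym (pochFin-limit ρ 0<n ≤-refl))
  (≈[]-trans (truncate K (finite K)) (pochFin-limit 1 {1} (s≤s z≤n) (m≤n*m K n ⦃ >-nonZero 0<n ⦄)))
  where
  open ≈-Reasoning
  fin : ℕ → ℕ → ℕ → Series
  fin ρ M c = series (pochFin ρ M c)
  extend : ∀ l x s → fin 1 1 (l + x) · ∏ (λ ρ → om (ρ + x)) (interval (suc l) s) ≈ fin 1 1 (l + s + x)
  extend l x zero    = ≈-trans (·-identityʳ _) (≡⇒≈ (cong (λ e → fin 1 1 (e + x)) (sym (+-identityʳ l))))
  extend l x (suc s) = begin
    fin 1 1 (l + x) · (om (suc l + x) · ∏ (λ ρ → om (ρ + x)) (interval (2 + l) s))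
      ≈⟨ ·-assoc _ _ _ ⟨
    (fin 1 1 (l + x) · om (suc l + x)) · ∏ (λ ρ → om (ρ + x)) (interval (2 + l) s)
      ≈⟨ ·-congʳ (≈-trans (·-congˡ (≡⇒≈ (cong (om ∘ suc) (sym (*-identityˡ (l + x)))))) (≈-sym (pochFin-suc 1 1 (l + x)))) ⟩
    fin 1 1 (suc l + x) · ∏ (λ ρ → om (ρ + x)) (interval (2 + l) s)
      ≈⟨ extend (suc l) x s ⟩
    fin 1 1 (suc l + s + x)
      ≡⟨ cong (λ e → fin 1 1 (e + x)) (+-suc l s) ⟨
    fin 1 1 (l + suc s + x) ∎
  finite : ∀ c → ∏ (λ ρ → fin ρ n c) (interval 1 n) ≈ fin 1 1 (n * c)
  finite zero    = ≈-trans (∏-cong (interval 1 n) λ ρ → pw λ _ → refl) (≈-trans (∏-𝟙 (interval 1 n)) (≈-trans (pw λ _ → refl) (≡⇒≈ (cong (fin 1 1) (sym (*-zeroʳ n))))))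
  finite (suc c) = begin
    ∏ (λ ρ → fin ρ n (suc c)) (interval 1 n)                              ≈⟨ ∏-cong (interval 1 n) (λ ρ → pochFin-suc ρ n c) ⟩
    ∏ (λ ρ → fin ρ n c · om (ρ + n * c)) (interval 1 n)                   ≈⟨ ∏-· _ _ (interval 1 n) ⟩
    ∏ (λ ρ → fin ρ n c) (interval 1 n) · ∏ (λ ρ → om (ρ + n * c)) (interval 1 n) ≈⟨ ·-congʳ (finite c) ⟩
    fin 1 1 (n * c) · ∏ (λ ρ → om (ρ + n * c)) (interval 1 n)             ≈⟨ extend 0 (n * c) n ⟩
    fin 1 1 (n + n * c)                                                   ≡⟨ cong (fin 1 1) (*-suc n c) ⟨
    fin 1 1 (n * suc c)                                                   ∎

module ThetaProducts (M : ℕ) (0<M : 0 < M) where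
  open Limit M 0<M

  θ : ℕ → Series
  θ ρ = infinite ρ M · infinite (M ∸ ρ) M

  theta₂-< : ∀ {y z} → y < z → theta₂ y z ≈ θ (z ∸ y)
  theta₂-< {y} {z} y<z = ≈-trans (·-cong
    (≡⇒≈ (cong (if_then infinite (z ∸ y) M · infinite (M ∸ (z ∸ y)) M else 𝟙) (<ᵇ-true y<z)))
    (≡⇒≈ (cong (if_then infinite (y ∸ z) M · infinite (M ∸ (y ∸ z)) M else 𝟙) (<ᵇ-false (<⇒≤ y<z)))))
    (·-identityʳ _)

  theta₂-> : ∀ {y z} → z < y → theta₂ y z ≈ θ (y ∸ z)
  theta₂-> z<y = ≈-trans (·-comm _ _) (theta₂-< z<y)

  private
    a b : ℕ → Series
    a s = ∏ (λ d → infinite d M) (interval 1 s)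
    b s = ∏ (λ d → infinite (M ∸ d) M) (interval 1 s)

    ∏-last : ∀ (f : ℕ → Series) s → ∏ f (interval 1 (suc s)) ≈ ∏ f (interval 1 s) · f (suc s)
    ∏-last f s = ≈-trans (≡⇒≈ (cong (∏ f) (trans (cong (interval 1) (+-comm 1 s)) (interval-++ 1 s 1))))
      (≈-trans (∏-++ f (interval 1 s) _) (·-congˡ (·-identityʳ _)))

    row : ∀ l s → ∏ (theta₂ l) (interval (suc l) s) ≈ a s · b s
    row l s = begin
      ∏ (theta₂ l) (interval (suc l) s)                    ≈⟨ ∏-congAll (interval-bounds (suc l) s) (λ z (l<z , _) → theta₂-< l<z) ⟩
      ∏ (λ z → θ (z ∸ l)) (interval (suc l) s)             ≡⟨ cong (λ e → ∏ (λ z → θ (z ∸ l)) (interval e s)) (+-comm 1 l) ⟩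
      ∏ (λ z → θ (z ∸ l)) (interval (l + 1) s)             ≡⟨ cong (∏ (λ z → θ (z ∸ l))) (interval-map l 1 s) ⟩
      ∏ (λ z → θ (z ∸ l)) (map (l +_) (interval 1 s))      ≈⟨ ∏-map _ (l +_) (interval 1 s) ⟩
      ∏ (λ d → θ (l + d ∸ l)) (interval 1 s)               ≈⟨ ∏-cong (interval 1 s) (λ d → ≡⇒≈ (cong θ (m+n∸m≡n l d))) ⟩
      ∏ θ (interval 1 s)                                   ≈⟨ ∏-· _ _ (interval 1 s) ⟩
      a s · b s                                            ∎
      where open ≈-Reasoning

    all-rows : ∀ l s → ∏₂ theta₂ (interval l s) ≈ ∏ a (downFrom s) · ∏ b (downFrom s)
    all-rows l zero    = ≈-sym (·-identityˡ 𝟙)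
    all-rows l (suc s) = ≈-trans (·-cong (row l s) (all-rows (suc l) s))
      (solve 4 (λ a b c d → (a :* b) :* (c :* d) := (a :* c) :* (b :* d)) ≈-refl (a s) (b s) (∏ a (downFrom s)) (∏ b (downFrom s)))
      where open Solver

    -- As s + t = M - 1, the residues M - 1, ..., M - t in `b t` are s + t, ..., s + 1 and continue
    -- those of `a s`.
    complementary : ∀ s t → s + suc t ≡ M → a s · b t ≈ a (s + t)
    complementary s zero    eq = ≈-trans (·-identityʳ _) (≡⇒≈ (cong a (sym (+-identityʳ s))))
    complementary s (suc t) eq = begin
      a s · b (suc t)                              ≈⟨ ·-congˡ (≈-trans (∏-last _ t) (·-comm _ _)) ⟩
      a s · (infinite (M ∸ suc t) M · b t)         ≡⟨ cong (λ e → a s · (infinite e M · b t)) (trans (cong (_∸ suc t) (trans (sym eq) (+-suc s (suc t)))) (m+n∸n≡m (suc s) (suc t))) ⟩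
      a s · (infinite (suc s) M · b t)             ≈⟨ ·-assoc _ _ _ ⟨
      (a s · infinite (suc s) M) · b t             ≈⟨ ·-congʳ (∏-last _ s) ⟨
      a (suc s) · b t                              ≈⟨ complementary (suc s) t (trans (sym (+-suc s (suc t))) eq) ⟩
      a (suc s + t)                                ≡⟨ cong a (+-suc s t) ⟨
      a (s + suc t)                                ∎
      where open ≈-Reasoning

    balanced : ∀ s t → s + t ≡ M → ∏ a (downFrom s) · ∏ b (interval t s) ≈ pow (a (M ∸ 1)) s
    balanced zero    t _  = ·-identityˡ 𝟙
    balanced (suc s) t eq = begin
      (a s · ∏ a (downFrom s)) · (b t · ∏ b (interval (suc t) s))
        ≈⟨ solve 4 (λ a b c d → (a :* b) :* (c :* d) := (a :* c) :* (b :* d)) ≈-refl (a s) (∏ a (downFrom s)) (b t) (∏ b (interval (suc t) s)) ⟩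
      (a s · b t) · (∏ a (downFrom s) · ∏ b (interval (suc t) s))
        ≈⟨ ·-cong (≈-trans (complementary s t (trans (+-suc s t) eq)) (≡⇒≈ (cong a (cong (_∸ 1) eq)))) (balanced s (suc t) (trans (+-suc s t) eq)) ⟩
      a (M ∸ 1) · pow (a (M ∸ 1)) s ∎
      where
      open ≈-Reasoning
      open Solver

  -- A row with s labels to its right contributes `a s · b s`. Reversing the order of the b's pairs
  -- `a s` with `b (M − 1 − s)`, which covers every nonzero residue once. Together with a diagonal
  -- factor for the residue 0, each of the M pairs becomes (q; q)_∞.
  Θ-residues : Θ (interval 0 M) ≈ pow (infinite 1 1) M
  Θ-residues = begin
    ∏ (λ _ → infinite M M) (interval 0 M) · ∏₂ theta₂ (interval 0 M)
      ≈⟨ ·-cong (≈-trans (∏-const (infinite M M) (interval 0 M)) (≡⇒≈ (cong (pow (infinite M M)) (length-interval 0 M)))) (all-rows 0 M) ⟩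
    pow (infinite M M) M · (∏ a (downFrom M) · ∏ b (downFrom M))
      ≈⟨ ·-congˡ (·-congˡ (≈-trans (≡⇒≈ (cong (∏ b) (sym (reverse-upTo M)))) (≈-trans (∏-↭ b (↭ᵖ.↭-reverse (upTo M))) (≡⇒≈ (cong (∏ b) (upTo-interval M)))))) ⟩
    pow (infinite M M) M · (∏ a (downFrom M) · ∏ b (interval 0 M))
      ≈⟨ ·-congˡ (balanced M 0 (+-identityʳ M)) ⟩
    pow (infinite M M) M · pow (a (M ∸ 1)) M
      ≈⟨ ≈-trans (·-comm _ _) (≈-sym (pow-· (a (M ∸ 1)) (infinite M M) M)) ⟩
    pow (a (M ∸ 1) · infinite M M) M
      ≈⟨ pow-cong M (≈-trans (≈-trans (·-congˡ (≡⇒≈ (cong (λ e → infinite e M) (sym top)))) (≈-trans (≈-sym (∏-last _ (M ∸ 1))) (≡⇒≈ (cong a top)))) (infinite-classes M 0<M)) ⟩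
    pow (infinite 1 1) M ∎
    where
    open ≈-Reasoning
    top : suc (M ∸ 1) ≡ M
    top = m+[n∸m]≡n 0<M

  series-theta : ∀ ρ → series (theta ρ M) ≈ θ ρ
  series-theta ρ = pw λ _ → refl

  differences : ∀ x s → map (λ b → x + s ∸ b) (descent s) ≡ map (x +_) (interval 1 s)
  differences x zero    = refl
  differences x (suc s) = cong₂ _∷_
    (trans (cong (x + suc s ∸_) (length-replicate s)) (trans (cong (_∸ s) (trans (+-suc x s) (cong suc refl))) (trans (m+n∸n≡m (suc x) s) (+-comm 1 x))))
    (trans (map-cong (λ b → cong (_∸ b) (+-suc x s)) (descent s)) (trans (differences (suc x) s)
      (trans (map-cong (λ d → sym (+-suc x d)) (interval 1 s)) (trans (map-∘ (interval 1 s)) (cong (map (x +_)) (sym (interval-map 1 1 s)))))))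

  row-descent : ∀ x s → ∏ (theta₂ (x + s)) (descent s) ≈ ∏ (λ d → series (theta (x + d) M)) (interval 1 s)
  row-descent x s = begin
    ∏ (theta₂ (x + s)) (descent s)                        ≈⟨ ∏-congAll (descent-bounds s) (λ b b<s → theta₂-> (<-≤-trans b<s (m≤n+m s x))) ⟩
    ∏ (λ b → θ (x + s ∸ b)) (descent s)                   ≈⟨ ∏-map θ (λ b → x + s ∸ b) (descent s) ⟨
    ∏ θ (map (λ b → x + s ∸ b) (descent s))               ≡⟨ cong (∏ θ) (differences x s) ⟩
    ∏ θ (map (x +_) (interval 1 s))                       ≈⟨ ∏-map θ (x +_) (interval 1 s) ⟩
    ∏ (λ d → θ (x + d)) (interval 1 s)                    ≈⟨ ∏-cong (interval 1 s) (λ d → series-theta (x + d)) ⟨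
    ∏ (λ d → series (theta (x + d) M)) (interval 1 s)     ∎
    where open ≈-Reasoning

  private
    range-1 : ∀ n → range 1 n ≡ interval 1 n
    range-1 n = trans (cong (map suc) (upTo-interval n)) (sym (interval-map 1 0 n))

  theta-row : ∀ x n → ∏ (theta₂ (x + n)) (descent n) ≈ series (prodL (map (λ i → theta (i + x) M) (range 1 n)))
  theta-row x n = ≈-trans (row-descent x n) (≈-trans (∏-cong (interval 1 n) λ d → ≡⇒≈ (cong (λ e → series (theta e M)) (+-comm x d)))
    (≈-trans (≡⇒≈ (cong (∏ _) (sym (range-1 n)))) (≈-sym (series-∏ _ (range 1 n)))))

  -- The rows of `descent n` start at its largest label and have n - 1, ..., 0 factors, like the
  -- blocks i = 1, ..., n.
  theta-triangle : ∀ n → ∏₂ theta₂ (descent n) ≈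
    series (prodL (concatMap (λ i → map (λ j → theta (j ∸ i) M) (range (suc i) n)) (range 1 n)))
  theta-triangle n = ≈-trans (go 1 n refl) (≈-sym (≈-trans (≡⇒≈ (cong (λ l → series (prodL (concatMap block l))) (range-1 n))) (blocks (interval 1 n))))
    where
    block : ℕ → List PS
    block i = map (λ j → theta (j ∸ i) M) (range (suc i) n)
    prodL-++ : ∀ fs gs → series (prodL (fs ++ gs)) ≈ series (prodL fs) · series (prodL gs)
    prodL-++ []       gs = ≈-trans (≈-sym (·-identityˡ _)) (·-congʳ (pw λ _ → refl))
    prodL-++ (f ∷ fs) gs = ≈-trans (pw λ _ → refl) (≈-trans (·-congˡ {series f} (prodL-++ fs gs))
      (≈-trans (≈-sym (·-assoc _ _ _)) (·-congʳ (pw λ _ → refl))))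
    blocks : ∀ is → series (prodL (concatMap block is)) ≈ ∏ (series ∘ prodL ∘ block) is
    blocks []       = pw λ _ → refl
    blocks (i ∷ is) = ≈-trans (prodL-++ (block i) (concatMap block is)) (·-congˡ (blocks is))
    block-row : ∀ l s → l + suc s ≡ suc n → ∏ (theta₂ s) (descent s) ≈ series (prodL (block l))
    block-row l s eq = begin
      ∏ (theta₂ s) (descent s)                              ≈⟨ row-descent 0 s ⟩
      ∏ (λ d → series (theta d M)) (interval 1 s)           ≈⟨ ∏-cong (interval 1 s) (λ d → ≡⇒≈ (cong (λ e → series (theta e M)) (sym (m+n∸m≡n l d)))) ⟩
      ∏ (λ d → series (theta (l + d ∸ l) M)) (interval 1 s) ≈⟨ ∏-map _ (l +_) (interval 1 s) ⟨
      ∏ (λ j → series (theta (j ∸ l) M)) (map (l +_) (interval 1 s)) ≡⟨ cong (∏ _) (trans (sym (interval-map l 1 s)) (trans (cong (λ e → interval e s) (+-comm l 1)) (sym rng))) ⟩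
      ∏ (λ j → series (theta (j ∸ l) M)) (range (suc l) n)  ≈⟨ series-∏ _ (range (suc l) n) ⟨
      series (prodL (block l))                              ∎
      where
      open ≈-Reasoning
      n∸l : n ∸ l ≡ s
      n∸l = trans (cong (_∸ l) (sym (suc-injective (trans (sym (+-suc l s)) eq)))) (m+n∸m≡n l s)
      rng : range (suc l) n ≡ interval (suc l) s
      rng = trans (cong (map (suc l +_)) (trans (cong upTo n∸l) (upTo-interval s)))
        (trans (sym (interval-map (suc l) 0 s)) (cong (λ e → interval e s) (+-identityʳ (suc l))))
    go : ∀ l s → l + s ≡ suc n → ∏₂ theta₂ (descent s) ≈ ∏ (series ∘ prodL ∘ block) (interval l s)
    go l zero    _  = ≈-refl
    go l (suc s) eq = ·-cong (≈-trans (≡⇒≈ (cong (λ e → ∏ (theta₂ e) (descent s)) (length-replicate s))) (block-row l s eq)) (go (suc l) s (trans (sym (+-suc l s)) eq))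

-- Evaluation of Q

private
  series-⊛ : ∀ f g → series (f ⊛ g) ≈ series f · series g
  series-⊛ f g = pw λ _ → refl

  series-mono-⊛ : ∀ e g → series (mono e ⊛ g) ≈ q^ e · series g
  series-mono-⊛ e g = pw λ _ → refl

  series-⊛-inv : ∀ f g → series (f ⊛ inv g) ≈ series f · inverse (series g)
  series-⊛-inv f g = pw λ _ → refl

  series-pow : ∀ f e → series (powPS f e) ≈ pow (series f) e
  series-pow f zero    = pw λ _ → refl
  series-pow f (suc e) = ≈-trans (series-⊛ f _) (·-congˡ (series-pow f e))

  pow-unit : ∀ f e → coef f 0 ≡ ℤ.+ 1 → coef (pow f e) 0 ≡ ℤ.+ 1
  pow-unit f zero    _  = refl
  pow-unit f (suc e) f0 = ·-unit f (pow f e) f0 (pow-unit f e f0)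

  pow-+ : ∀ f a b → pow f (a + b) ≈ pow f a · pow f b
  pow-+ f zero    b = ≈-sym (·-identityˡ _)
  pow-+ f (suc a) b = ≈-trans (·-congˡ (pow-+ f a b)) (≈-sym (·-assoc _ _ _))

  pow-inverse : ∀ f e → coef f 0 ≡ ℤ.+ 1 → pow f e · pow (inverse f) e ≈ 𝟙
  pow-inverse f e f0 = ≈-trans (≈-sym (pow-· f (inverse f) e)) (≈-trans (pow-cong e (inverse-right f f0)) (pow-𝟙 e))
    where
    pow-𝟙 : ∀ e → pow 𝟙 e ≈ 𝟙
    pow-𝟙 zero    = ≈-refl
    pow-𝟙 (suc e) = ≈-trans (·-identityˡ _) (pow-𝟙 e)

  infinite-unit : ∀ {a} b → 0 < a → coef (infinite a b) 0 ≡ ℤ.+ 1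
  infinite-unit {suc a} b _ = trans (at (pochFin-suc (suc a) b 0) 0) (·-unit (series (pochFin (suc a) b 0)) (om (suc a + b * 0)) refl refl)

  count-++ : ∀ i xs ys → count i (xs ++ ys) ≡ count i xs + count i ys
  count-++ i []       ys = refl
  count-++ i (x ∷ xs) ys with x ≡ᵇ i
  ... | true  = cong suc (count-++ i xs ys)
  ... | false = count-++ i xs ys

  count-zeros : ∀ s → count 0 (replicate s 0) ≡ s
  count-zeros zero    = refl
  count-zeros (suc s) = cong suc (count-zeros s)

  count-suc-zeros : ∀ i s → count (suc i) (replicate s 0) ≡ 0
  count-suc-zeros i zero    = refl
  count-suc-zeros i (suc s) = count-suc-zeros i s

  count-0-positive : ∀ {xs} → All (0 <_) xs → count 0 xs ≡ 0
  count-0-positive []             = refl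
  count-0-positive (s≤s z≤n ∷ ps) = count-0-positive ps

  ≤maxPart : ∀ xs → All (_≤ maxPart xs) xs
  ≤maxPart []       = []
  ≤maxPart (x ∷ xs) = m≤m⊔n x (maxPart xs) ∷ All.map (λ p → ≤-trans p (m≤n⊔m x (maxPart xs))) (≤maxPart xs)

  -- Collects the denominators (1 - t)^(m_i) of v_λ into (1 - t)^N, as every part is counted under
  -- exactly one value i.
  pow-count : ∀ f {B} xs → All (_< B) xs → ∏ (λ i → pow f (count i xs)) (interval 0 B) ≈ pow f (length xs)
  pow-count f {B} []       []         = ∏-𝟙 (interval 0 B)
  pow-count f {B} (x ∷ xs) (x<B ∷ ps) = begin
    ∏ (λ i → pow f (count i (x ∷ xs))) (interval 0 B)
      ≈⟨ ∏-cong (interval 0 B) bump ⟩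
    ∏ (λ i → (if x ≡ᵇ i then f else 𝟙) · pow f (count i xs)) (interval 0 B)
      ≈⟨ ∏-· _ _ (interval 0 B) ⟩
    ∏ (λ i → if x ≡ᵇ i then f else 𝟙) (interval 0 B) · ∏ (λ i → pow f (count i xs)) (interval 0 B)
      ≈⟨ ·-cong (hit 0 B z≤n x<B) (pow-count f xs ps) ⟩
    f · pow f (length xs) ∎
    where
    open ≈-Reasoning
    bump : ∀ i → pow f (count i (x ∷ xs)) ≈ (if x ≡ᵇ i then f else 𝟙) · pow f (count i xs)
    bump i with x ≡ᵇ i
    ... | true  = ≈-refl
    ... | false = ≈-sym (·-identityˡ _)
    miss : ∀ l s → x < l → ∏ (λ i → if x ≡ᵇ i then f else 𝟙) (interval l s) ≈ 𝟙
    miss l zero    _   = ≈-refl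
    miss l (suc s) x<l with x ≡ᵇ l | ≡ᵇ⇒≡ x l
    ... | true  | e = contradiction (e _) (<⇒≢ x<l)
    ... | false | _ = ≈-trans (·-identityˡ _) (miss (suc l) s (m<n⇒m<1+n x<l))
    hit : ∀ l s → l ≤ x → x < l + s → ∏ (λ i → if x ≡ᵇ i then f else 𝟙) (interval l s) ≈ f
    hit l zero    l≤x x<l = contradiction (subst (x <_) (+-identityʳ l) x<l) (≤⇒≯ l≤x)
    hit l (suc s) l≤x x< with x ≡ᵇ l | ≡ᵇ⇒≡ x l | ≡⇒≡ᵇ x l
    ... | true  | e | _ = ≈-trans (·-congˡ (miss (suc l) s (s≤s (≤-reflexive (e _))))) (·-identityʳ f)
    ... | false | _ | e = ≈-trans (·-identityˡ _) (hit (suc l) s (≤∧≢⇒< l≤x (e ∘ sym)) (subst (x <_) (+-suc l s) x<))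

-- The normalisation of Q: b_λ / v_λ = (1 − t)^N / (t; t)_{m₀}.
module Normalisation (n : ℕ) (0<n : 0 < n) where
  open Chain n 0<n using (poch)

  series-tPoch : ∀ μ → series (tPoch n μ) ≈ poch μ
  series-tPoch zero    = pw λ _ → refl
  series-tPoch (suc μ) = begin
    series (tPoch n (suc μ))                  ≈⟨ series-∏ _ (upTo (suc μ)) ⟩
    ∏ factor (upTo (suc μ))                   ≡⟨ cong (∏ factor) (upTo-∷ʳ μ) ⟨
    ∏ factor (upTo μ ++ μ ∷ [])               ≈⟨ ∏-++ factor (upTo μ) (μ ∷ []) ⟩
    ∏ factor (upTo μ) · (factor μ · 𝟙)        ≈⟨ ·-cong (≈-trans (≈-sym (series-∏ _ (upTo μ))) (series-tPoch μ)) (≈-trans (·-identityʳ _) (series-om (n * suc μ))) ⟩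
    poch μ · om (n * suc μ)                   ≈⟨ ·-comm _ _ ⟩
    poch (suc μ)                              ∎
    where
    open ≈-Reasoning
    factor : ℕ → Series
    factor j = series (onePS ⊖ mono (n * suc j))

  poch-unit : ∀ μ → coef (poch μ) 0 ≡ ℤ.+ 1
  poch-unit zero    = refl
  poch-unit (suc μ) = ·-unit (om (n * suc μ)) (poch μ) (om-unit (*-mono-≤ 0<n (s≤s z≤n))) (poch-unit μ)

  private
    v : ℕ → Series
    v μ = series (vFactor n μ)

    series-pow-om : ∀ μ → series (powPS (onePS ⊖ mono n) μ) ≈ pow (om n) μ
    series-pow-om μ = ≈-trans (series-pow (onePS ⊖ mono n) μ) (pow-cong μ (series-om n))

    v-pow : ∀ μ → v μ · pow (om n) μ ≈ poch μ
    v-pow μ = begin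
      v μ · pow (om n) μ
        ≈⟨ ·-cong (series-⊛-inv (tPoch n μ) (powPS (onePS ⊖ mono n) μ)) (≈-sym (series-pow-om μ)) ⟩
      (series (tPoch n μ) · inverse p) · p
        ≈⟨ solve 3 (λ t i p → (t :* i) :* p := t :* (p :* i)) ≈-refl (series (tPoch n μ)) (inverse p) p ⟩
      series (tPoch n μ) · (p · inverse p)
        ≈⟨ ·-cong (series-tPoch μ) (inverse-right p (trans (at (series-pow-om μ) 0) (pow-unit (om n) μ (om-unit 0<n)))) ⟩
      poch μ · 𝟙   ≈⟨ ·-identityʳ _ ⟩
      poch μ       ∎
      where
      open ≈-Reasoning
      open Solver
      p = series (powPS (onePS ⊖ mono n) μ)

  module _ (N : ℕ) (lam : List ℕ) (positive : All (0 <_) lam) (ℓ≤N : length lam ≤ N) where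
    private
      s = N ∸ length lam
      c : ℕ → ℕ
      c i = count i (pad N lam)
      bound = suc (maxPart lam)
      vs = series (vλ n N lam)

      length-pad : length (pad N lam) ≡ N
      length-pad = trans (length-++ lam) (trans (cong (length lam +_) (length-replicate s)) (m+[n∸m]≡n ℓ≤N))

      c-0 : c 0 ≡ s
      c-0 = trans (count-++ 0 lam (replicate s 0)) (cong₂ _+_ (count-0-positive positive) (count-zeros s))

      c-suc : ∀ i → c (suc i) ≡ count (suc i) lam
      c-suc i = trans (count-++ (suc i) lam (replicate s 0)) (trans (cong (count (suc i) lam +_) (count-suc-zeros i s)) (+-identityʳ _))

      pad-bound : All (_< bound) (pad N lam)
      pad-bound = Allᵖ.++⁺ (All.map s≤s (≤maxPart lam)) (Allᵖ.replicate⁺ s (s≤s z≤n))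

      vs-≈ : vs ≈ ∏ (v ∘ c) (interval 0 bound)
      vs-≈ = ≈-trans (series-∏ (vFactor n ∘ c) (upTo bound)) (≡⇒≈ (cong (∏ (v ∘ c)) (upTo-interval bound)))

      bs-≈ : series (bλ n lam) ≈ ∏ (poch ∘ c) (interval 1 (maxPart lam))
      bs-≈ = begin
        series (bλ n lam)                                                  ≈⟨ series-∏ _ (range 1 (maxPart lam)) ⟩
        ∏ (λ i → series (tPoch n (count i lam))) (map suc (upTo (maxPart lam))) ≈⟨ ∏-map _ suc (upTo (maxPart lam)) ⟩
        ∏ (λ i → series (tPoch n (count (suc i) lam))) (upTo (maxPart lam)) ≈⟨ ∏-cong (upTo (maxPart lam)) (λ i → ≈-trans (series-tPoch (count (suc i) lam)) (≡⇒≈ (cong poch (sym (c-suc i))))) ⟩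
        ∏ (poch ∘ c ∘ suc) (upTo (maxPart lam))                            ≈⟨ ∏-map _ suc (upTo (maxPart lam)) ⟨
        ∏ (poch ∘ c) (map suc (upTo (maxPart lam)))                        ≡⟨ cong (∏ (poch ∘ c)) (trans (cong (map suc) (upTo-interval (maxPart lam))) (sym (interval-map 1 0 (maxPart lam)))) ⟩
        ∏ (poch ∘ c) (interval 1 (maxPart lam))                            ∎
        where open ≈-Reasoning

      vs-pow : vs · pow (om n) N ≈ poch s · series (bλ n lam)
      vs-pow = begin
        vs · pow (om n) N
          ≈⟨ ·-cong vs-≈ (≈-sym (≈-trans (pow-count (om n) (pad N lam) pad-bound) (≡⇒≈ (cong (pow (om n)) length-pad)))) ⟩
        ∏ (v ∘ c) (interval 0 bound) · ∏ (pow (om n) ∘ c) (interval 0 bound)      ≈⟨ ∏-· _ _ (interval 0 bound) ⟨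
        ∏ (λ i → v (c i) · pow (om n) (c i)) (interval 0 bound)               ≈⟨ ∏-cong (interval 0 bound) (λ i → v-pow (c i)) ⟩
        poch (c 0) · ∏ (poch ∘ c) (interval 1 (maxPart lam))              ≈⟨ ·-cong (≡⇒≈ (cong poch c-0)) (≈-sym bs-≈) ⟩
        poch s · series (bλ n lam)                                        ∎
        where open ≈-Reasoning

      vs-unit : coef vs 0 ≡ ℤ.+ 1
      vs-unit = trans (at vs-≈ 0) (∏-unit (v ∘ c) (interval 0 bound) λ i →
        ·-unit (series (tPoch n (c i))) (inverse (series (powPS (onePS ⊖ mono n) (c i)))) (trans (at (series-tPoch (c i)) 0) (poch-unit (c i))) refl)

    hlQ-≈ : series (hlQ n N lam) · poch s ≈ pow (om n) N · series (symSum n N (pad N lam))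
    hlQ-≈ = begin
      series (hlQ n N lam) · poch s                 ≈⟨ ·-congʳ (≈-trans (series-⊛ (bλ n lam) _) (·-congˡ hlP-≈)) ⟩
      (b · (inverse vs · S)) · poch s               ≈⟨ solve 4 (λ b i s p → (b :* (i :* s)) :* p := (i :* (p :* b)) :* s) ≈-refl b (inverse vs) S (poch s) ⟩
      (inverse vs · (poch s · b)) · S               ≈⟨ ·-congʳ (·-congˡ vs-pow) ⟨
      (inverse vs · (vs · pow (om n) N)) · S        ≈⟨ solve 4 (λ i v p s → (i :* (v :* p)) :* s := (v :* i) :* (p :* s)) ≈-refl (inverse vs) vs (pow (om n) N) S ⟩
      (vs · inverse vs) · (pow (om n) N · S)        ≈⟨ ≈-trans (·-congʳ (inverse-right vs vs-unit)) (·-identityˡ _) ⟩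
      pow (om n) N · S                              ∎
      where
      open ≈-Reasoning
      open Solver
      b = series (bλ n lam)
      S = series (symSum n N (pad N lam))
      hlP-≈ : series (hlP n N lam) ≈ inverse vs · S
      hlP-≈ with length lam ≤ᵇ N | ≤⇒≤ᵇ ℓ≤N
      ... | true | _ = pw λ _ → refl

  open Alphabet n 0<n

  series-symSum : ∀ N lam → length lam ≡ N → series (symSum n N lam) ≈ sym-sum lam (upTo N)
  series-symSum N lam len = ≈-trans (series-∑ _ (perms (upTo N))) (≈-trans (∑-cong (perms (upTo N)) λ w → series-mono-⊛ (sumℕ (zipWith _*_ lam w)) (pairProd n w))
    (perms-sym-sum lam (upTo N) (trans len (sym (length-upTo N)))))

  upTo-distinct : ∀ N → Distinct (upTo N)
  upTo-distinct N = subst Distinct (sym (upTo-interval N)) (go 0 N)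
    where
    go : ∀ l s → Distinct (interval l s)
    go l zero    = []
    go l (suc s) = All.map (<⇒≢ ∘ proj₁) (interval-bounds (suc l) s) ∷ go (suc l) s

  hlQ-poch : ∀ m k r s lam → All (0 <_) lam → length lam ≤ suc r + s → pad (suc r + s) lam ≡ replicate r m ++ k ∷ replicate s 0 →
    series (hlQ n (suc r + s) lam) · poch (suc r + s ∸ length lam) ≈ ΨN m k r (upTo (suc r + s)) · poch s
  hlQ-poch m k r s lam positive ℓ≤N pad≡ = begin
    series (hlQ n N lam) · poch (N ∸ length lam)         ≈⟨ hlQ-≈ N lam positive ℓ≤N ⟩
    pow (om n) N · series (symSum n N (pad N lam))       ≡⟨ cong (λ l → pow (om n) N · series (symSum n N l)) pad≡ ⟩
    pow (om n) N · series (symSum n N λ∗)                ≈⟨ ·-congˡ (series-symSum N λ∗ (trans (length-++ (replicate r m))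
                                                              (trans (cong₂ _+_ (length-replicate r) (cong suc (length-replicate s))) (+-suc r s)))) ⟩
    pow (om n) N · sym-sum λ∗ (upTo N)                   ≡⟨ cong (λ l → pow (om n) l · sym-sum λ∗ (upTo N)) (length-upTo N) ⟨
    pow (om n) (length (upTo N)) · sym-sum λ∗ (upTo N)   ≈⟨ sym-sum-ΨN m k r s (upTo N) (length-upTo N) (upTo-distinct N) ⟩
    ΨN m k r (upTo N) · poch s                           ∎
    where
    open ≈-Reasoning
    N = suc r + s
    λ∗ = replicate r m ++ k ∷ replicate s 0

  -- For k = 0 the part k still occupies the place r + 1, which costs a factor 1 − t^{N−r}.
  hlQ-ΨN : ∀ m k r K s → 1 ≤ m → K ≤ s → series (hlQ n (suc r + s) (mrk m r k)) ≈[ K ] ΨN m k r (upTo (suc r + s))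
  hlQ-ΨN m zero r K s 1≤m K≤s = begin
    Q                    ≈⟨ truncate K (·-identityʳ Q) ⟨
    Q · 𝟙                ≈⟨ ·-cong[] {f = Q} ≈[]-refl (om-one[] (≤-trans K≤s (≤-trans (n≤1+n s) (m≤n*m (suc s) n ⦃ >-nonZero 0<n ⦄)))) ⟨
    Q · om (n * suc s)   ≈⟨ truncate K (·-unit-cancel (poch s) (poch-unit s) (≈-trans (regroup (poch s) Q (om (n * suc s))) (≈-trans exact (·-comm _ _)))) ⟩
    ΨN m 0 r (upTo N)    ∎
    where
    open ≈[]-Reasoning K
    N = suc r + s
    lam = mrk m r 0
    Q = series (hlQ n N lam)
    regroup : ∀ p q o → p · (q · o) ≈ q · (o · p)
    regroup = solve 3 (λ p q o → p :* (q :* o) := q :* (o :* p)) ≈-refl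
      where open Solver
    len : length lam ≡ r
    len = trans (length-++ (replicate r m)) (trans (+-identityʳ _) (length-replicate r))
    s≡ : N ∸ length lam ≡ suc s
    s≡ = trans (cong (N ∸_) len) (trans (cong (_∸ r) (sym (+-suc r s))) (m+n∸m≡n r (suc s)))
    exact : Q · poch (suc s) ≈ ΨN m 0 r (upTo N) · poch s
    exact = ≈-trans (·-congˡ (≡⇒≈ (cong poch (sym s≡)))) (hlQ-poch m 0 r s lam (Allᵖ.++⁺ (Allᵖ.replicate⁺ r 1≤m) [])
      (subst (_≤ N) (sym len) (m≤n⇒m≤1+n (m≤m+n r s))) (cong₂ (λ x e → x ++ replicate e 0) (++-identityʳ (replicate r m)) s≡))
  hlQ-ΨN m k@(suc _) r K s 1≤m K≤s = truncate K (·-unit-cancel (poch s) (poch-unit s)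
    (≈-trans (·-comm _ _) (≈-trans (·-congˡ (≡⇒≈ (cong poch (sym s≡)))) (≈-trans exact (·-comm _ _)))))
    where
    N = suc r + s
    lam = mrk m r k
    len : length lam ≡ suc r
    len = trans (length-++ (replicate r m)) (trans (+-comm _ 1) (cong suc (length-replicate r)))
    s≡ : N ∸ length lam ≡ s
    s≡ = trans (cong (N ∸_) len) (m+n∸m≡n (suc r) s)
    exact = hlQ-poch m k r s lam (Allᵖ.++⁺ (Allᵖ.replicate⁺ r 1≤m) (s≤s z≤n ∷ [])) (subst (_≤ N) (sym len) (m≤m+n (suc r) s))
      (trans (cong (λ e → (replicate r m ++ k ∷ []) ++ replicate e 0) s≡) (++-assoc (replicate r m) (k ∷ []) (replicate s 0)))

-- The coefficientwise limit

private
  tri-C : ∀ r → r C 2 ≡ tri r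
  tri-C zero    = refl
  tri-C (suc r) = trans (sym (nCk+nC[k+1]≡[n+1]C[k+1] r 1)) (cong₂ _+_ (nC1≡n r) (tri-C r))

private
  -- Negative d is included: the right side is 0 by definition, and the left side is a coefficient
  -- below q^a or one of negative index.
  coeffℤ-shift : ∀ (f g : PS) K {a} → series f ≈[ a + K ] q^ a · series g → ∀ d → (∀ e → d ≡ ℤ.+ e → e < K) →
    coeffℤ f (d ℤ.+ ℤ.+ a) ≡ coeffℤ g d
  coeffℤ-shift f g K {a} h (ℤ.+ e) e<K =
    trans (cong f (+-comm e a)) (trans (below h (a + e) (+-monoʳ-< a (e<K e refl))) (coef-q^-· a (series g) e))
  coeffℤ-shift f g K {a} h -[1+ e ] _ with <-≤-connex a (suc e)
  ... | inj₁ a<  = cong (coeffℤ f) {y = ℤ.- ℤ.+ suc (e ∸ a)} (trans (ℤᵖ.⊖-< a<) (cong (λ x → ℤ.- ℤ.+ x) (+-∸-assoc 1 (≤-pred a<))))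
  ... | inj₂ e<a = trans (cong (coeffℤ f) (ℤᵖ.⊖-≥ e<a)) (trans (below h (a ∸ suc e) (<-≤-trans x<a (m≤m+n a K))) (coef-q^-·-< a (series g) (a ∸ suc e) x<a))
    where
    x<a : a ∸ suc e < a
    x<a = ∸-monoʳ-< {a} {suc e} {0} (s≤s z≤n) e<a

  series-product : ∀ a b c d e → series (a ⊛ b ⊛ c ⊛ d ⊛ e) ≈ (((series a · series b) · series c) · series d) · series e
  series-product a b c d e = pw λ _ → refl

module Evaluation (m n′ k : ℕ) (1≤m : 1 ≤ m) (k≤m : k ≤ m) where
  open Comparison m n′ k k≤m
  open ChainLimit m n′ k k≤m

  private
    module C₁ = Chain n 0<n
    module L₁ = Limit n 0<n
    module L₂ = Limit κ 0<κ
    module A₁ = Alphabet n 0<n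

    T = infinite 1 1
    Tκ = infinite κ κ

    hlQ-Ψ : ∀ r K s → r + K + n * suc (suc r + K) ≤ s →
      series (hlQ n (suc r + s) (mrk m r k)) ≈[ K ] C₁.Ψ m k r (C₁.zeros residues)
    hlQ-Ψ r K s bound = begin
      series (hlQ n N (mrk m r k))      ≈⟨ Normalisation.hlQ-ΨN n 0<n m k r K s 1≤m (≤-trans (m≤n+m K r) (≤-trans (m≤m+n _ _) bound)) ⟩
      A₁.ΨN m k r (upTo N)               ≈⟨ truncate K (A₁.ΨN-↭ m k r (subst (λ e → upTo e ↭ Residues.letters n 0<n ρ ρ≤n Q (C₁.zeros residues))
                                             (trans (+-comm (Q * n) ρ) (sym (m≡m%n+[m/n]*n N n))) (Residues.upTo-letters n 0<n ρ ρ≤n Q))) ⟩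
      A₁.ΨN m k r (Residues.letters n 0<n ρ ρ≤n Q (C₁.zeros residues))
        ≈⟨ Letters.ΨN-letters n 0<n (λ y → Q + Residues.extra n 0<n ρ ρ≤n y) K m k r (λ y → ≤-trans long (m≤m+n Q _)) r (C₁.zeros residues)
             (C₁.nearPairs residues-near (labels residues)) (Allᵖ.map⁺ (All.map (λ (_ , y<n) → y<n , ≤-refl) (interval-bounds 0 n))) ⟩
      C₁.Ψ m k r (C₁.zeros residues)    ∎
      where
      open ≈[]-Reasoning K
      N = suc r + s
      Q = N / n
      ρ = N % n
      ρ≤n : ρ ≤ n
      ρ≤n = <⇒≤ (m%n<n N n)
      labels : ∀ ys → map proj₁ (C₁.zeros ys) ≡ ys
      labels []       = refl
      labels (y ∷ ys) = cong (y ∷_) (labels ys)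
      -- The bound on s yields Q ≥ r + K + 2, one more than required.
      long : suc r + K ≤ Q
      long = ≤-trans (≤-trans (n≤1+n _) (≤-reflexive (sym (m*n/n≡m (suc (suc r + K)) n))))
        (/-monoˡ-≤ n (≤-trans (≤-reflexive (*-comm (suc (suc r + K)) n)) (≤-trans (m≤n+m _ (r + K)) (≤-trans bound (m≤n+m s (suc r))))))

    T-unit : coef T 0 ≡ ℤ.+ 1
    T-unit = infinite-unit {1} 1 (s≤s z≤n)

    Tκ-unit : coef Tκ 0 ≡ ℤ.+ 1
    Tκ-unit = infinite-unit κ 0<κ

    Θ-alternant : L₂.Θ alternant ≈ Tκ · (pow Tκ n′ · (series (prodL (map (λ i → theta (i + k) κ) (range 1 n′))) ·
      series (prodL (concatMap (λ i → map (λ j → theta (j ∸ i) κ) (range (suc i) n′)) (range 1 n′)))))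
    Θ-alternant = ≈-trans (·-cong (≈-trans (∏-const Tκ alternant) (≡⇒≈ (cong (pow Tκ) length-alternant)))
      (·-cong (≈-trans (≡⇒≈ (cong (λ e → ∏ (L₂.theta₂ (k + e)) (descent n′)) (length-replicate n′))) (ThetaProducts.theta-row κ 0<κ k n′)) (ThetaProducts.theta-triangle κ 0<κ n′)))
      (·-assoc _ _ _)

    rhs : Series
    rhs = series (rhs41 m n k)

    -- `Θ alternant` contains (q^κ; q^κ)_∞ to the power n, one copy per label. The copy on the left,
    -- which stems from the value of the chain sum for κ, leaves the exponent n - 1, and
    -- `Θ residues` is the denominator (q; q)_∞^n.
    rhs-≈ : Tκ · (L₁.Θ residues · rhs) ≈ infinite n n · L₂.Θ alternant
    rhs-≈ = begin
      Tκ · (L₁.Θ residues · rhs)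
        ≈⟨ ·-congˡ (·-cong (ThetaProducts.Θ-residues n 0<n) expand) ⟩
      Tκ · (pow T n · ((((infinite n n · pow Tκ n′) · pow (inverse T) n) · a) · b))
        ≈⟨ solve 7 (λ t p i q r a b → t :* (p :* ((((i :* q) :* r) :* a) :* b)) := (p :* r) :* (i :* (t :* (q :* (a :* b))))) ≈-refl
             Tκ (pow T n) (infinite n n) (pow Tκ n′) (pow (inverse T) n) a b ⟩
      (pow T n · pow (inverse T) n) · (infinite n n · (Tκ · (pow Tκ n′ · (a · b))))
        ≈⟨ ≈-trans (·-congʳ (pow-inverse T n T-unit)) (·-identityˡ _) ⟩
      infinite n n · (Tκ · (pow Tκ n′ · (a · b)))
        ≈⟨ ·-congˡ Θ-alternant ⟨
      infinite n n · L₂.Θ alternant ∎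
      where
      open ≈-Reasoning
      open Solver
      a = series (prodL (map (λ i → theta (i + k) κ) (range 1 n′)))
      b = series (prodL (concatMap (λ i → map (λ j → theta (j ∸ i) κ) (range (suc i) n′)) (range 1 n′)))
      expand : rhs ≈ (((infinite n n · pow Tκ n′) · pow (inverse T) n) · a) · b
      expand = ≈-trans (series-product (poch∞ n n) _ _ _ _) (·-congʳ (·-congʳ (·-cong (·-congˡ (series-pow (poch∞ κ κ) n′))
        (≈-trans (series-pow (inv (poch∞ 1 1)) n) (pow-cong n (pw λ _ → refl))))))

  hlQ-limit : ∀ K r s → n * (K + K) + K ≤ r → r + (shift r + K) + n * suc (suc r + (shift r + K)) ≤ s →
    series (hlQ n (suc r + s) (mrk m r k)) ≈[ shift r + K ] q^ (shift r) · rhs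
  hlQ-limit K r s r-large s-large = unit-cancel[] (L₁.Θ residues) Θ-unit (unit-cancel[] Tκ Tκ-unit (begin
    Tκ · (L₁.Θ residues · series (hlQ n (suc r + s) (mrk m r k)))
      ≈⟨ ·-cong[] {f = Tκ} ≈[]-refl (·-cong[] {f = L₁.Θ residues} ≈[]-refl (hlQ-Ψ r (shift r + K) s s-large)) ⟩
    Tκ · (L₁.Θ residues · C₁.Ψ m k r (C₁.zeros residues))
      ≈⟨ Ψ-limit K r (≤-trans (m≤m+n _ K) r-large) (≤-trans (m≤n+m K _) r-large) ⟩
    q^ (shift r) · (infinite n n · L₂.Θ alternant)
      ≈⟨ truncate (shift r + K) (≈-trans (·-congˡ (≈-sym rhs-≈)) (solve 4 (λ q t o r → q :* (t :* (o :* r)) := t :* (o :* (q :* r))) ≈-refl (q^ (shift r)) Tκ (L₁.Θ residues) rhs)) ⟩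
    Tκ · (L₁.Θ residues · (q^ (shift r) · rhs)) ∎))
    where
    open ≈[]-Reasoning (shift r + K)
    open Solver
    Θ-unit : coef (L₁.Θ residues) 0 ≡ ℤ.+ 1
    Θ-unit = trans (at (ThetaProducts.Θ-residues n 0<n) 0) (pow-unit T n T-unit)

  limit : ∀ (d : ℤ) → ∃[ R ] ((r : ℕ) → R ≤ r → ∃[ N₀ ] ((N : ℕ) → N₀ ≤ N →
    coeffℤ (hlQ n N (mrk m r k)) (d ℤ.+ ℤ.+ shiftExp m k r) ≡ coeffℤ (rhs41 m n k) d))
  -- `n * (K + K)` makes unbalanced compositions vanish modulo q^K, and the further `K` brings
  -- `poch r` to its limit. K exceeds the absolute value of d. The bound for N depends on r, since
  -- the alphabet must be resolved to the precision q^(shift r + K).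
  limit d = n * (K + K) + K , λ r r-large →
    suc r + bound r , λ N N-large →
      subst₂ (λ N e → coeffℤ (hlQ n N (mrk m r k)) (d ℤ.+ ℤ.+ e) ≡ coeffℤ (rhs41 m n k) d)
        (m+[n∸m]≡n (≤-trans (m≤m+n (suc r) (bound r)) N-large)) (cong (λ t → m * t + k * r) (sym (tri-C r)))
        (coeffℤ-shift (hlQ n (suc r + (N ∸ suc r)) (mrk m r k)) (rhs41 m n k) K
          (hlQ-limit K r (N ∸ suc r) r-large (subst (_≤ N ∸ suc r) (m+n∸m≡n (suc r) (bound r)) (∸-monoˡ-≤ (suc r) N-large)))
          d (λ { e refl → ≤-refl }))
    where
    K = suc ℤ.∣ d ∣
    bound : ℕ → ℕ
    bound r = r + (shift r + K) + n * suc (suc r + (shift r + K))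

theorem4p1 : (m n k : ℕ) → 1 ≤ m → 1 ≤ n → k ≤ m →
    (d : ℤ) →
    ∃[ R ] ((r : ℕ) → R ≤ r →
      ∃[ N₀ ] ((N : ℕ) → N₀ ≤ N →
        coeffℤ (hlQ n N (mrk m r k)) (d ℤ.+ ℤ.+ shiftExp m k r) ≡ coeffℤ (rhs41 m n k) d))
theorem4p1 m (suc n′) k 1≤m _ k≤m = Evaluation.limit m n′ k 1≤m k≤m
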